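{- Let $r\ge2$, $1\le i\le r$, $J\ge0$ be integers and put $\ell=r-i+1$. Then, as formal power series in $q$, $$\mathcal{C}_{(r-1)J+\ell}(q)=\mathrm{HP}^{2J+1}_i.$$
   Context: Fix $r\ge2$. For $1\le i\le r$ let $$\mathcal{C}_i(q)=\prod_{\substack{m\ge1,\ m\not\equiv 2 \ (\mathrm{mod}\ 4)\\ m\not\equiv 0,\ 2r\pm(2i-1)\ (\mathrm{mod}\ 4r)}}\frac{1}{1-q^m},$$ and for $g\ge1$ define recursively $\mathcal{C}_{(r-1)g+1}(q)=\mathcal{C}_{(r-1)(g-1)+r}(q)$ and, for $i=2,\ldots,r$, $$\mathcal{C}_{(r-1)g+i}(q)=\frac{\mathcal{C}_{(r-1)(g-1)+r-i+1}(q)-\mathcal{C}_{(r-1)(g-1)+r-i+2}(q)}{q^{2g(i-1)}}-\frac{\mathcal{C}_{(r-1)g+i-1}(q)}{q}.$$ Let $\mathbb{F}$ be a field of characteristic zero. For $k\ge1$ let $S_k=\mathbb{F}[x_k,x_{k+1},\ldots]$ graded by weight (the monomial $x_{i_1}^{\alpha_1}\cdots x_{i_m}^{\alpha_m}$ has weight $\sum_t i_t\alpha_t$), and for a homogeneous ideal $I$ let $\mathrm{HP}(S_k/I)=\sum_{j\ge0}\dim_{\mathbb{F}}(S_k/I)_j\,q^j$. Define $$L_k=\big(x_{2a-1}^2,\ x_{2b-1}x_{2b}^{r-1},\ x_{2c}^{r-n_1}x_{2c+2}^{n_1},\ x_{2c}^{r-n_2-1}x_{2c+1}x_{2c+2}^{n_2}\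 :\ 2a-1,2b-1,2c\ge k,\ 0\le n_1\le r-1,\ 0\le n_2\le r-2\big)\subseteq S_k,$$ and for $1\le \ell\le r$: if $k$ is even, $$L_k^{\ell}=\big(x_k^{\ell},\ x_k^{\ell-t}x_{k+2}^{r-\ell+t}\ (1\le t\le \ell-1),\ x_k^{\ell-t}x_{k+1}x_{k+2}^{r-\ell+t-1}\ (1\le t\le \ell-1),\ L_{k+1}\big);$$ if $k$ is odd, $L_k^{\ell}=\big(x_k^2,\ x_kx_{k+1}^{\ell-1},\ L_{k+1}^{\ell}\big)$. Put $\mathrm{HP}^{k}_{\ell}=\mathrm{HP}(S_k/L_k^{\ell})$. (Equivalently, $\mathrm{HP}^{2J+1}_i=\sum_{n\ge0}E_{r,i,J}(n)q^n$, where $E_{r,i,J}(n)$ counts partitions of $n$ with no repeated odd part, $\lambda_m-\lambda_{m+r-1}\ge2$ if $\lambda_m$ is odd, $\lambda_m-\lambda_{m+r-1}\ge3$ if $\lambda_m$ is even, all parts $>2J$, and at most $i-1$ parts equal to $2J+1$ or $2J+2$.) -}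

module Defs where

open import Data.Bool using (Bool; true; false; if_then_else_; not; _∧_)
open import Data.Nat as ℕ using (ℕ; zero; suc; _∸_; _≤_; _<_; _≤ᵇ_; _≡ᵇ_; _%_; _/_)
open import Data.Nat.Divisibility using (_∣?_)
open import Data.Integer as ℤ using (ℤ; +_; -[1+_])
open import Data.List using (List; []; _∷_; map; foldr; filterᵇ; upTo; length)
open import Data.List.Membership.Propositional using (_∈_)
open import Data.List.Relation.Unary.Unique.Propositional using (Unique)
open import Data.Vec using (Vec; []; _∷_)
open import Data.Product using (Σ; _×_)
open import Data.Sum using (_⊎_)
open import Relation.Nullary using (¬_; does)
open import Relation.Binary.PropositionalEquality using (_≡_)
open import Function.Bundles using (_⇔_)

PS : Set
PS = ℕ → ℤ

sumTo : ℕ → (ℕ → ℤ) → ℤ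
sumTo zero    h = h 0
sumTo (suc n) h = sumTo n h ℤ.+ h (suc n)

oneₚ : PS
oneₚ zero    = + 1
oneₚ (suc _) = + 0

_*ₚ_ : PS → PS → PS
(f *ₚ g) n = sumTo n (λ j → f j ℤ.* g (n ∸ j))

-- the series 1/(1-q^m) = Σ_j q^(m j)   (used for m ≥ 1)
geom : ℕ → PS
geom m j = if does (m ∣? j) then + 1 else + 0

prodGeom : List ℕ → PS
prodGeom ms = foldr (λ m f → geom m *ₚ f) oneₚ ms

-- the infinite product  Π_{m ≥ 1, allowed m} 1/(1-q^m):
-- its q^n coefficient is the q^n coefficient of the finite product over
-- 1 ≤ m ≤ n (factors with m > n are ≡ 1 mod q^(n+1)).
infProd : (ℕ → Bool) → PS
infProd allowed n = prodGeom (filterᵇ allowed (map suc (upTo n))) n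

-- Laurent-type coefficient functions (coefficient of q^m, m ∈ ℤ);
-- needed because the recursion divides by powers of q.
Ser : Set
Ser = ℤ → ℤ

fromPS : PS → Ser
fromPS f (+ n)      = f n
fromPS f -[1+ _ ]   = + 0

_-ₛ_ : Ser → Ser → Ser
(f -ₛ g) m = f m ℤ.- g m

divQ : ℕ → Ser → Ser
divQ a f m = f (m ℤ.+ + a)

allowedC : ℕ → ℕ → ℕ → Bool
allowedC zero      i m = false   -- junk, r ≥ 2 always in use
allowedC r@(suc _) i m =
  not (m % 4 ≡ᵇ 2) ∧ not (m % (4 ℕ.* r) ≡ᵇ 0)
  ∧ not (m % (4 ℕ.* r) ≡ᵇ (2 ℕ.* r ℕ.+ (2 ℕ.* i ∸ 1)))
  ∧ not (m % (4 ℕ.* r) ≡ᵇ (2 ℕ.* r ∸ (2 ℕ.* i ∸ 1)))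

Cbase : ℕ → ℕ → Ser
Cbase r i = fromPS (infProd (allowedC r i))

-- The recursion.  block r g j = C_{(r-1)g+j} for 1 ≤ j ≤ r.
-- For g ≥ 1:  C_{(r-1)g+1} = C_{(r-1)(g-1)+r}, and for 2 ≤ i ≤ r
--  C_{(r-1)g+i} = (C_{(r-1)(g-1)+r-i+1} - C_{(r-1)(g-1)+r-i+2}) / q^{2g(i-1)}
--                 - C_{(r-1)g+i-1} / q.

next : ℕ → ℕ → (ℕ → Ser) → ℕ → Ser
next r g prev zero          = λ _ → + 0   -- junk (index 0)
next r g prev (suc zero)    = prev r
next r g prev (suc (suc k)) =
  (divQ (2 ℕ.* g ℕ.* suc k) (prev (r ∸ i ℕ.+ 1) -ₛ prev (r ∸ i ℕ.+ 2)))
  -ₛ divQ 1 (next r g prev (suc k))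
  where i = suc (suc k)

block : ℕ → ℕ → ℕ → Ser
block r zero    = Cbase r
block r (suc g) = next r (suc g) (block r g)

-- The sequence C_N (N ≥ 1), for r ≥ 2:  if N ≤ r it is the base series,
-- otherwise N = (r-1)g + i with g ≥ 1, 2 ≤ i ≤ r, i.e.
-- g = (N-2) div (r-1), i = (N-2) mod (r-1) + 2.
C : ℕ → ℕ → Ser
C zero          N = λ _ → + 0   -- junk
C (suc zero)    N = λ _ → + 0   -- junk
C r@(suc (suc s)) N =
  if N ≤ᵇ r then Cbase r N
  else block r ((N ∸ 2) / suc s) ((N ∸ 2) % suc s ℕ.+ 2)

-- Monomials of weight n in x_1, x_2, ...: an exponent vector
-- (e_1,...,e_n) ∈ ℕ^n  (a monomial of weight n only involves x_v, v ≤ n).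

expo : ∀ {n} → Vec ℕ n → ℕ → ℕ
expo []       v             = 0
expo (x ∷ xs) zero          = 0        -- there is no x_0
expo (x ∷ xs) (suc zero)    = x
expo (x ∷ xs) (suc (suc v)) = expo xs (suc v)

wt : ∀ {n} → ℕ → Vec ℕ n → ℕ
wt o []       = 0
wt o (x ∷ xs) = o ℕ.* x ℕ.+ wt (suc o) xs

weight : ∀ {n} → Vec ℕ n → ℕ
weight = wt 1

-- the monomial lies in S_k = F[x_k, x_{k+1}, ...]
InS : ∀ {n} → ℕ → Vec ℕ n → Set
InS k e = ∀ v → v < k → expo e v ≡ 0

-- Membership of a monomial in the monomial ideals (a monomial lies in a
-- monomial ideal iff it is divisible by one of the generators).

InL : ∀ {n} → (r k : ℕ) → Vec ℕ n → Set
InL r k e =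
    (Σ ℕ λ a → k ≤ 2 ℕ.* a ℕ.+ 1 × 2 ≤ expo e (2 ℕ.* a ℕ.+ 1))
  ⊎ (Σ ℕ λ b → k ≤ 2 ℕ.* b ℕ.+ 1 × 1 ≤ expo e (2 ℕ.* b ℕ.+ 1)
                 × r ∸ 1 ≤ expo e (2 ℕ.* b ℕ.+ 2))
  ⊎ (Σ ℕ λ c → k ≤ 2 ℕ.* c × Σ ℕ λ n₁ → n₁ ≤ r ∸ 1
                 × r ∸ n₁ ≤ expo e (2 ℕ.* c) × n₁ ≤ expo e (2 ℕ.* c ℕ.+ 2))
  ⊎ (Σ ℕ λ c → k ≤ 2 ℕ.* c × Σ ℕ λ n₂ → n₂ ≤ r ∸ 2
                 × r ∸ n₂ ∸ 1 ≤ expo e (2 ℕ.* c) × 1 ≤ expo e (2 ℕ.* c ℕ.+ 1)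
                 × n₂ ≤ expo e (2 ℕ.* c ℕ.+ 2))

InLeven : ∀ {n} → (r k ℓ : ℕ) → Vec ℕ n → Set
InLeven r k ℓ e =
    ℓ ≤ expo e k
  ⊎ (Σ ℕ λ t → 1 ≤ t × t ≤ ℓ ∸ 1 × ℓ ∸ t ≤ expo e k
                 × r ∸ ℓ ℕ.+ t ≤ expo e (k ℕ.+ 2))
  ⊎ (Σ ℕ λ t → 1 ≤ t × t ≤ ℓ ∸ 1 × ℓ ∸ t ≤ expo e k × 1 ≤ expo e (k ℕ.+ 1)
                 × r ∸ ℓ ℕ.+ t ∸ 1 ≤ expo e (k ℕ.+ 2))
  ⊎ InL r (k ℕ.+ 1) e

InLodd : ∀ {n} → (r k ℓ : ℕ) → Vec ℕ n → Set
InLodd r k ℓ e =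
    2 ≤ expo e k
  ⊎ (1 ≤ expo e k × ℓ ∸ 1 ≤ expo e (k ℕ.+ 1))
  ⊎ InLeven r (k ℕ.+ 1) ℓ e

-- standard monomials of weight n of S_k / L_k^ℓ (k odd); they form an
-- F-basis of the degree-n part (S_k/L_k^ℓ)_n.
StdOdd : (r k ℓ n : ℕ) → Vec ℕ n → Set
StdOdd r k ℓ n e = weight e ≡ n × InS k e × ¬ InLodd r k ℓ e

HasSize : {A : Set} → (A → Set) → ℕ → Set
HasSize {A} P N =
  Σ (List A) λ xs → Unique xs × (∀ x → (x ∈ xs) ⇔ P x) × length xs ≡ N

-- coefficient of q^n in HP^k_ℓ = HP(S_k / L_k^ℓ), k odd, is N
HPoddCoeff : (r k ℓ n N : ℕ) → Set
HPoddCoeff r k ℓ n N = HasSize (StdOdd r k ℓ n) N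

{-# OPTIONS --safe #-}
-- Write E(J,k,b) for HP^{2J+1}_{k+1} with r = k+b+1.  Splitting off the exponents of x_{2J+1} and
-- x_{2J+2} gives
--   E(J,0,b)   = E(J+1,b,0),
--   E(J,k+1,b) = E(J,k,b+1) + q^{(2J+2)(k+1)} E(J+1,b,k+1) + q^{(2J+2)k+2J+1} E(J+1,b+1,k),
-- which is the recursion of the C's read backwards, so only J = 0 (the Göllnitz-Gordon-Andrews
-- identities) remains.  Andrews' alternating series
--   A(J,k,b) = Σ_{n∈ℤ} (-1)ⁿ q^{2rn(n+J+1)+n-2(k+1)n} ∏_{s=1}^{J} (1-q^{2n+2s}) / ∏_{s=0}^{J-1} (1+q^{2n+2s+1})
-- satisfies the same recursion and tends to (q²;q²)_∞/(-q;q²)_∞ as J → ∞, where E tends to 1;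
-- hence A = E · (q²;q²)_∞/(-q;q²)_∞, and A(0,k,b) is a product by Jacobi's triple product identity.
-- All of this happens modulo q^{N+1}, where q is nilpotent and every sum and product is finite.
module Submission where

open import Defs
open import Algebra.Bundles using (CommutativeRing)
import Algebra.Solver.Ring as RingSolver
open import Algebra.Solver.Ring.AlmostCommutativeRing using (fromCommutativeRing; _-Raw-AlmostCommutative⟶_)
open import Data.Bool using (Bool; true; false; T; if_then_else_; not; _∧_)
open import Data.Empty using (⊥; ⊥-elim)
open import Data.Integer as ℤ using (ℤ; +_; -[1+_])
import Data.Integer.Properties as ℤₚ
open import Data.Integer.Tactic.RingSolver using () renaming (solve-∀ to ℤ-solve-∀)
open import Data.List using ([]; _∷_; _++_; applyUpTo; filterᵇ; map)
open import Data.List.Membership.Propositional.Properties using (∈-++⁺ˡ; ∈-++⁺ʳ; ∈-++⁻; ∈-map⁺; ∈-map⁻)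
open import Data.List.Properties using (length-++; length-map)
import Data.List.Relation.Unary.All as All
import Data.List.Relation.Unary.AllPairs as AllPairs
open import Data.List.Relation.Unary.Any using (here; there)
import Data.List.Relation.Unary.Unique.Propositional.Properties as Uniqueₚ
open import Data.Maybe using (Maybe; just; nothing)
open import Data.Nat as ℕ using (ℕ; zero; suc; _≤_; _<_; z≤n; s≤s; _∸_; _%_; _≡ᵇ_; NonZero)
import Data.Nat.DivMod as DM
open import Data.Nat.Divisibility using (_∣?_; divides; ∣m∣n⇒∣m+n; ∣m+n∣m⇒∣n; ∣-refl; ∣⇒≤; _∣0; n∣m*n)
import Data.Nat.Properties as ℕₚ
open import Data.Nat.Tactic.RingSolver using (solve-∀)
open import Data.Product using (Σ; ∃; _×_; _,_; proj₁; proj₂)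
import Data.Sign as Sign
open import Data.Sum using (_⊎_; inj₁; inj₂; [_,_])
open import Data.Unit using (⊤; tt)
open import Data.Vec using (Vec; []; _∷_)
open import Function using (_∘_; _⇔_; mk⇔; Equivalence)
open import Function.Properties.Equivalence using () renaming (trans to ⇔-trans)
open import Level using (0ℓ)
open import Relation.Binary.PropositionalEquality as ≡ using (_≡_; _≢_)
open import Relation.Nullary using (¬_; yes; no)
open import Relation.Nullary.Decidable using (does-⇔; dec-true; dec-false)

-- Why the two recursions exist. In a standard monomial the pair of exponents of x_{2a+1}, x_{2a+2}
-- is linked to earlier variables only through the exponent d of x_{2a}: its sum must stay below r -
-- d. So what follows x_{2J+2}^d is counted by the same function one level up, with bound r - d.
-- This is why k and b change places between levels, and why raising the bound by one admits just
-- two new pairs. On the analytic side the factors of the bilateral series have negative powers of q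
-- when n < 0. For -J ≤ n ≤ -1 some factor 1 - q^{2n+2s} is zero, and n ↦ -(n+J+1) carries the other
-- negative indices to n ≥ 0. The series is therefore folded onto n ≥ 0, at the price that comparing
-- levels J and J+1 moves half of each summand by one index. The recursion expresses level J through
-- level J+1 and smaller k, so agreement at all levels J ≥ M propagates down to J = 0. Everything
-- analytic is stated for a nilpotent q in an arbitrary commutative ring; power series modulo
-- q^{N+1} enter only as an instance, with M = N + 1.

-- Ring identities with integer constants over an arbitrary commutative ring.

module IntegerCoefficients (R : CommutativeRing 0ℓ 0ℓ) where

  open CommutativeRing R hiding (zero)
  open import Algebra.Properties.Semiring.Mult.TCOptimised semiring using (×-homo-+; ×1-homo-*) renaming (_×_ to _·_)
  open import Algebra.Properties.Ring ring using (-0#≈0#; -‿+-comm; -‿involutive; -‿distribˡ-*; -‿distribʳ-*)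
  open import Relation.Binary.Reasoning.Setoid setoid

  -- Equality of the series used later is not decidable, so the constants of ring identities are
  -- taken in ℤ, where cancelling coefficients can be recognised.
  fromℤ : ℤ → Carrier
  fromℤ (+ n)    = n · 1#
  fromℤ -[1+ n ] = - (suc n · 1#)

  fromℤ-⊖ : ∀ m n → fromℤ (m ℤ.⊖ n) ≈ m · 1# - n · 1#
  fromℤ-⊖ m zero = sym (trans (+-congˡ -0#≈0#) (+-identityʳ _))
  fromℤ-⊖ zero (suc n) = sym (+-identityˡ _)
  fromℤ-⊖ (suc m) (suc n) = begin
    fromℤ (suc m ℤ.⊖ suc n)                     ≡⟨ ≡.cong fromℤ (ℤₚ.[1+m]⊖[1+n]≡m⊖n m n) ⟩
    fromℤ (m ℤ.⊖ n)                             ≈⟨ fromℤ-⊖ m n ⟩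
    m · 1# - n · 1#                             ≈⟨ +-congʳ (+-identityˡ _) ⟨
    (0# + m · 1#) - n · 1#                      ≈⟨ +-congʳ (+-congʳ (-‿inverseʳ 1#)) ⟨
    ((1# - 1#) + m · 1#) - n · 1#               ≈⟨ +-congʳ (trans (+-assoc _ _ _) (trans (+-congˡ (+-comm _ _)) (sym (+-assoc _ _ _)))) ⟩
    ((1# + m · 1#) - 1#) - n · 1#               ≈⟨ +-assoc _ _ _ ⟩
    (1# + m · 1#) + (- 1# - n · 1#)             ≈⟨ +-cong (sym (×-homo-+ 1# 1 m)) (trans (-‿+-comm _ _) (-‿cong (sym (×-homo-+ 1# 1 n)))) ⟩
    suc m · 1# - suc n · 1#                     ∎

  fromℤ-+ : ∀ i j → fromℤ (i ℤ.+ j) ≈ fromℤ i + fromℤ j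
  fromℤ-+ (+ m) (+ n) = ×-homo-+ 1# m n
  fromℤ-+ (+ m) -[1+ n ] = fromℤ-⊖ m (suc n)
  fromℤ-+ -[1+ m ] (+ n) = trans (fromℤ-⊖ n (suc m)) (+-comm _ _)
  fromℤ-+ -[1+ m ] -[1+ n ] = begin
    - (suc (suc (m ℕ.+ n)) · 1#)      ≡⟨ ≡.cong (λ x → - (x · 1#)) (≡.cong suc (≡.sym (ℕₚ.+-suc m n))) ⟩
    - ((suc m ℕ.+ suc n) · 1#)        ≈⟨ -‿cong (×-homo-+ 1# (suc m) (suc n)) ⟩
    - (suc m · 1# + suc n · 1#)       ≈⟨ -‿+-comm _ _ ⟨
    - (suc m · 1#) - suc n · 1#       ∎

  fromℤ-◃⁻ : ∀ n → fromℤ (Sign.- ℤ.◃ n) ≈ - (n · 1#)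
  fromℤ-◃⁻ zero = sym -0#≈0#
  fromℤ-◃⁻ (suc n) = refl

  fromℤ-◃⁺ : ∀ n → fromℤ (Sign.+ ℤ.◃ n) ≈ n · 1#
  fromℤ-◃⁺ n = reflexive (≡.cong fromℤ (ℤₚ.+◃n≡+n n))

  fromℤ-* : ∀ i j → fromℤ (i ℤ.* j) ≈ fromℤ i * fromℤ j
  fromℤ-* (+ m) (+ n) = trans (fromℤ-◃⁺ (m ℕ.* n)) (×1-homo-* m n)
  fromℤ-* (+ m) -[1+ n ] = trans (fromℤ-◃⁻ (m ℕ.* suc n)) (trans (-‿cong (×1-homo-* m (suc n))) (-‿distribʳ-* _ _))
  fromℤ-* -[1+ m ] (+ n) = trans (fromℤ-◃⁻ (suc m ℕ.* n)) (trans (-‿cong (×1-homo-* (suc m) n)) (-‿distribˡ-* _ _))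
  fromℤ-* -[1+ m ] -[1+ n ] = begin
    (suc m ℕ.* suc n) · 1#              ≈⟨ ×1-homo-* (suc m) (suc n) ⟩
    suc m · 1# * suc n · 1#             ≈⟨ -‿involutive _ ⟨
    - - (suc m · 1# * suc n · 1#)       ≈⟨ -‿cong (-‿distribˡ-* _ _) ⟩
    - (- (suc m · 1#) * suc n · 1#)     ≈⟨ -‿distribʳ-* _ _ ⟩
    - (suc m · 1#) * - (suc n · 1#)     ∎

  fromℤ-neg : ∀ i → fromℤ (ℤ.- i) ≈ - fromℤ i
  fromℤ-neg (+ zero)   = sym -0#≈0#
  fromℤ-neg (+ suc n)  = refl
  fromℤ-neg -[1+ n ]   = sym (-‿involutive _)

  fromℤ-morphism : ℤ.+-*-rawRing -Raw-AlmostCommutative⟶ fromCommutativeRing R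
  fromℤ-morphism = record
    { ⟦_⟧ = fromℤ ; +-homo = fromℤ-+ ; *-homo = fromℤ-* ; -‿homo = fromℤ-neg
    ; 0-homo = refl ; 1-homo = refl }

  fromℤ-≟ : ∀ i j → Maybe (fromℤ i ≈ fromℤ j)
  fromℤ-≟ i j with i ℤₚ.≟ j
  ... | yes i≡j = just (reflexive (≡.cong fromℤ i≡j))
  ... | no _    = nothing

  open RingSolver ℤ.+-*-rawRing (fromCommutativeRing R) fromℤ-morphism fromℤ-≟ public
    using (solve; _:=_; _:+_; _:*_; _:-_; :-_; con)

-- Finite sums and products.

module BigOperators (R : CommutativeRing 0ℓ 0ℓ) where

  open CommutativeRing R hiding (zero)
  open IntegerCoefficients R

  ∑ : ℕ → (ℕ → Carrier) → Carrier
  ∑ zero    f = 0#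
  ∑ (suc n) f = ∑ n f + f n

  ∏ : ℕ → (ℕ → Carrier) → Carrier
  ∏ zero    f = 1#
  ∏ (suc n) f = ∏ n f * f n

  ∑-cong : ∀ n {f g} → (∀ k → k < n → f k ≈ g k) → ∑ n f ≈ ∑ n g
  ∑-cong zero    f≈g = refl
  ∑-cong (suc n) f≈g = +-cong (∑-cong n (λ k k<n → f≈g k (ℕₚ.m<n⇒m<1+n k<n))) (f≈g n ℕₚ.≤-refl)

  ∑-head : ∀ n f → ∑ (suc n) f ≈ f 0 + ∑ n (f ∘ suc)
  ∑-head zero    f = +-comm _ _
  ∑-head (suc n) f = trans (+-congʳ (∑-head n f)) (+-assoc _ _ _)

  ∑-+ : ∀ n f g → ∑ n (λ k → f k + g k) ≈ ∑ n f + ∑ n g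
  ∑-+ zero    f g = sym (+-identityˡ _)
  ∑-+ (suc n) f g = trans (+-congʳ (∑-+ n f g))
    (solve 4 (λ a b c d → (a :+ b) :+ (c :+ d) := (a :+ c) :+ (b :+ d)) refl _ _ _ _)

  *-∑ : ∀ c n f → c * ∑ n f ≈ ∑ n (λ k → c * f k)
  *-∑ c zero    f = zeroʳ c
  *-∑ c (suc n) f = trans (distribˡ c _ _) (+-congʳ (*-∑ c n f))

  ∑-zero : ∀ n {f} → (∀ k → f k ≈ 0#) → ∑ n f ≈ 0#
  ∑-zero zero    f≈0 = refl
  ∑-zero (suc n) f≈0 = trans (+-cong (∑-zero n f≈0) (f≈0 n)) (+-identityʳ _)

  ∑-truncate : ∀ m {f} → (∀ k → m ≤ k → f k ≈ 0#) → ∀ j → ∑ (j ℕ.+ m) f ≈ ∑ m f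
  ∑-truncate m f≈0 zero    = refl
  ∑-truncate m f≈0 (suc j) = trans (+-cong (∑-truncate m f≈0 j) (f≈0 _ (ℕₚ.m≤n+m m j))) (+-identityʳ _)

  ∏-cong : ∀ n {f g} → (∀ k → k < n → f k ≈ g k) → ∏ n f ≈ ∏ n g
  ∏-cong zero    f≈g = refl
  ∏-cong (suc n) f≈g = *-cong (∏-cong n (λ k k<n → f≈g k (ℕₚ.m<n⇒m<1+n k<n))) (f≈g n ℕₚ.≤-refl)

  ∏-head : ∀ n f → ∏ (suc n) f ≈ f 0 * ∏ n (f ∘ suc)
  ∏-head zero    f = *-comm _ _
  ∏-head (suc n) f = trans (*-congʳ (∏-head n f)) (*-assoc _ _ _)

  ∏-* : ∀ n f g → ∏ n (λ k → f k * g k) ≈ ∏ n f * ∏ n g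
  ∏-* zero    f g = sym (*-identityˡ _)
  ∏-* (suc n) f g = trans (*-congʳ (∏-* n f g))
    (solve 4 (λ a b c d → (a :* b) :* (c :* d) := (a :* c) :* (b :* d)) refl _ _ _ _)

  ∏-one : ∀ n {f} → (∀ k → k < n → f k ≈ 1#) → ∏ n f ≈ 1#
  ∏-one zero    f≈1 = refl
  ∏-one (suc n) f≈1 = trans (*-cong (∏-one n (λ k k<n → f≈1 k (ℕₚ.m<n⇒m<1+n k<n))) (f≈1 n ℕₚ.≤-refl)) (*-identityˡ _)

  ∏-truncate : ∀ m {f} → (∀ k → m ≤ k → f k ≈ 1#) → ∀ j → ∏ (j ℕ.+ m) f ≈ ∏ m f
  ∏-truncate m f≈1 zero    = refl
  ∏-truncate m f≈1 (suc j) = trans (*-cong (∏-truncate m f≈1 j) (f≈1 _ (ℕₚ.m≤n+m m j))) (*-identityʳ _)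

  ∏-++ : ∀ m n f → ∏ (n ℕ.+ m) f ≈ ∏ m f * ∏ n (λ j → f (j ℕ.+ m))
  ∏-++ m zero    f = sym (*-identityʳ _)
  ∏-++ m (suc n) f = trans (*-congʳ (∏-++ m n f)) (*-assoc _ _ _)

-- Nilpotent elements, geometric series and units.

module Nilpotents (R : CommutativeRing 0ℓ 0ℓ) where

  open CommutativeRing R hiding (zero)
  open import Algebra.Properties.CommutativeSemiring.Exp commutativeSemiring
  open import Relation.Binary.Reasoning.Setoid setoid
  open IntegerCoefficients R
  open BigOperators R

  ^-vanish : ∀ m {x} → x ^ m ≈ 0# → ∀ {n} → m ≤ n → x ^ n ≈ 0#
  ^-vanish m {x} x^m≈0 {n} m≤n = begin
    x ^ n                     ≡⟨ ≡.cong (x ^_) (ℕₚ.m+[n∸m]≡n m≤n) ⟨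
    x ^ (m ℕ.+ (n ℕ.∸ m))     ≈⟨ ^-homo-* x m _ ⟩
    x ^ m * x ^ (n ℕ.∸ m)     ≈⟨ *-congʳ x^m≈0 ⟩
    0# * x ^ (n ℕ.∸ m)        ≈⟨ zeroˡ _ ⟩
    0#                        ∎

  *-nilpotent : ∀ m {x} y → x ^ m ≈ 0# → (x * y) ^ m ≈ 0#
  *-nilpotent m {x} y x^m≈0 = trans (^-distrib-* x y m) (trans (*-congʳ x^m≈0) (zeroˡ _))

  1-0≈1 : ∀ {x} → x ≈ 0# → 1# - x ≈ 1#
  1-0≈1 x≈0 = trans (+-congˡ (-‿cong x≈0)) (solve 0 (con (+ 1) :- con (+ 0) := con (+ 1)) refl)

  geometric : ℕ → Carrier → Carrier
  geometric m x = ∑ m (x ^_)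

  [1-x]*geometric : ∀ m x → (1# - x) * geometric m x ≈ 1# - x ^ m
  [1-x]*geometric zero    x = solve 1 (λ x → (con (+ 1) :- x) :* con (+ 0) := con (+ 1) :- con (+ 1)) refl x
  [1-x]*geometric (suc m) x = trans (trans (distribˡ _ _ _) (+-congʳ ([1-x]*geometric m x)))
    (solve 2 (λ x y → (con (+ 1) :- y) :+ (con (+ 1) :- x) :* y := con (+ 1) :- x :* y) refl x (x ^ m))

  geometric-inverse : ∀ m {x} → x ^ m ≈ 0# → (1# - x) * geometric m x ≈ 1#
  geometric-inverse m {x} x^m≈0 = trans ([1-x]*geometric m x) (1-0≈1 x^m≈0)

  cancel-unit : ∀ {a a⁻¹ x y} → a * a⁻¹ ≈ 1# → a * x ≈ a * y → x ≈ y
  cancel-unit {a} {a⁻¹} {x} {y} inv ax≈ay = begin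
    x                ≈⟨ *-identityˡ x ⟨
    1# * x           ≈⟨ *-congʳ inv ⟨
    (a * a⁻¹) * x    ≈⟨ solve 3 (λ a b x → a :* b :* x := b :* (a :* x)) refl a a⁻¹ x ⟩
    a⁻¹ * (a * x)    ≈⟨ *-congˡ ax≈ay ⟩
    a⁻¹ * (a * y)    ≈⟨ solve 3 (λ a b x → b :* (a :* x) := a :* b :* x) refl a a⁻¹ y ⟩
    (a * a⁻¹) * y    ≈⟨ *-congʳ inv ⟩
    1# * y           ≈⟨ *-identityˡ y ⟩
    y                ∎

-- Jacobi's triple product for nilpotent u and v, with base Q = uv.

module TripleProduct (R : CommutativeRing 0ℓ 0ℓ) where

  open CommutativeRing R hiding (zero)
  open import Algebra.Properties.CommutativeSemiring.Exp commutativeSemiring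
  open import Relation.Binary.Reasoning.Setoid setoid
  open IntegerCoefficients R
  open BigOperators R
  open Nilpotents R

  -- gauss Q z k = (-z)ᵏ Q^{k(k-1)/2}
  gauss : Carrier → Carrier → ℕ → Carrier
  gauss Q z zero    = 1#
  gauss Q z (suc k) = - (z * Q ^ k) * gauss Q z k

  gauss-cong : ∀ Q {x y} → x ≈ y → ∀ k → gauss Q x k ≈ gauss Q y k
  gauss-cong Q x≈y zero    = refl
  gauss-cong Q x≈y (suc k) = *-cong (-‿cong (*-congʳ x≈y)) (gauss-cong Q x≈y k)

  gauss-multiple : ∀ Q z k → ∃ λ w → gauss Q z k ≈ z ^ k * w
  gauss-multiple Q z zero = 1# , sym (*-identityʳ _)
  gauss-multiple Q z (suc k) with gauss-multiple Q z k
  ... | w , eq = - Q ^ k * w , trans (*-congˡ eq)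
    (solve 4 (λ u x y w → :- (u :* x) :* (y :* w) := (u :* y) :* (:- x :* w)) refl z (Q ^ k) (z ^ k) w)

  gauss-vanish : ∀ Q m {z} → z ^ m ≈ 0# → ∀ {k} → m ≤ k → gauss Q z k ≈ 0#
  gauss-vanish Q m {z} z^m≈0 {k} m≤k with gauss-multiple Q z k
  ... | w , eq = trans eq (trans (*-congʳ (^-vanish m z^m≈0 m≤k)) (zeroˡ w))

  gauss-scale : ∀ Q z k → gauss Q (z * Q) k ≈ Q ^ k * gauss Q z k
  gauss-scale Q z zero = sym (*-identityˡ _)
  gauss-scale Q z (suc k) = trans (*-congˡ (gauss-scale Q z k))
    (solve 4 (λ z q x y → :- (z :* q :* x) :* (x :* y) := (q :* x) :* (:- (z :* x) :* y)) refl z Q (Q ^ k) (gauss Q z k))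

  gauss-zero : ∀ Q {z} → z ≈ 0# → ∀ k → gauss Q z (suc k) ≈ 0#
  gauss-zero Q z≈0 k = trans (*-congʳ (trans (-‿cong (*-congʳ z≈0))
    (solve 1 (λ x → :- (con (+ 0) :* x) := con (+ 0)) refl (Q ^ k)))) (zeroˡ _)

  module _ (u v : Carrier) (M : ℕ) (u^M≈0 : u ^ M ≈ 0#) (v^M≈0 : v ^ M ≈ 0#) where

    private
      Q : Carrier
      Q = u * v

      Q^M≈0 : Q ^ M ≈ 0#
      Q^M≈0 = *-nilpotent M v u^M≈0

      Q^1+-nilpotent : ∀ k → (Q ^ suc k) ^ M ≈ 0#
      Q^1+-nilpotent k = *-nilpotent M (Q ^ k) Q^M≈0

      -- The term of index k - b of the theta series.
      t : ℕ → ℕ → Carrier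
      t k       zero    = gauss Q u k
      t zero    (suc b) = gauss Q v (suc b)
      t (suc k) (suc b) = t k b

      t₀ : ∀ b → t 0 b ≈ gauss Q v b
      t₀ zero    = refl
      t₀ (suc b) = refl

      t-vanishʳ : ∀ b {k} → b ℕ.+ M ≤ k → t k b ≈ 0#
      t-vanishʳ zero    le       = gauss-vanish Q M u^M≈0 le
      t-vanishʳ (suc b) (s≤s le) = t-vanishʳ b le

      t-vanishˡ : ∀ k {b} → k ℕ.+ M ≤ b → t k b ≈ 0#
      t-vanishˡ zero    {b} le   = trans (t₀ b) (gauss-vanish Q M v^M≈0 le)
      t-vanishˡ (suc k) (s≤s le) = t-vanishˡ k le

      -- The theta terms of indices k - b and k - b - 1 have ratio -u Q^{k-b-1}. Multiplied by v Q^b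
      -- this becomes -Q^k, so no negative power of Q occurs even when k < b.
      t-step : ∀ k b → (v * Q ^ b) * t k b ≈ - (t k (suc b) * Q ^ k)
      t-step zero b = trans (*-congˡ (t₀ b))
        (solve 2 (λ x y → x :* y := :- ((:- x :* y) :* con (+ 1))) refl (v * Q ^ b) (gauss Q v b))
      t-step (suc k) zero = solve 4 (λ u v x y → (v :* con (+ 1)) :* (:- (u :* x) :* y) := :- (y :* (u :* v :* x)))
        refl u v (Q ^ k) (gauss Q u k)
      t-step (suc k) (suc b) = begin
        (v * (Q * Q ^ b)) * t k b        ≈⟨ solve 4 (λ v q x y → (v :* (q :* x)) :* y := q :* ((v :* x) :* y)) refl v Q (Q ^ b) (t k b) ⟩
        Q * ((v * Q ^ b) * t k b)        ≈⟨ *-congˡ (t-step k b) ⟩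
        Q * - (t k (suc b) * Q ^ k)      ≈⟨ solve 3 (λ q x y → q :* :- (x :* y) := :- (x :* (q :* y))) refl Q (t k (suc b)) (Q ^ k) ⟩
        - (t k (suc b) * (Q * Q ^ k))    ∎

      iq : ℕ → Carrier
      iq k = ∏ k (λ m → geometric M (Q ^ suc m))

      [Q] : ℕ → Carrier
      [Q] k = ∏ k (λ m → 1# - Q ^ suc m)

      iq-step : ∀ k → (1# - Q ^ suc k) * iq (suc k) ≈ iq k
      iq-step k = begin
        (1# - Q ^ suc k) * (iq k * geometric M (Q ^ suc k)) ≈⟨ solve 3 (λ a b c → a :* (b :* c) := b :* (a :* c)) refl _ _ _ ⟩
        iq k * ((1# - Q ^ suc k) * geometric M (Q ^ suc k)) ≈⟨ *-congˡ (geometric-inverse M (Q^1+-nilpotent k)) ⟩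
        iq k * 1#                                           ≈⟨ *-identityʳ _ ⟩
        iq k                                                ∎

      iq-inverse : ∀ k → [Q] k * iq k ≈ 1#
      iq-inverse k = trans (sym (∏-* k _ _)) (∏-one k (λ m _ → geometric-inverse M (Q^1+-nilpotent m)))

      [Q]-stable : ∀ j → [Q] (j ℕ.+ M) ≈ [Q] M
      [Q]-stable = ∏-truncate M (λ k M≤k → 1-0≈1 (^-vanish M Q^M≈0 (ℕₚ.m≤n⇒m≤1+n M≤k)))

      -- Interpolates between two classical series. `iq k` is 1/(Q;Q)_k, so b = 0 gives Euler's
      -- series for (u;Q)_∞; for large b the terms that survive all have denominator (Q;Q)_∞, and
      -- the bilateral theta series appears.
      S : ℕ → Carrier
      S b = ∑ (b ℕ.+ M) (λ k → t k b * iq k)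

      -- Split 1 = (1 - Q^k) + Q^k. In the first part the factor cancels the last one of (Q;Q)_k,
      -- and moving k by one gives back `S b`; in the second part `t-step` turns Q^k into -v Q^b.
      S-step : ∀ b → S (suc b) ≈ (1# - v * Q ^ b) * S b
      S-step b = begin
        S (suc b)
          ≈⟨ ∑-cong (suc L) (λ k _ → solve 3 (λ x y z → x :* z := x :* (con (+ 1) :- y) :* z :+ x :* y :* z) refl (t k (suc b)) (Q ^ k) (iq k)) ⟩
        ∑ (suc L) (λ k → F k + G k)
          ≈⟨ ∑-+ (suc L) F G ⟩
        ∑ (suc L) F + ∑ (suc L) G
          ≈⟨ +-cong (trans (∑-head L F) (+-cong F0≈0 (∑-cong L (λ k _ → F-suc k)))) (+-cong (∑-cong L (λ k _ → G≈ k)) GL≈0) ⟩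
        (0# + S b) + (∑ L (λ k → - (v * Q ^ b) * (t k b * iq k)) + 0#)
          ≈⟨ +-congˡ (+-congʳ (*-∑ _ L _)) ⟨
        (0# + S b) + (- (v * Q ^ b) * S b + 0#)
          ≈⟨ solve 2 (λ x s → (con (+ 0) :+ s) :+ (:- x :* s :+ con (+ 0)) := (con (+ 1) :- x) :* s) refl (v * Q ^ b) (S b) ⟩
        (1# - v * Q ^ b) * S b ∎
        where
        L = b ℕ.+ M
        F G : ℕ → Carrier
        F k = t k (suc b) * (1# - Q ^ k) * iq k
        G k = t k (suc b) * Q ^ k * iq k
        F0≈0 : F 0 ≈ 0#
        F0≈0 = solve 1 (λ x → x :* (con (+ 1) :- con (+ 1)) :* con (+ 1) := con (+ 0)) refl (t 0 (suc b))
        F-suc : ∀ k → F (suc k) ≈ t k b * iq k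
        F-suc k = trans (*-assoc _ _ _) (*-congˡ (iq-step k))
        G≈ : ∀ k → G k ≈ - (v * Q ^ b) * (t k b * iq k)
        G≈ k = begin
          t k (suc b) * Q ^ k * iq k            ≈⟨ solve 2 (λ x y → x :* y := :- (:- x :* y)) refl _ _ ⟩
          - (- (t k (suc b) * Q ^ k) * iq k)    ≈⟨ -‿cong (*-congʳ (t-step k b)) ⟨
          - (((v * Q ^ b) * t k b) * iq k)      ≈⟨ solve 3 (λ x y z → :- ((x :* y) :* z) := :- x :* (y :* z)) refl _ _ _ ⟩
          - (v * Q ^ b) * (t k b * iq k)        ∎
        GL≈0 : G L ≈ 0#
        GL≈0 = trans (G≈ L) (trans (*-congˡ (trans (*-congʳ (t-vanishʳ b ℕₚ.≤-refl)) (zeroˡ _))) (zeroʳ _))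

      S-product : ∀ b → S b ≈ ∏ b (λ m → 1# - v * Q ^ m) * S 0
      S-product zero    = sym (*-identityˡ _)
      S-product (suc b) = trans (S-step b) (trans (*-congˡ (S-product b))
        (solve 3 (λ x y z → x :* (y :* z) := y :* x :* z) refl _ _ _))

      euler : Carrier → Carrier
      euler z = ∑ M (λ k → gauss Q z k * iq k)

      euler-cong : ∀ {x y} → x ≈ y → euler x ≈ euler y
      euler-cong x≈y = ∑-cong M (λ k _ → *-congʳ (gauss-cong Q x≈y k))

      -- The same splitting 1 = (1 - Q^k) + Q^k; by `gauss-scale` both parts are multiples of the
      -- series at zQ.
      euler-step : ∀ {z} → z ^ M ≈ 0# → euler z ≈ (1# - z) * euler (z * Q)
      euler-step {z} z^M≈0 = begin
        ∑ M (λ k → gauss Q z k * iq k)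
          -- The zero term of index M is added because the part carrying 1 - Q^k loses one index
          -- when it is shifted.
          ≈⟨ +-identityʳ _ ⟨
        ∑ M (λ k → gauss Q z k * iq k) + 0#
          ≈⟨ +-congˡ (trans (*-congʳ gM≈0) (zeroˡ _)) ⟨
        ∑ (suc M) (λ k → gauss Q z k * iq k)
          ≈⟨ ∑-cong (suc M) (λ k _ → solve 3 (λ x y z → x :* z := x :* (con (+ 1) :- y) :* z :+ (y :* x) :* z) refl (gauss Q z k) (Q ^ k) (iq k)) ⟩
        ∑ (suc M) (λ k → F k + G k)
          ≈⟨ ∑-+ (suc M) F G ⟩
        ∑ (suc M) F + ∑ (suc M) G
          ≈⟨ +-cong (trans (∑-head M F) (+-cong F0≈0 (∑-cong M (λ k _ → F-suc k)))) (+-cong (∑-cong M (λ k _ → *-congʳ (sym (gauss-scale Q z k)))) GM≈0) ⟩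
        (0# + ∑ M (λ k → - z * (gauss Q (z * Q) k * iq k))) + (euler (z * Q) + 0#)
          ≈⟨ +-congʳ (+-congˡ (*-∑ _ M _)) ⟨
        (0# + - z * euler (z * Q)) + (euler (z * Q) + 0#)
          ≈⟨ solve 2 (λ z s → (con (+ 0) :+ :- z :* s) :+ (s :+ con (+ 0)) := (con (+ 1) :- z) :* s) refl z (euler (z * Q)) ⟩
        (1# - z) * euler (z * Q) ∎
        where
        gM≈0 = gauss-vanish Q M z^M≈0 ℕₚ.≤-refl
        F G : ℕ → Carrier
        F k = gauss Q z k * (1# - Q ^ k) * iq k
        G k = (Q ^ k * gauss Q z k) * iq k
        GM≈0 : G M ≈ 0#
        GM≈0 = trans (*-congʳ (*-congˡ gM≈0)) (trans (*-congʳ (zeroʳ _)) (zeroˡ _))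
        F0≈0 : F 0 ≈ 0#
        F0≈0 = solve 0 (con (+ 1) :* (con (+ 1) :- con (+ 1)) :* con (+ 1) := con (+ 0)) refl
        F-suc : ∀ k → F (suc k) ≈ - z * (gauss Q (z * Q) k * iq k)
        F-suc k = begin
          - (z * Q ^ k) * gauss Q z k * (1# - Q ^ suc k) * iq (suc k)    ≈⟨ *-assoc _ _ _ ⟩
          - (z * Q ^ k) * gauss Q z k * ((1# - Q ^ suc k) * iq (suc k))  ≈⟨ *-congˡ (iq-step k) ⟩
          - (z * Q ^ k) * gauss Q z k * iq k                             ≈⟨ solve 4 (λ z x y i → :- (z :* x) :* y :* i := :- z :* ((x :* y) :* i)) refl _ _ _ _ ⟩
          - z * ((Q ^ k * gauss Q z k) * iq k)                           ≈⟨ *-congˡ (*-congʳ (gauss-scale Q z k)) ⟨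
          - z * (gauss Q (z * Q) k * iq k)                               ∎

      euler-zero : 0 < M → ∀ {z} → z ≈ 0# → euler z ≈ 1#
      euler-zero (s≤s {n = m} _) {z} z≈0 = begin
        ∑ (suc m) (λ k → gauss Q z k * iq k)
          ≈⟨ ∑-head m _ ⟩
        1# * 1# + ∑ m (λ k → gauss Q z (suc k) * iq (suc k))
          ≈⟨ +-congˡ (∑-zero m (λ k → trans (*-congʳ (gauss-zero Q z≈0 k)) (zeroˡ _))) ⟩
        1# * 1# + 0#
          ≈⟨ solve 0 (con (+ 1) :* con (+ 1) :+ con (+ 0) := con (+ 1)) refl ⟩
        1# ∎

      euler-product : ∀ j → euler u ≈ ∏ j (λ m → 1# - u * Q ^ m) * euler (u * Q ^ j)
      euler-product zero = trans (euler-cong (sym (*-identityʳ u))) (sym (*-identityˡ _))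
      euler-product (suc j) = begin
        euler u                                                       ≈⟨ euler-product j ⟩
        P * euler (u * Q ^ j)                                         ≈⟨ *-congˡ (euler-step (*-nilpotent M (Q ^ j) u^M≈0)) ⟩
        P * ((1# - u * Q ^ j) * euler (u * Q ^ j * Q))                ≈⟨ *-assoc _ _ _ ⟨
        P * (1# - u * Q ^ j) * euler (u * Q ^ j * Q)                  ≈⟨ *-congˡ (euler-cong (solve 3 (λ u x q → u :* x :* q := u :* (q :* x)) refl u (Q ^ j) Q)) ⟩
        P * (1# - u * Q ^ j) * euler (u * Q ^ suc j)                  ∎
        where P = ∏ j (λ m → 1# - u * Q ^ m)

      [Q]-iq : ∀ {k} → M ≤ k → [Q] M * iq k ≈ 1#
      [Q]-iq {k} M≤k = begin
        [Q] M * iq k                     ≈⟨ *-congʳ ([Q]-stable (k ℕ.∸ M)) ⟨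
        [Q] (k ℕ.∸ M ℕ.+ M) * iq k       ≡⟨ ≡.cong (λ n → [Q] n * iq k) (ℕₚ.m∸n+n≡m M≤k) ⟩
        [Q] k * iq k                     ≈⟨ iq-inverse k ⟩
        1#                               ∎

      theta-unfold : ∀ b → ∑ (b ℕ.+ M) (λ k → t k b) ≈ ∑ M (gauss Q u) + ∑ b (gauss Q v ∘ suc)
      theta-unfold zero    = sym (+-identityʳ _)
      theta-unfold (suc b) = trans (∑-head (b ℕ.+ M) _) (trans (+-congˡ (theta-unfold b))
        (solve 3 (λ x y z → x :+ (y :+ z) := y :+ (z :+ x)) refl _ _ _))

      -- The value b = 2M is far enough out: for k ≥ M the product (Q;Q)_k has already stabilised
      -- and cancels, and for k ≤ M the index k - 2M is at most -M, so the theta term itself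
      -- vanishes.
      [Q]-S : [Q] M * S (M ℕ.+ M) ≈ ∑ (M ℕ.+ M ℕ.+ M) (λ k → t k (M ℕ.+ M))
      [Q]-S = trans (*-∑ ([Q] M) (M ℕ.+ M ℕ.+ M) _) (∑-cong (M ℕ.+ M ℕ.+ M) (λ k _ → term k))
        where
        term : ∀ k → [Q] M * (t k (M ℕ.+ M) * iq k) ≈ t k (M ℕ.+ M)
        term k with ℕₚ.≤-total M k
        ... | inj₁ M≤k = trans (solve 3 (λ x y z → x :* (y :* z) := y :* (x :* z)) refl _ _ _)
                (trans (*-congˡ ([Q]-iq M≤k)) (*-identityʳ _))
        ... | inj₂ k≤M = trans (*-congˡ (*-congʳ tk≈0)) (trans (trans (*-congˡ (zeroˡ _)) (zeroʳ _)) (sym tk≈0))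
          where tk≈0 = t-vanishˡ k (ℕₚ.+-monoˡ-≤ M k≤M)

    jacobi-triple-product : 0 < M →
      ∑ M (gauss (u * v) u) + ∑ M (gauss (u * v) v ∘ suc)
        ≈ ∏ M (λ m → 1# - (u * v) ^ suc m) * (∏ M (λ m → 1# - u * (u * v) ^ m) * ∏ M (λ m → 1# - v * (u * v) ^ m))
    jacobi-triple-product 0<M = begin
      ∑ M (gauss Q u) + ∑ M (gauss Q v ∘ suc)
        ≈⟨ +-congˡ (∑-truncate M (λ k M≤k → gauss-vanish Q M v^M≈0 (ℕₚ.m≤n⇒m≤1+n M≤k)) M) ⟨
      ∑ M (gauss Q u) + ∑ (M ℕ.+ M) (gauss Q v ∘ suc)
        ≈⟨ theta-unfold (M ℕ.+ M) ⟨
      ∑ (M ℕ.+ M ℕ.+ M) (λ k → t k (M ℕ.+ M))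
        ≈⟨ [Q]-S ⟨
      [Q] M * S (M ℕ.+ M)
        ≈⟨ *-congˡ (S-product (M ℕ.+ M)) ⟩
      [Q] M * (∏ (M ℕ.+ M) (λ m → 1# - v * Q ^ m) * S 0)
        ≈⟨ *-congˡ (*-cong (∏-truncate M (λ k M≤k → 1-0≈1 (trans (*-congˡ (^-vanish M Q^M≈0 M≤k)) (zeroʳ v))) M) S₀) ⟩
      [Q] M * (∏ M (λ m → 1# - v * Q ^ m) * ∏ M (λ m → 1# - u * Q ^ m))
        ≈⟨ *-congˡ (*-comm _ _) ⟩
      [Q] M * (∏ M (λ m → 1# - u * Q ^ m) * ∏ M (λ m → 1# - v * Q ^ m)) ∎
      where
      S₀ : S 0 ≈ ∏ M (λ m → 1# - u * Q ^ m)
      S₀ = trans (euler-product M) (trans (*-congˡ (euler-zero 0<M (trans (*-congˡ Q^M≈0) (zeroʳ u)))) (*-identityʳ _))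

-- Arithmetic of the exponents in Andrews' series.

module Exponents where

  open import Data.Nat using (_+_; _*_)

  α β : ℕ → ℕ → ℕ → ℕ → ℕ
  α J k b n = 2 * b * n + 2 * (1 + (k + b)) * n * (n + J) + n
  β J k b n = 2 * (1 + (k + b)) * n * (n + J + 1) + 2 * k * (n + J + 1) + n + 2 * J + 1

  -- `lo` and `hi` are the weights of x_{2J+1} x_{2J+2}^k and x_{2J+2}^{k+1}, the two initial
  -- monomials whose exponents sum to k + 1.
  lo : ℕ → ℕ → ℕ
  lo J k = (2 * J + 2) * k + (2 * J + 1)

  hi : ℕ → ℕ → ℕ
  hi J k = (2 * J + 2) * (1 + k)

  α-shift : ∀ J k b n → α J k (suc b) n ≡ α J (suc k) b n + 2 * n
  α-shift = ident
    where
    ident : ∀ J k b n → 2 * (1 + b) * n + 2 * (1 + (k + (1 + b))) * n * (n + J) + n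
                        ≡ 2 * b * n + 2 * (1 + ((1 + k) + b)) * n * (n + J) + n + 2 * n
    ident = solve-∀

  β-shift : ∀ J k b n → β J (suc k) b n ≡ β J k (suc b) n + (2 * n + 2 * J + 2)
  β-shift = ident
    where
    ident : ∀ J k b n →
      2 * (1 + ((1 + k) + b)) * n * (n + J + 1) + 2 * (1 + k) * (n + J + 1) + n + 2 * J + 1
        ≡ 2 * (1 + (k + (1 + b))) * n * (n + J + 1) + 2 * k * (n + J + 1) + n + 2 * J + 1 + (2 * n + 2 * J + 2)
    ident = solve-∀

  -- This and the next three identities locate the summands of level J+1 at level J: an `α` part of
  -- index n lands on the `β` part of index n, a `β` part of index n lands on the `α` part of index
  -- n + 1. The surplus exponents become the factors 1 + q^{2n+1} and 1 + q^{2n+2J+3}.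
  hi+α : ∀ J k b n → hi J k + α (suc J) b (suc k) n ≡ β J k (suc b) n + (2 * n + 1)
  hi+α = ident
    where
    ident : ∀ J k b n →
      (2 * J + 2) * (1 + k) + (2 * (1 + k) * n + 2 * (1 + (b + (1 + k))) * n * (n + (1 + J)) + n)
        ≡ 2 * (1 + (k + (1 + b))) * n * (n + J + 1) + 2 * k * (n + J + 1) + n + 2 * J + 1 + (2 * n + 1)
    ident = solve-∀

  lo+α : ∀ J k b n → lo J k + α (suc J) (suc b) k n ≡ β J k (suc b) n
  lo+α = ident
    where
    ident : ∀ J k b n →
      (2 * J + 2) * k + (2 * J + 1) + (2 * k * n + 2 * (1 + ((1 + b) + k)) * n * (n + (1 + J)) + n)
        ≡ 2 * (1 + (k + (1 + b))) * n * (n + J + 1) + 2 * k * (n + J + 1) + n + 2 * J + 1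
    ident = solve-∀

  hi+β : ∀ J k b n → hi J k + β (suc J) b (suc k) n ≡ α J (suc k) b (suc n)
  hi+β = ident
    where
    ident : ∀ J k b n →
      (2 * J + 2) * (1 + k) + (2 * (1 + (b + (1 + k))) * n * (n + (1 + J) + 1) + 2 * b * (n + (1 + J) + 1) + n + 2 * (1 + J) + 1)
        ≡ 2 * b * (1 + n) + 2 * (1 + ((1 + k) + b)) * (1 + n) * ((1 + n) + J) + (1 + n)
    ident = solve-∀

  lo+β : ∀ J k b n → lo J k + β (suc J) (suc b) k n ≡ α J (suc k) b (suc n) + (2 * suc n + 2 * J + 1)
  lo+β = ident
    where
    ident : ∀ J k b n →
      (2 * J + 2) * k + (2 * J + 1) + (2 * (1 + ((1 + b) + k)) * n * (n + (1 + J) + 1) + 2 * (1 + b) * (n + (1 + J) + 1) + n + 2 * (1 + J) + 1)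
        ≡ 2 * b * (1 + n) + 2 * (1 + ((1 + k) + b)) * (1 + n) * ((1 + n) + J) + (1 + n) + (2 * (1 + n) + 2 * J + 1)
    ident = solve-∀

  α-first : ∀ J b n → α (suc J) b 0 n ≡ α J 0 b n + 2 * n
  α-first = ident
    where
    ident : ∀ J b n → 2 * 0 * n + 2 * (1 + (b + 0)) * n * (n + (1 + J)) + n
                      ≡ 2 * b * n + 2 * (1 + (0 + b)) * n * (n + J) + n + 2 * n
    ident = solve-∀

  β-first : ∀ J b n → β J 0 b n ≡ α J 0 b n + (2 * n + 2 * J + 1)
  β-first = ident
    where
    ident : ∀ J b n →
      2 * (1 + (0 + b)) * n * (n + J + 1) + 2 * 0 * (n + J + 1) + n + 2 * J + 1
        ≡ 2 * b * n + 2 * (1 + (0 + b)) * n * (n + J) + n + (2 * n + 2 * J + 1)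
    ident = solve-∀

  β-last : ∀ J b n → β (suc J) b 0 n ≡ α J 0 b (suc n)
  β-last = ident
    where
    ident : ∀ J b n →
      2 * (1 + (b + 0)) * n * (n + (1 + J) + 1) + 2 * b * (n + (1 + J) + 1) + n + 2 * (1 + J) + 1
        ≡ 2 * b * (1 + n) + 2 * (1 + (0 + b)) * (1 + n) * ((1 + n) + J) + (1 + n)
    ident = solve-∀

  α-zero : ∀ J k b → α J k b 0 ≡ 0
  α-zero = ident
    where
    ident : ∀ J k b → 2 * b * 0 + 2 * (1 + (k + b)) * 0 * (0 + J) + 0 ≡ 0
    ident = solve-∀

  -- Together with `J≤β` this collapses the series for J ≥ M: only the `α` part of index 0, where
  -- the exponent is 0, survives.
  J≤α : ∀ J k b n → J ≤ α J k b (suc n)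
  J≤α J k b n = ≡.subst (J ≤_) (ident J k b n) (ℕₚ.m≤m+n J _)
    where
    ident : ∀ J k b n →
      J + (J + 2 * (1 + n) + 2 * (k + b) * (1 + n) * ((1 + n) + J) + 2 * n * ((1 + n) + J) + 2 * b * (1 + n) + (1 + n))
        ≡ 2 * b * (1 + n) + 2 * (1 + (k + b)) * (1 + n) * ((1 + n) + J) + (1 + n)
    ident = solve-∀

  J≤β : ∀ J k b n → J ≤ β J k b n
  J≤β J k b n = ≡.subst (J ≤_) (ident J k b n) (ℕₚ.m≤m+n J _)
    where
    ident : ∀ J k b n →
      J + (J + 2 * (1 + (k + b)) * n * (n + J + 1) + 2 * k * (n + J + 1) + n + 1)
        ≡ 2 * (1 + (k + b)) * n * (n + J + 1) + 2 * k * (n + J + 1) + n + 2 * J + 1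
    ident = solve-∀

  -- The exponents of the theta series with base q^{4r}, r = k + b + 1.
  modulus : ℕ → ℕ → ℕ
  modulus k b = 4 * suc (k + b)

  γ : ℕ → ℕ → ℕ → ℕ
  γ m c zero    = 0
  γ m c (suc n) = c + m * n + γ m c n

  -- `γ m c n` is cn + mn(n-1)/2. With ℓ = b + 1 the values of c here and in `γ-β` are 2r + (2ℓ-1)
  -- and 2r - (2ℓ-1) = 2k + 1, the excluded odd residues modulo 4r; their sum is 4r, as the triple
  -- product with base q^{4r} demands.
  γ-α : ∀ k b n → γ (modulus k b) (2 * suc (k + b) + (2 * b + 1)) n ≡ α 0 k b n
  γ-α k b zero    = ≡.sym (α-zero 0 k b)
  γ-α k b (suc n) = ≡.trans (≡.cong (λ x → 2 * suc (k + b) + (2 * b + 1) + modulus k b * n + x) (γ-α k b n)) (ident k b n)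
    where
    ident : ∀ k b n →
      2 * (1 + (k + b)) + (2 * b + 1) + 4 * (1 + (k + b)) * n + (2 * b * n + 2 * (1 + (k + b)) * n * (n + 0) + n)
        ≡ 2 * b * (1 + n) + 2 * (1 + (k + b)) * (1 + n) * ((1 + n) + 0) + (1 + n)
    ident = solve-∀

  γ-β : ∀ k b n → γ (modulus k b) (2 * k + 1) (suc n) ≡ β 0 k b n
  γ-β k b zero    = ident k b
    where
    ident : ∀ k b → 2 * k + 1 + 4 * (1 + (k + b)) * 0 + 0 ≡ 2 * (1 + (k + b)) * 0 * (0 + 0 + 1) + 2 * k * (0 + 0 + 1) + 0 + 2 * 0 + 1
    ident = solve-∀
  γ-β k b (suc n) = ≡.trans (≡.cong (λ x → 2 * k + 1 + modulus k b * suc n + x) (γ-β k b n)) (ident k b n)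
    where
    ident : ∀ k b n →
      2 * k + 1 + 4 * (1 + (k + b)) * (1 + n) + (2 * (1 + (k + b)) * n * (n + 0 + 1) + 2 * k * (n + 0 + 1) + n + 2 * 0 + 1)
        ≡ 2 * (1 + (k + b)) * (1 + n) * ((1 + n) + 0 + 1) + 2 * k * ((1 + n) + 0 + 1) + (1 + n) + 2 * 0 + 1
    ident = solve-∀

  residues-sum : ∀ k b → 2 * suc (k + b) + (2 * b + 1) + (2 * k + 1) ≡ modulus k b
  residues-sum = ident
    where
    ident : ∀ k b → 2 * (1 + (k + b)) + (2 * b + 1) + (2 * k + 1) ≡ 4 * (1 + (k + b))
    ident = solve-∀

-- Andrews' alternating series: recursion, limit and value at J = 0.

module QSeries (R : CommutativeRing 0ℓ 0ℓ) (q : CommutativeRing.Carrier R) (M : ℕ) where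

  open CommutativeRing R hiding (zero)
  open import Algebra.Properties.CommutativeSemiring.Exp commutativeSemiring
  open import Relation.Binary.Reasoning.Setoid setoid
  open IntegerCoefficients R
  open BigOperators R
  open Nilpotents R
  open TripleProduct R
  open Exponents

  q^-split : ∀ {e} a b → e ≡ a ℕ.+ b → q ^ e ≈ q ^ a * q ^ b
  q^-split a b ≡.refl = ^-homo-* q a b

  q^-join : ∀ {e} a b → a ℕ.+ b ≡ e → q ^ a * q ^ b ≈ q ^ e
  q^-join a b ≡.refl = sym (^-homo-* q a b)

  q^-swap : ∀ a b c d → a ℕ.+ b ≡ c ℕ.+ d → q ^ a * q ^ b ≈ q ^ c * q ^ d
  q^-swap a b c d eq = trans (q^-join a b eq) (^-homo-* q c d)

  sgn : ℕ → Carrier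
  sgn zero    = 1#
  sgn (suc n) = - sgn n

  -- h m = 1/(1 + q^m)
  h : ℕ → Carrier
  h m = geometric M (- q ^ m)

  -- K J n = ∏_{s=1}^{J} (1 - q^{2n+2s}) / ∏_{s=0}^{J} (1 + q^{2n+2s+1})
  K : ℕ → ℕ → Carrier
  K zero    n = h (2 ℕ.* n ℕ.+ 1)
  K (suc J) n = K J n * (1# - q ^ (2 ℕ.* n ℕ.+ 2 ℕ.* J ℕ.+ 2)) * h (2 ℕ.* n ℕ.+ 2 ℕ.* suc J ℕ.+ 1)

  term : ℕ → ℕ → ℕ → ℕ → Carrier
  term J k b n = sgn n * (K J n * (q ^ α J k b n * (1# + q ^ (2 ℕ.* n ℕ.+ 2 ℕ.* J ℕ.+ 1)) - q ^ β J k b n * (1# + q ^ (2 ℕ.* n ℕ.+ 1))))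

  -- term J k b n collects the indices n and -(n+J+1) of the bilateral series.
  A : ℕ → ℕ → ℕ → Carrier
  A J k b = ∑ M (term J k b)

  module _ (q^M≈0 : q ^ M ≈ 0#) where

    h-inverse : ∀ m → (1# + q ^ suc m) * h (suc m) ≈ 1#
    h-inverse m = trans (*-congʳ (solve 1 (λ x → con (+ 1) :+ x := con (+ 1) :- (:- x)) refl _)) (geometric-inverse M nil)
      where
      nil : (- q ^ suc m) ^ M ≈ 0#
      nil = trans (^-congˡ M (solve 2 (λ x y → :- (x :* y) := x :* (:- y)) refl q (q ^ m))) (*-nilpotent M (- q ^ m) q^M≈0)

    h-inverse′ : ∀ m → (1# + q ^ (m ℕ.+ 1)) * h (m ℕ.+ 1) ≈ 1#
    h-inverse′ m = ≡.subst (λ n → (1# + q ^ n) * h n ≈ 1#) (ℕₚ.+-comm 1 m) (h-inverse m)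

    K-up : ∀ J n → K (suc J) n * (1# + q ^ (2 ℕ.* n ℕ.+ 2 ℕ.* suc J ℕ.+ 1)) ≈ K J n * (1# - q ^ (2 ℕ.* n ℕ.+ 2 ℕ.* J ℕ.+ 2))
    K-up J n = begin
      K J n * w * h m * (1# + q ^ m)    ≈⟨ solve 3 (λ x y z → x :* y :* z := x :* (z :* y)) refl _ _ _ ⟩
      K J n * w * ((1# + q ^ m) * h m)  ≈⟨ *-congˡ (h-inverse′ (2 ℕ.* n ℕ.+ 2 ℕ.* suc J)) ⟩
      K J n * w * 1#                    ≈⟨ *-identityʳ _ ⟩
      K J n * w                         ∎
      where
      m = 2 ℕ.* n ℕ.+ 2 ℕ.* suc J ℕ.+ 1
      w = 1# - q ^ (2 ℕ.* n ℕ.+ 2 ℕ.* J ℕ.+ 2)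

    -- Strips the first factors of the quotient, where `K-up` strips the last ones. The reflected
    -- index reads the product from its other end, so this is the form that fits the `β` part.
    K-shift : ∀ J n → K (suc J) n * (1# + q ^ (2 ℕ.* n ℕ.+ 1)) ≈ K J (suc n) * (1# - q ^ (2 ℕ.* suc n))
    K-shift zero n = begin
      h m * (1# - q ^ (2 ℕ.* n ℕ.+ 0 ℕ.+ 2)) * h (2 ℕ.* n ℕ.+ 2 ℕ.+ 1) * (1# + q ^ m)
        ≡⟨ ≡.cong₂ (λ x y → h m * (1# - q ^ x) * h y * (1# + q ^ m)) (e₁ n) (e₂ n) ⟩
      h m * (1# - q ^ (2 ℕ.* suc n)) * h (2 ℕ.* suc n ℕ.+ 1) * (1# + q ^ m)
        ≈⟨ solve 4 (λ x y z w → x :* y :* z :* w := (w :* x) :* (z :* y)) refl _ _ _ _ ⟩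
      (1# + q ^ m) * h m * (h (2 ℕ.* suc n ℕ.+ 1) * (1# - q ^ (2 ℕ.* suc n)))
        ≈⟨ *-congʳ (h-inverse′ (2 ℕ.* n)) ⟩
      1# * (h (2 ℕ.* suc n ℕ.+ 1) * (1# - q ^ (2 ℕ.* suc n)))
        ≈⟨ *-identityˡ _ ⟩
      h (2 ℕ.* suc n ℕ.+ 1) * (1# - q ^ (2 ℕ.* suc n)) ∎
      where
      m = 2 ℕ.* n ℕ.+ 1
      e₁ : ∀ n → 2 ℕ.* n ℕ.+ 0 ℕ.+ 2 ≡ 2 ℕ.* (1 ℕ.+ n)
      e₁ = solve-∀
      e₂ : ∀ n → 2 ℕ.* n ℕ.+ 2 ℕ.+ 1 ≡ 2 ℕ.* (1 ℕ.+ n) ℕ.+ 1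
      e₂ = solve-∀
    K-shift (suc J) n = begin
      K (suc J) n * (1# - q ^ (2 ℕ.* n ℕ.+ 2 ℕ.* suc J ℕ.+ 2)) * h (2 ℕ.* n ℕ.+ 2 ℕ.* suc (suc J) ℕ.+ 1) * (1# + q ^ m)
        ≡⟨ ≡.cong₂ (λ x y → K (suc J) n * (1# - q ^ x) * h y * (1# + q ^ m)) (e₁ n J) (e₂ n J) ⟩
      K (suc J) n * w * h′ * (1# + q ^ m)
        ≈⟨ solve 4 (λ x y z w → x :* y :* z :* w := (x :* w) :* (y :* z)) refl _ _ _ _ ⟩
      K (suc J) n * (1# + q ^ m) * (w * h′)
        ≈⟨ *-congʳ (K-shift J n) ⟩
      K J (suc n) * (1# - q ^ (2 ℕ.* suc n)) * (w * h′)
        ≈⟨ solve 4 (λ x y z w → (x :* w) :* (y :* z) := x :* y :* z :* w) refl _ _ _ _ ⟩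
      K J (suc n) * w * h′ * (1# - q ^ (2 ℕ.* suc n)) ∎
      where
      m = 2 ℕ.* n ℕ.+ 1
      w = 1# - q ^ (2 ℕ.* suc n ℕ.+ 2 ℕ.* J ℕ.+ 2)
      h′ = h (2 ℕ.* suc n ℕ.+ 2 ℕ.* suc J ℕ.+ 1)
      e₁ : ∀ n J → 2 ℕ.* n ℕ.+ 2 ℕ.* (1 ℕ.+ J) ℕ.+ 2 ≡ 2 ℕ.* (1 ℕ.+ n) ℕ.+ 2 ℕ.* J ℕ.+ 2
      e₁ = solve-∀
      e₂ : ∀ n J → 2 ℕ.* n ℕ.+ 2 ℕ.* (2 ℕ.+ J) ℕ.+ 1 ≡ 2 ℕ.* (1 ℕ.+ n) ℕ.+ 2 ℕ.* (1 ℕ.+ J) ℕ.+ 1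
      e₂ = solve-∀

    -- Each summand of level J+1 splits into a piece with `K J n` and a piece with `K J (suc n)`,
    -- the shape that `∑-reflect` compares with level J.
    term-up : ∀ J k b n → term (suc J) k b n
      ≈ sgn n * (q ^ α (suc J) k b n * (K J n * (1# - q ^ (2 ℕ.* n ℕ.+ 2 ℕ.* J ℕ.+ 2)))
                 - q ^ β (suc J) k b n * (K J (suc n) * (1# - q ^ (2 ℕ.* suc n))))
    term-up J k b n = *-congˡ (begin
      K (suc J) n * (a * y - c * z)                    ≈⟨ solve 5 (λ x a y c z → x :* (a :* y :- c :* z) := a :* (x :* y) :- c :* (x :* z)) refl _ a y c z ⟩
      a * (K (suc J) n * y) - c * (K (suc J) n * z)    ≈⟨ +-cong (*-congˡ (K-up J n)) (-‿cong (*-congˡ (K-shift J n))) ⟩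
      _ ∎)
      where
      a = q ^ α (suc J) k b n
      c = q ^ β (suc J) k b n
      y = 1# + q ^ (2 ℕ.* n ℕ.+ 2 ℕ.* suc J ℕ.+ 1)
      z = 1# + q ^ (2 ℕ.* n ℕ.+ 1)

    -- The contribution a is moved from index n to index n + 1: this is the
    -- reflection n ↦ -(n+J+1) of the bilateral series.
    ∑-reflect : ∀ {f g : ℕ → Carrier} (a c : ℕ → Carrier) →
      (∀ n → f n ≈ sgn n * (a n + c n)) → (∀ n → g n ≈ sgn n * (c n - a (suc n))) →
      a 0 ≈ 0# → a M ≈ 0# → ∑ M f ≈ ∑ M g
    ∑-reflect {f} {g} a c f≈ g≈ a₀≈0 aM≈0 = begin
      ∑ M f
        ≈⟨ ∑-cong M (λ n _ → trans (f≈ n) (distribˡ _ _ _)) ⟩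
      ∑ M (λ n → sgn n * a n + sgn n * c n)
        ≈⟨ ∑-+ M _ _ ⟩
      ∑ M (λ n → sgn n * a n) + ∑ M (λ n → sgn n * c n)
        ≈⟨ +-congʳ (+-identityʳ _) ⟨
      ∑ M (λ n → sgn n * a n) + 0# + ∑ M (λ n → sgn n * c n)
        ≈⟨ +-congʳ (+-congˡ (trans (*-congˡ aM≈0) (zeroʳ _))) ⟨
      ∑ (suc M) (λ n → sgn n * a n) + ∑ M (λ n → sgn n * c n)
        ≈⟨ +-congʳ (trans (∑-head M _) (trans (+-congʳ (trans (*-congˡ a₀≈0) (zeroʳ _))) (+-identityˡ _))) ⟩
      ∑ M (λ n → - sgn n * a (suc n)) + ∑ M (λ n → sgn n * c n)
        ≈⟨ ∑-+ M _ _ ⟨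
      ∑ M (λ n → - sgn n * a (suc n) + sgn n * c n)
        ≈⟨ ∑-cong M (λ n _ → trans (solve 3 (λ s a c → :- s :* a :+ s :* c := s :* (c :- a)) refl _ _ _) (sym (g≈ n))) ⟩
      ∑ M g ∎

    α-vanish : ∀ J k b {n} → M ≤ n → q ^ α J k b n ≈ 0#
    α-vanish J k b {n} M≤n = ^-vanish M q^M≈0 (ℕₚ.≤-trans M≤n (ℕₚ.m≤n+m n (2 ℕ.* b ℕ.* n ℕ.+ 2 ℕ.* (1 ℕ.+ (k ℕ.+ b)) ℕ.* n ℕ.* (n ℕ.+ J))))

    A-first : ∀ J b → A J 0 b ≈ A (suc J) b 0
    A-first J b = ∑-reflect a c f≈ g≈
        (solve 2 (λ x y → x :* (y :* (con (+ 1) :- con (+ 1))) := con (+ 0)) refl _ _)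
        (trans (*-congˡ (trans (*-congʳ (α-vanish J 0 b ℕₚ.≤-refl)) (zeroˡ _))) (zeroʳ _))
      where
      a c : ℕ → Carrier
      a n = K J n * (q ^ α J 0 b n * (1# - q ^ (2 ℕ.* n)))
      c n = K J n * (q ^ α J 0 b n * q ^ (2 ℕ.* n) * (1# - q ^ (2 ℕ.* n ℕ.+ 2 ℕ.* J ℕ.+ 2)))
      e : ∀ n J → 2 ℕ.* n ℕ.+ 2 ℕ.* J ℕ.+ 1 ℕ.+ (2 ℕ.* n ℕ.+ 1) ≡ 2 ℕ.* n ℕ.+ (2 ℕ.* n ℕ.+ 2 ℕ.* J ℕ.+ 2)
      e = solve-∀
      f≈ : ∀ n → term J 0 b n ≈ sgn n * (a n + c n)
      f≈ n = *-congˡ (begin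
        k * (p * (1# + y) - q ^ β J 0 b n * (1# + z))
          ≈⟨ *-congˡ (+-congˡ (-‿cong (*-congʳ (q^-split (α J 0 b n) _ (β-first J b n))))) ⟩
        k * (p * (1# + y) - p * y * (1# + z))
          ≈⟨ solve 4 (λ k p y z → k :* (p :* (con (+ 1) :+ y) :- p :* y :* (con (+ 1) :+ z)) := k :* (p :* (con (+ 1) :- y :* z))) refl k p y z ⟩
        k * (p * (1# - y * z))
          -- Both products equal q^{4n+2J+2}. In the new form 1 - xw = (1 - x) + x(1 - w): the part
          -- with 1 - x vanishes at n = 0 and is reflected, the part with 1 - w has the factor
          -- supplied by `K-up`.
          ≈⟨ *-congˡ (*-congˡ (+-congˡ (-‿cong (q^-swap (2 ℕ.* n ℕ.+ 2 ℕ.* J ℕ.+ 1) (2 ℕ.* n ℕ.+ 1) (2 ℕ.* n) (2 ℕ.* n ℕ.+ 2 ℕ.* J ℕ.+ 2) (e n J))))) ⟩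
        k * (p * (1# - x * w))
          ≈⟨ solve 4 (λ k p x w → k :* (p :* (con (+ 1) :- x :* w)) := k :* (p :* (con (+ 1) :- x)) :+ k :* (p :* x :* (con (+ 1) :- w))) refl k p x w ⟩
        a n + c n ∎)
        where
        k = K J n
        p = q ^ α J 0 b n
        x = q ^ (2 ℕ.* n)
        y = q ^ (2 ℕ.* n ℕ.+ 2 ℕ.* J ℕ.+ 1)
        z = q ^ (2 ℕ.* n ℕ.+ 1)
        w = q ^ (2 ℕ.* n ℕ.+ 2 ℕ.* J ℕ.+ 2)
      g≈ : ∀ n → term (suc J) b 0 n ≈ sgn n * (c n - a (suc n))
      g≈ n = trans (term-up J b 0 n) (*-congˡ (+-cong
        (trans (*-congʳ (q^-split (α J 0 b n) _ (α-first J b n))) (solve 3 (λ p k w → p :* (k :* w) := k :* (p :* w)) refl _ _ _))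
        (-‿cong (trans (*-congʳ (^-congʳ q (β-last J b n))) (solve 3 (λ p k w → p :* (k :* w) := k :* (p :* w)) refl _ _ _)))))

    -- Both series of level J have the same r, hence differ only in the powers of q. In their
    -- difference the `α` parts leave a factor 1 - q^{2n} and the `β` parts a factor 1 -
    -- q^{2n+2J+2}; these are the factors that `term-up` produces from level J+1, the first of them
    -- at index n + 1.
    A-next : ∀ J k b → A J (suc k) b ≈ A J k (suc b) + (q ^ hi J k * A (suc J) b (suc k) + q ^ lo J k * A (suc J) (suc b) k)
    A-next J k b = begin
      A J (suc k) b
        ≈⟨ solve 2 (λ x y → x := y :+ (x :+ con (ℤ.- (+ 1)) :* y)) refl (A J (suc k) b) (A J k (suc b)) ⟩
      A J k (suc b) + (A J (suc k) b + - 1# * A J k (suc b))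
        ≈⟨ +-congˡ (trans (+-congˡ (*-∑ _ M _)) (sym (∑-+ M _ _))) ⟩
      A J k (suc b) + ∑ M (λ n → term J (suc k) b n + - 1# * term J k (suc b) n)
        ≈⟨ +-congˡ (∑-reflect a c f≈ g≈
             (solve 3 (λ x y z → x :* (y :* ((con (+ 1) :- con (+ 1)) :* z)) := con (+ 0)) refl _ _ _)
             (trans (*-congˡ (trans (*-congʳ (α-vanish J (suc k) b ℕₚ.≤-refl)) (zeroˡ _))) (zeroʳ _))) ⟩
      A J k (suc b) + ∑ M (λ n → q ^ hi J k * term (suc J) b (suc k) n + q ^ lo J k * term (suc J) (suc b) k n)
        ≈⟨ +-congˡ (trans (∑-+ M _ _) (sym (+-cong (*-∑ _ M _) (*-∑ _ M _)))) ⟩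
      A J k (suc b) + (q ^ hi J k * A (suc J) b (suc k) + q ^ lo J k * A (suc J) (suc b) k) ∎
      where
      a c : ℕ → Carrier
      a n = K J n * (q ^ α J (suc k) b n * ((1# - q ^ (2 ℕ.* n)) * (1# + q ^ (2 ℕ.* n ℕ.+ 2 ℕ.* J ℕ.+ 1))))
      c n = K J n * (q ^ β J k (suc b) n * ((1# - q ^ (2 ℕ.* n ℕ.+ 2 ℕ.* J ℕ.+ 2)) * (1# + q ^ (2 ℕ.* n ℕ.+ 1))))
      f≈ : ∀ n → term J (suc k) b n + - 1# * term J k (suc b) n ≈ sgn n * (a n + c n)
      f≈ n = begin
        s * (κ * (p * (1# + y) - q ^ β J (suc k) b n * (1# + z))) + - 1# * (s * (κ * (q ^ α J k (suc b) n * (1# + y) - r * (1# + z))))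
          ≈⟨ +-cong (*-congˡ (*-congˡ (+-congˡ (-‿cong (*-congʳ (q^-split (β J k (suc b) n) _ (β-shift J k b n)))))))
                    (*-congˡ (*-congˡ (*-congˡ (+-congʳ (*-congʳ (q^-split (α J (suc k) b n) _ (α-shift J k b n))))))) ⟩
        s * (κ * (p * (1# + y) - r * w * (1# + z))) + - 1# * (s * (κ * (p * x * (1# + y) - r * (1# + z))))
          ≈⟨ solve 8 (λ s κ p r x y z w →
               s :* (κ :* (p :* (con (+ 1) :+ y) :- r :* w :* (con (+ 1) :+ z))) :+ con (ℤ.- (+ 1)) :* (s :* (κ :* (p :* x :* (con (+ 1) :+ y) :- r :* (con (+ 1) :+ z))))
               := s :* (κ :* (p :* ((con (+ 1) :- x) :* (con (+ 1) :+ y))) :+ κ :* (r :* ((con (+ 1) :- w) :* (con (+ 1) :+ z)))))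
               refl s κ p r x y z w ⟩
        s * (a n + c n) ∎
        where
        s = sgn n
        κ = K J n
        p = q ^ α J (suc k) b n
        r = q ^ β J k (suc b) n
        x = q ^ (2 ℕ.* n)
        y = q ^ (2 ℕ.* n ℕ.+ 2 ℕ.* J ℕ.+ 1)
        z = q ^ (2 ℕ.* n ℕ.+ 1)
        w = q ^ (2 ℕ.* n ℕ.+ 2 ℕ.* J ℕ.+ 2)
      g≈ : ∀ n → q ^ hi J k * term (suc J) b (suc k) n + q ^ lo J k * term (suc J) (suc b) k n ≈ sgn n * (c n - a (suc n))
      g≈ n = begin
        q ^ hi J k * term (suc J) b (suc k) n + q ^ lo J k * term (suc J) (suc b) k n
          ≈⟨ +-cong (*-congˡ (term-up J b (suc k) n)) (*-congˡ (term-up J (suc b) k n)) ⟩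
        H * (s * (αh * (κ * w) - βh * (κ₁ * x₁))) + L * (s * (αl * (κ * w) - βl * (κ₁ * x₁)))
          ≈⟨ solve 11 (λ s H L αh αl βh βl κ κ₁ w x₁ →
               H :* (s :* (αh :* (κ :* w) :- βh :* (κ₁ :* x₁))) :+ L :* (s :* (αl :* (κ :* w) :- βl :* (κ₁ :* x₁)))
               := s :* ((H :* αh :+ L :* αl) :* (κ :* w) :- (H :* βh :+ L :* βl) :* (κ₁ :* x₁)))
               refl s H L αh αl βh βl κ κ₁ w x₁ ⟩
        s * ((H * αh + L * αl) * (κ * w) - (H * βh + L * βl) * (κ₁ * x₁))
          ≈⟨ *-congˡ (+-cong (*-congʳ (+-cong (q^-swap (hi J k) (α (suc J) b (suc k) n) (β J k (suc b) n) (2 ℕ.* n ℕ.+ 1) (hi+α J k b n)) (q^-join (lo J k) (α (suc J) (suc b) k n) (lo+α J k b n))))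
               (-‿cong (*-congʳ (+-cong (q^-join (hi J k) (β (suc J) b (suc k) n) (hi+β J k b n)) (q^-swap (lo J k) (β (suc J) (suc b) k n) (α J (suc k) b (suc n)) (2 ℕ.* suc n ℕ.+ 2 ℕ.* J ℕ.+ 1) (lo+β J k b n)))))) ⟩
        s * ((r * z + r) * (κ * w) - (p₁ + p₁ * y₁) * (κ₁ * x₁))
          ≈⟨ solve 9 (λ s r z κ w p₁ y₁ κ₁ x₁ →
               s :* ((r :* z :+ r) :* (κ :* w) :- (p₁ :+ p₁ :* y₁) :* (κ₁ :* x₁))
               := s :* (κ :* (r :* (w :* (con (+ 1) :+ z))) :- κ₁ :* (p₁ :* (x₁ :* (con (+ 1) :+ y₁)))))
               refl s r z κ w p₁ y₁ κ₁ x₁ ⟩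
        s * (c n - a (suc n)) ∎
        where
        s = sgn n
        H = q ^ hi J k
        L = q ^ lo J k
        αh = q ^ α (suc J) b (suc k) n
        αl = q ^ α (suc J) (suc b) k n
        βh = q ^ β (suc J) b (suc k) n
        βl = q ^ β (suc J) (suc b) k n
        κ = K J n
        κ₁ = K J (suc n)
        w = 1# - q ^ (2 ℕ.* n ℕ.+ 2 ℕ.* J ℕ.+ 2)
        x₁ = 1# - q ^ (2 ℕ.* suc n)
        r = q ^ β J k (suc b) n
        z = q ^ (2 ℕ.* n ℕ.+ 1)
        p₁ = q ^ α J (suc k) b (suc n)
        y₁ = q ^ (2 ℕ.* suc n ℕ.+ 2 ℕ.* J ℕ.+ 1)

    1+0≈1 : ∀ {x} → x ≈ 0# → 1# + x ≈ 1#
    1+0≈1 x≈0 = trans (+-congˡ x≈0) (+-identityʳ _)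

    q^-vanish : ∀ {e} → M ≤ e → q ^ e ≈ 0#
    q^-vanish = ^-vanish M q^M≈0

    h-vanish : ∀ m → M ≤ m → h (m ℕ.+ 1) ≈ 1#
    h-vanish m M≤m = trans (sym (*-identityˡ _)) (trans (*-congʳ (sym (1+0≈1 (q^-vanish (ℕₚ.≤-trans M≤m (ℕₚ.m≤m+n m 1)))))) (h-inverse′ m))

    M≤2* : ∀ {J} → M ≤ J → M ≤ 2 ℕ.* J
    M≤2* {J} M≤J = ℕₚ.≤-trans M≤J (ℕₚ.m≤m+n J _)

    K-stable : ∀ j → K (j ℕ.+ M) 0 ≈ K M 0
    K-stable zero = refl
    K-stable (suc j) = begin
      K (j ℕ.+ M) 0 * (1# - q ^ (2 ℕ.* (j ℕ.+ M) ℕ.+ 2)) * h (2 ℕ.* suc (j ℕ.+ M) ℕ.+ 1)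
        ≈⟨ *-cong (*-cong (K-stable j) (1-0≈1 (q^-vanish (ℕₚ.≤-trans (M≤2* M≤j+M) (ℕₚ.m≤m+n _ 2)))))
                  (h-vanish _ (M≤2* (ℕₚ.m≤n⇒m≤1+n M≤j+M))) ⟩
      K M 0 * 1# * 1#
        ≈⟨ solve 1 (λ x → x :* con (+ 1) :* con (+ 1) := x) refl _ ⟩
      K M 0 ∎
      where M≤j+M = ℕₚ.m≤n+m M j

    A-limit : 0 < M → ∀ {J} k b → M ≤ J → A J k b ≈ K M 0
    A-limit (s≤s {n = N} _) {J} k b M≤J = begin
      ∑ (suc N) (term J k b)
        ≈⟨ ∑-head N (term J k b) ⟩
      term J k b 0 + ∑ N (term J k b ∘ suc)
        ≈⟨ +-cong t₀ (∑-zero N tₙ) ⟩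
      K M 0 + 0#
        ≈⟨ +-identityʳ _ ⟩
      K M 0 ∎
      where
      β≈0 : ∀ n → q ^ β J k b n ≈ 0#
      β≈0 n = q^-vanish (ℕₚ.≤-trans M≤J (J≤β J k b n))
      K≈ : K J 0 ≈ K M 0
      K≈ = ≡.subst (λ i → K i 0 ≈ K M 0) (ℕₚ.m∸n+n≡m M≤J) (K-stable (J ℕ.∸ M))
      t₀ : term J k b 0 ≈ K M 0
      t₀ = trans (*-congˡ (*-cong K≈ (+-cong
             (*-cong (^-congʳ q (α-zero J k b)) (1+0≈1 (q^-vanish (ℕₚ.≤-trans (M≤2* M≤J) (ℕₚ.m≤m+n (2 ℕ.* J) 1)))))
             (-‿cong (*-congʳ (β≈0 0))))))
           (solve 2 (λ x y → con (+ 1) :* (x :* (con (+ 1) :* con (+ 1) :- con (+ 0) :* y)) := x) refl _ _)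
      tₙ : ∀ n → term J k b (suc n) ≈ 0#
      tₙ n = trans (*-congˡ (*-congˡ (+-cong (*-congʳ (q^-vanish (ℕₚ.≤-trans M≤J (J≤α J k b n)))) (-‿cong (*-congʳ (β≈0 (suc n)))))))
           (solve 4 (λ s x y z → s :* (x :* (con (+ 0) :* y :- con (+ 0) :* z)) := con (+ 0)) refl _ _ _ _)

    module _ (E : ℕ → ℕ → ℕ → Carrier)
             (E-first : ∀ J b → E J 0 b ≈ E (suc J) b 0)
             (E-next  : ∀ J k b → E J (suc k) b ≈ E J k (suc b) + (q ^ hi J k * E (suc J) b (suc k) + q ^ lo J k * E (suc J) (suc b) k))
             (E-limit : ∀ {J} k b → M ≤ J → E J k b ≈ 1#) (0<M : 0 < M) where

      -- Descending induction on J, with d the distance to the levels J ≥ M where both sides are the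
      -- limit. Within a level the induction is on k for all b at once, since the recursion moves
      -- one unit from k to b. Modulo q^M, `K M 0` is (q²;q²)_∞/(-q;q²)_∞.
      A-unique : ∀ d J k b → M ≤ d ℕ.+ J → A J k b ≈ E J k b * K M 0
      A-unique zero J k b M≤J = trans (A-limit 0<M k b M≤J) (trans (sym (*-identityˡ _)) (*-congʳ (sym (E-limit k b M≤J))))
      A-unique (suc d) J k b M≤ = go k b
        where
        ih : ∀ k b → A (suc J) k b ≈ E (suc J) k b * K M 0
        ih k b = A-unique d (suc J) k b (≡.subst (M ≤_) (≡.sym (ℕₚ.+-suc d J)) M≤)
        go : ∀ k b → A J k b ≈ E J k b * K M 0
        go zero b = trans (A-first J b) (trans (ih b 0) (*-congʳ (sym (E-first J b))))
        go (suc k) b = begin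
          A J (suc k) b
            ≈⟨ A-next J k b ⟩
          A J k (suc b) + (q ^ hi J k * A (suc J) b (suc k) + q ^ lo J k * A (suc J) (suc b) k)
            ≈⟨ +-cong (go k (suc b)) (+-cong (*-congˡ (ih b (suc k))) (*-congˡ (ih (suc b) k))) ⟩
          E J k (suc b) * κ + (q ^ hi J k * (E (suc J) b (suc k) * κ) + q ^ lo J k * (E (suc J) (suc b) k * κ))
            ≈⟨ solve 6 (λ e x f y g κ → e :* κ :+ (x :* (f :* κ) :+ y :* (g :* κ)) := (e :+ (x :* f :+ y :* g)) :* κ) refl _ _ _ _ _ _ ⟩
          (E J k (suc b) + (q ^ hi J k * E (suc J) b (suc k) + q ^ lo J k * E (suc J) (suc b) k)) * κ
            ≈⟨ *-congʳ (E-next J k b) ⟨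
          E J (suc k) b * κ ∎
          where κ = K M 0

    gauss-q^ : ∀ {Q m} → Q ≈ q ^ m → ∀ c n → gauss Q (q ^ c) n ≈ sgn n * q ^ γ m c n
    gauss-q^ Q≈ c zero = sym (*-identityˡ _)
    gauss-q^ {Q} {m} Q≈ c (suc n) = begin
      - (q ^ c * Q ^ n) * gauss Q (q ^ c) n
        ≈⟨ *-cong (-‿cong (*-congˡ (trans (^-congˡ n Q≈) (^-assocʳ q m n)))) (gauss-q^ Q≈ c n) ⟩
      - (q ^ c * q ^ (m ℕ.* n)) * (sgn n * q ^ γ m c n)
        ≈⟨ solve 4 (λ x y s z → :- (x :* y) :* (s :* z) := :- s :* (x :* y :* z)) refl _ _ _ _ ⟩
      - sgn n * (q ^ c * q ^ (m ℕ.* n) * q ^ γ m c n)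
        ≈⟨ *-congˡ (trans (*-congʳ (sym (^-homo-* q c (m ℕ.* n)))) (sym (^-homo-* q (c ℕ.+ m ℕ.* n) (γ m c n)))) ⟩
      - sgn n * q ^ (c ℕ.+ m ℕ.* n ℕ.+ γ m c n) ∎

    -- At J = 0 the two factors 1 + q^{2n+2J+1} and 1 + q^{2n+1} coincide and cancel the only
    -- denominator of `K 0 n`. The folded summands are then the two halves of a theta series, the
    -- second half beginning at index 1.
    A₀-theta : ∀ k b {Q} → Q ≈ q ^ modulus k b →
      A 0 k b ≈ ∑ M (gauss Q (q ^ (2 ℕ.* suc (k ℕ.+ b) ℕ.+ (2 ℕ.* b ℕ.+ 1)))) + ∑ M (gauss Q (q ^ (2 ℕ.* k ℕ.+ 1)) ∘ suc)
    A₀-theta k b {Q} Q≈ = trans (∑-cong M (λ n _ → step n)) (∑-+ M _ _)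
      where
      step : ∀ n → term 0 k b n ≈ gauss Q (q ^ (2 ℕ.* suc (k ℕ.+ b) ℕ.+ (2 ℕ.* b ℕ.+ 1))) n + gauss Q (q ^ (2 ℕ.* k ℕ.+ 1)) (suc n)
      step n = begin
        sgn n * (h z * (a * (1# + q ^ (2 ℕ.* n ℕ.+ 0 ℕ.+ 1)) - c * (1# + q ^ z)))
          ≡⟨ ≡.cong (λ x → sgn n * (h z * (a * (1# + q ^ (x ℕ.+ 1)) - c * (1# + q ^ z)))) (ℕₚ.+-identityʳ (2 ℕ.* n)) ⟩
        sgn n * (h z * (a * (1# + q ^ z) - c * (1# + q ^ z)))
          ≈⟨ solve 5 (λ s h a c w → s :* (h :* (a :* w :- c :* w)) := (w :* h) :* (s :* a :+ :- s :* c)) refl _ _ _ _ _ ⟩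
        (1# + q ^ z) * h z * (sgn n * a + - sgn n * c)
          ≈⟨ trans (*-congʳ (h-inverse′ (2 ℕ.* n))) (*-identityˡ _) ⟩
        sgn n * a + - sgn n * c
          ≈⟨ +-cong (trans (gauss-q^ {m = modulus k b} Q≈ (2 ℕ.* suc (k ℕ.+ b) ℕ.+ (2 ℕ.* b ℕ.+ 1)) n) (*-congˡ (^-congʳ q (γ-α k b n)))) (trans (gauss-q^ {m = modulus k b} Q≈ (2 ℕ.* k ℕ.+ 1) (suc n)) (*-congˡ (^-congʳ q (γ-β k b n)))) ⟨
        _ ∎
        where
        z = 2 ℕ.* n ℕ.+ 1
        a = q ^ α 0 k b n
        c = q ^ β 0 k b n

    q^-nilpotent : ∀ e → (q ^ (e ℕ.+ 1)) ^ M ≈ 0#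
    q^-nilpotent e = trans (^-congˡ M (q^-split {e ℕ.+ 1} 1 e (ℕₚ.+-comm e 1)))
      (trans (^-congˡ M (*-congʳ (*-identityʳ q))) (*-nilpotent M (q ^ e) q^M≈0))

    A₀-product : 0 < M → ∀ k b → let m = modulus k b ; c = 2 ℕ.* suc (k ℕ.+ b) ℕ.+ (2 ℕ.* b ℕ.+ 1) ; d = 2 ℕ.* k ℕ.+ 1 in
      A 0 k b ≈ ∏ M (λ s → 1# - q ^ (m ℕ.* suc s)) * (∏ M (λ s → 1# - q ^ (c ℕ.+ m ℕ.* s)) * ∏ M (λ s → 1# - q ^ (d ℕ.+ m ℕ.* s)))
    A₀-product 0<M k b = begin
      A 0 k b
        ≈⟨ A₀-theta k b Q≈ ⟩
      ∑ M (gauss Q u) + ∑ M (gauss Q v ∘ suc)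
        ≈⟨ jacobi-triple-product u v M u-nil (q^-nilpotent (2 ℕ.* k)) 0<M ⟩
      ∏ M (λ s → 1# - Q ^ suc s) * (∏ M (λ s → 1# - u * Q ^ s) * ∏ M (λ s → 1# - v * Q ^ s))
        ≈⟨ *-cong (∏-cong M (λ s _ → +-congˡ (-‿cong (Q^ (suc s)))))
             (*-cong (∏-cong M (λ s _ → +-congˡ (-‿cong (q^Q^ c s)))) (∏-cong M (λ s _ → +-congˡ (-‿cong (q^Q^ d s))))) ⟩
      _ ∎
      where
      m = modulus k b
      c = 2 ℕ.* suc (k ℕ.+ b) ℕ.+ (2 ℕ.* b ℕ.+ 1)
      d = 2 ℕ.* k ℕ.+ 1
      u = q ^ c
      v = q ^ d
      Q = u * v
      Q≈ : Q ≈ q ^ m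
      Q≈ = q^-join c d (residues-sum k b)
      u-nil : u ^ M ≈ 0#
      u-nil = ≡.subst (λ e → (q ^ e) ^ M ≈ 0#) (ℕₚ.+-assoc (2 ℕ.* suc (k ℕ.+ b)) (2 ℕ.* b) 1) (q^-nilpotent (2 ℕ.* suc (k ℕ.+ b) ℕ.+ 2 ℕ.* b))
      Q^ : ∀ s → Q ^ s ≈ q ^ (m ℕ.* s)
      Q^ s = trans (^-congˡ s Q≈) (^-assocʳ q m s)
      q^Q^ : ∀ e s → q ^ e * Q ^ s ≈ q ^ (e ℕ.+ m ℕ.* s)
      q^Q^ e s = trans (*-congˡ (Q^ s)) (sym (^-homo-* q e _))

-- Residue classes modulo 4 and 4r.

module Residues where

  ≡ᵇ-true : ∀ {m n} → (m ≡ᵇ n) ≡ true → m ≡ n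
  ≡ᵇ-true {m} {n} eq = ℕₚ.≡ᵇ⇒≡ m n (≡.subst T (≡.sym eq) _)

  ≡ᵇ-false : ∀ {m n} → m ≢ n → (m ≡ᵇ n) ≡ false
  ≡ᵇ-false {m} {n} m≢n with m ≡ᵇ n in eq
  ... | true  = ⊥-elim (m≢n (≡ᵇ-true eq))
  ... | false = ≡.refl

  ≡ᵇ-exclusive : ∀ m n {c d} → (m ≡ c → n ≡ d → ⊥) → (m ≡ᵇ c) ∧ (n ≡ᵇ d) ≡ false
  ≡ᵇ-exclusive m n {c} {d} excl with m ≡ᵇ c in eq
  ... | false = ≡.refl
  ... | true  = ≡ᵇ-false (excl (≡ᵇ-true eq))

  ≡ᵇ-refl : ∀ n → (n ≡ᵇ n) ≡ true
  ≡ᵇ-refl zero    = ≡.refl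
  ≡ᵇ-refl (suc n) = ≡ᵇ-refl n

  -- Factor number m belongs to position m - 1 of a product, so within a block of full period
  -- residue 0 sits at the last position and residue c + 1 at position c.
  residue-zero : ∀ a t j → j < suc a → (suc (j ℕ.+ t ℕ.* suc a) % suc a ≡ᵇ 0) ≡ (j ≡ᵇ a)
  residue-zero a t j (s≤s j≤a) = ≡.trans (≡.cong (_≡ᵇ 0) (DM.[m+kn]%n≡m%n (suc j) t (suc a))) (go (ℕₚ.m≤n⇒m<n∨m≡n j≤a))
    where
    go : j < a ⊎ j ≡ a → (suc j % suc a ≡ᵇ 0) ≡ (j ≡ᵇ a)
    go (inj₁ j<a)    = ≡.trans (≡.cong (_≡ᵇ 0) (DM.m<n⇒m%n≡m (s≤s j<a))) (≡.sym (≡ᵇ-false (ℕₚ.<⇒≢ j<a)))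
    go (inj₂ ≡.refl) = ≡.trans (≡.cong (_≡ᵇ 0) (DM.n%n≡0 (suc j))) (≡.sym (≡ᵇ-refl j))

  residue-suc : ∀ a t j c → j < suc a → c < a → (suc (j ℕ.+ t ℕ.* suc a) % suc a ≡ᵇ suc c) ≡ (j ≡ᵇ c)
  residue-suc a t j c (s≤s j≤a) c<a = ≡.trans (≡.cong (_≡ᵇ suc c) (DM.[m+kn]%n≡m%n (suc j) t (suc a))) (go (ℕₚ.m≤n⇒m<n∨m≡n j≤a))
    where
    go : j < a ⊎ j ≡ a → (suc j % suc a ≡ᵇ suc c) ≡ (j ≡ᵇ c)
    go (inj₁ j<a)    = ≡.cong (_≡ᵇ suc c) (DM.m<n⇒m%n≡m (s≤s j<a))
    go (inj₂ ≡.refl) = ≡.trans (≡.cong (_≡ᵇ suc c) (DM.n%n≡0 (suc j))) (≡.sym (≡ᵇ-false (ℕₚ.<⇒≢ c<a ∘ ≡.sym)))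

  -- Both moduli are even, so either residue determines the parity of m.
  odd-residue : ∀ r m c .{{_ : NonZero (4 ℕ.* r)}} → m % (4 ℕ.* r) ≡ 2 ℕ.* c ℕ.+ 1 → m % 4 ≢ 2
  odd-residue r m c eq m%4≡2 = 1≢0 (begin
      1                          ≡⟨ DM.[m+kn]%n≡m%n 1 c 2 ⟨
      (1 ℕ.+ c ℕ.* 2) % 2        ≡⟨ ≡.cong (_% 2) (≡.trans (ident c) (≡.sym eq)) ⟩
      m % (4 ℕ.* r) % 2          ≡⟨ DM.m∣n⇒o%n%m≡o%m 2 (4 ℕ.* r) m (divides (2 ℕ.* r) (ident₂ r)) ⟩
      m % 2                      ≡⟨ DM.m∣n⇒o%n%m≡o%m 2 4 m (divides 2 ≡.refl) ⟨
      m % 4 % 2                  ≡⟨ ≡.cong (_% 2) m%4≡2 ⟩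
      0                          ∎)
    where
    open ≡.≡-Reasoning
    1≢0 : 1 ≢ 0
    1≢0 ()
    ident : ∀ c → 1 ℕ.+ c ℕ.* 2 ≡ 2 ℕ.* c ℕ.+ 1
    ident = solve-∀
    ident₂ : ∀ r → 4 ℕ.* r ≡ 2 ℕ.* r ℕ.* 2
    ident₂ = solve-∀

  zero-residue : ∀ r m .{{_ : NonZero (4 ℕ.* r)}} → m % (4 ℕ.* r) ≡ 0 → m % 4 ≢ 2
  zero-residue r m eq m%4≡2 = 0≢2 (≡.trans (≡.cong (_% 4) (≡.sym eq))
      (≡.trans (DM.m∣n⇒o%n%m≡o%m 4 (4 ℕ.* r) m (divides r (ℕₚ.*-comm 4 r))) m%4≡2))
    where
    0≢2 : 0 ≢ 2
    0≢2 ()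

-- From the triple product to the product over allowed m.

module Products (R : CommutativeRing 0ℓ 0ℓ) (q : CommutativeRing.Carrier R) (M : ℕ) where

  open CommutativeRing R hiding (zero)
  open import Algebra.Properties.CommutativeSemiring.Exp commutativeSemiring
  open import Relation.Binary.Reasoning.Setoid setoid
  open IntegerCoefficients R
  open BigOperators R
  open Nilpotents R
  open QSeries R q M
  open Exponents
  open Residues

  select : Bool → Carrier → Carrier
  select true  x = x
  select false x = 1#

  select-cong : ∀ b {x y} → x ≈ y → select b x ≈ select b y
  select-cong true  x≈y = x≈y
  select-cong false x≈y = refl

  ∏-select-single : ∀ n c (x : ℕ → Carrier) → c < n → ∏ n (λ j → select (j ≡ᵇ c) (x j)) ≈ x c
  ∏-select-single (suc n) zero x _ = trans (∏-head n _) (trans (*-congˡ (∏-one n (λ _ _ → refl))) (*-identityʳ _))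
  ∏-select-single (suc n) (suc c) x (s≤s c<n) = trans (∏-head n _) (trans (*-identityˡ _) (∏-select-single n c (x ∘ suc) c<n))

  ∏-progression : ∀ a c (f : ℕ → Bool) (x : ℕ → Carrier) → c < a →
    (∀ t j → j < a → f (j ℕ.+ t ℕ.* a) ≡ (j ≡ᵇ c)) →
    ∀ t → ∏ (t ℕ.* a) (λ m → select (f m) (x m)) ≈ ∏ t (λ s → x (c ℕ.+ s ℕ.* a))
  ∏-progression a c f x c<a f≡ zero = refl
  ∏-progression a c f x c<a f≡ (suc t) = trans (∏-++ (t ℕ.* a) a _) (*-cong (∏-progression a c f x c<a f≡ t)
    (trans (∏-cong a (λ j j<a → reflexive (≡.cong (λ e → select e (x (j ℕ.+ t ℕ.* a))) (f≡ t j j<a))))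
           (∏-select-single a c (λ j → x (j ℕ.+ t ℕ.* a)) c<a)))

  φ : ℕ → Carrier
  φ m = 1# - q ^ suc m

  -- P f n = ∏_{1 ≤ m ≤ n, f m} (1 - q^m)
  P : (ℕ → Bool) → ℕ → Carrier
  P f n = ∏ n (λ m → select (f (suc m)) (φ m))

  P-inverse : (g : ℕ → Carrier) → (∀ m → φ m * g m ≈ 1#) → ∀ f n → P f n * ∏ n (λ m → select (f (suc m)) (g m)) ≈ 1#
  P-inverse g inv f n = trans (sym (∏-* n _ _)) (∏-one n (λ m _ → inverse (f (suc m)) m))
    where
    inverse : ∀ b m → select b (φ m) * select b (g m) ≈ 1#
    inverse true  m = inv m
    inverse false m = *-identityˡ _

  module _ (q^M≈0 : q ^ M ≈ 0#) where

    φ-inverse : ∀ m → φ m * geometric M (q ^ suc m) ≈ 1#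
    φ-inverse m = geometric-inverse M (*-nilpotent M (q ^ m) q^M≈0)

    P-cancel : ∀ f n {x y} → P f n * x ≈ P f n * y → x ≈ y
    P-cancel f n = cancel-unit (P-inverse _ φ-inverse f n)

    P-complement : ∀ f n → ∏ n φ ≈ P f n * P (not ∘ f) n
    P-complement f n = trans (∏-cong n (λ m _ → split (f (suc m)) (φ m))) (∏-* n _ _)
      where
      split : ∀ b x → x ≈ select b x * select (not b) x
      split true  x = sym (*-identityʳ _)
      split false x = sym (*-identityˡ _)

    ∏-stable : ∀ {n f} → M ≤ n → (∀ k → M ≤ k → f k ≈ 1#) → ∏ n f ≈ ∏ M f
    ∏-stable {n} {f} M≤n f≈1 = trans (reflexive (≡.cong (λ i → ∏ i f) (≡.sym (ℕₚ.m∸n+n≡m M≤n)))) (∏-truncate M f≈1 (n ℕ.∸ M))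

    1-q^≈1 : ∀ {e} → M ≤ e → 1# - q ^ e ≈ 1#
    1-q^≈1 M≤e = 1-0≈1 (^-vanish M q^M≈0 M≤e)

    h-square : ∀ m → h (m ℕ.+ 1) * (1# - q ^ (m ℕ.+ 1 ℕ.+ (m ℕ.+ 1))) ≈ 1# - q ^ (m ℕ.+ 1)
    h-square m = begin
      h m′ * (1# - q ^ (m′ ℕ.+ m′))             ≈⟨ *-congˡ (+-congˡ (-‿cong (^-homo-* q m′ m′))) ⟩
      h m′ * (1# - q ^ m′ * q ^ m′)             ≈⟨ solve 2 (λ h x → h :* (con (+ 1) :- x :* x) := ((con (+ 1) :+ x) :* h) :* (con (+ 1) :- x)) refl _ _ ⟩
      (1# + q ^ m′) * h m′ * (1# - q ^ m′)      ≈⟨ trans (*-congʳ (h-inverse′ q^M≈0 m)) (*-identityˡ _) ⟩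
      1# - q ^ m′                               ∎
      where m′ = m ℕ.+ 1

    -- Each factor 1/(1 + q^m) is (1 - q^m)/(1 - q^{2m}).
    K₀-finite : ∀ J → K J 0 * ∏ (suc J) (λ s → φ (1 ℕ.+ s ℕ.* 4)) ≈ ∏ (suc (J ℕ.* 2)) φ
    K₀-finite zero = trans (*-congˡ (*-identityˡ _)) (trans (h-square 0) (sym (*-identityˡ _)))
    K₀-finite (suc J) = begin
      K J 0 * (1# - q ^ (2 ℕ.* J ℕ.+ 2)) * h (2 ℕ.* suc J ℕ.+ 1) * (∏ (suc J) (λ s → φ (1 ℕ.+ s ℕ.* 4)) * φ (1 ℕ.+ suc J ℕ.* 4))
        ≈⟨ solve 5 (λ a b c d e → a :* b :* c :* (d :* e) := (a :* d) :* b :* (c :* e)) refl _ _ _ _ _ ⟩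
      K J 0 * ∏ (suc J) (λ s → φ (1 ℕ.+ s ℕ.* 4)) * (1# - q ^ (2 ℕ.* J ℕ.+ 2)) * (h (2 ℕ.* suc J ℕ.+ 1) * φ (1 ℕ.+ suc J ℕ.* 4))
        ≈⟨ *-cong (*-cong (K₀-finite J) (1-q^ (e₁ J))) (trans (*-congˡ (1-q^ (e₂ J))) (trans (h-square (2 ℕ.* suc J)) (1-q^ (e₃ J)))) ⟩
      ∏ (suc (J ℕ.* 2)) φ * φ (suc (J ℕ.* 2)) * φ (suc (suc (J ℕ.* 2))) ∎
      where
      1-q^ : ∀ {a b} → a ≡ b → 1# - q ^ a ≈ 1# - q ^ b
      1-q^ ≡.refl = refl
      e₁ : ∀ J → 2 ℕ.* J ℕ.+ 2 ≡ 2 ℕ.+ J ℕ.* 2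
      e₁ = solve-∀
      e₂ : ∀ J → 2 ℕ.+ (1 ℕ.+ J) ℕ.* 4 ≡ 2 ℕ.* (1 ℕ.+ J) ℕ.+ 1 ℕ.+ (2 ℕ.* (1 ℕ.+ J) ℕ.+ 1)
      e₂ = solve-∀
      e₃ : ∀ J → 2 ℕ.* (1 ℕ.+ J) ℕ.+ 1 ≡ 3 ℕ.+ J ℕ.* 2
      e₃ = solve-∀

    module _ (k b : ℕ) where

      private
        r = suc (k ℕ.+ b)
        a = 4 ℕ.* r
        -- A common cut-off for all products: a multiple of 4 and of 4r, so every residue class
        -- fills whole blocks, and at least M, beyond which the factors are 1.
        L = M ℕ.* a

        two zer odd₁ odd₂ : ℕ → Bool
        two  m = m % 4 ≡ᵇ 2
        zer  m = m % a ≡ᵇ 0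
        odd₁ m = m % a ≡ᵇ 2 ℕ.* r ℕ.+ (2 ℕ.* suc b ℕ.∸ 1)
        odd₂ m = m % a ≡ᵇ 2 ℕ.* r ℕ.∸ (2 ℕ.* suc b ℕ.∸ 1)

        c₁≡ : ∀ r b → 2 ℕ.* r ℕ.+ (2 ℕ.* suc b ℕ.∸ 1) ≡ suc (2 ℕ.* r ℕ.+ 2 ℕ.* b)
        c₁≡ r b = ≡.trans (≡.cong (2 ℕ.* r ℕ.+_) (ℕₚ.+-suc b (b ℕ.+ 0))) (ℕₚ.+-suc (2 ℕ.* r) (2 ℕ.* b))

        c₂≡ : 2 ℕ.* r ℕ.∸ (2 ℕ.* suc b ℕ.∸ 1) ≡ suc (2 ℕ.* k)
        c₂≡ = ≡.trans (≡.cong₂ ℕ._∸_ (ident k b) (ℕₚ.+-suc b (b ℕ.+ 0))) (ℕₚ.m+n∸n≡m (1 ℕ.+ 2 ℕ.* k) (suc (2 ℕ.* b)))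
          where
          ident : ∀ k b → 2 ℕ.* (1 ℕ.+ (k ℕ.+ b)) ≡ 1 ℕ.+ 2 ℕ.* k ℕ.+ (1 ℕ.+ 2 ℕ.* b)
          ident = solve-∀

        M≤L : M ≤ L
        M≤L = ℕₚ.m≤m*n M a

        φ-vanish : ∀ k → M ≤ k → φ k ≈ 1#
        φ-vanish k M≤k = 1-q^≈1 (ℕₚ.m≤n⇒m≤1+n M≤k)

        two-product : P two L ≈ ∏ (suc M) (λ s → φ (1 ℕ.+ s ℕ.* 4))
        two-product = begin
          P two L                                         ≡⟨ ≡.cong (P two) (ident M r) ⟩
          P two (M ℕ.* r ℕ.* 4)                           ≈⟨ ∏-progression 4 1 (two ∘ suc) φ (s≤s (s≤s z≤n)) (λ t j j<4 → residue-suc 3 t j 1 j<4 (s≤s (s≤s z≤n))) (M ℕ.* r) ⟩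
          ∏ (M ℕ.* r) (λ s → φ (1 ℕ.+ s ℕ.* 4))           ≈⟨ ∏-stable (ℕₚ.m≤m*n M r) small ⟩
          ∏ M (λ s → φ (1 ℕ.+ s ℕ.* 4))                   ≈⟨ ∏-stable (ℕₚ.n≤1+n M) small ⟨
          ∏ (suc M) (λ s → φ (1 ℕ.+ s ℕ.* 4))             ∎
          where
          ident : ∀ M r → M ℕ.* (4 ℕ.* r) ≡ M ℕ.* r ℕ.* 4
          ident = solve-∀
          small : ∀ k → M ≤ k → φ (1 ℕ.+ k ℕ.* 4) ≈ 1#
          small k M≤k = φ-vanish (1 ℕ.+ k ℕ.* 4) (ℕₚ.m≤n⇒m≤1+n (ℕₚ.≤-trans M≤k (ℕₚ.m≤m*n k 4)))

        -- After multiplication by the factors with m ≡ 2 modulo 4, both sides become (q;q)_∞: each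
        -- 1/(1 + q^m) with m odd equals (1 - q^m)/(1 - q^{2m}), and these 2m are the numbers ≡ 2
        -- modulo 4.
        K≈P : K M 0 ≈ P (not ∘ two) L
        K≈P = P-cancel two L (begin
          P two L * K M 0                                  ≈⟨ *-comm _ _ ⟩
          K M 0 * P two L                                  ≈⟨ *-congˡ two-product ⟩
          K M 0 * ∏ (suc M) (λ s → φ (1 ℕ.+ s ℕ.* 4))      ≈⟨ K₀-finite M ⟩
          ∏ (suc (M ℕ.* 2)) φ                              ≈⟨ ∏-stable (ℕₚ.m≤n⇒m≤1+n (ℕₚ.m≤m*n M 2)) φ-vanish ⟩
          ∏ M φ                                            ≈⟨ ∏-stable M≤L φ-vanish ⟨
          ∏ L φ                                            ≈⟨ P-complement two L ⟩
          P two L * P (not ∘ two) L                        ∎)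

        -- The three excluded classes modulo 4r are pairwise disjoint and contain no m ≡ 2 modulo 4.
        -- They contribute exactly the three products of the triple product identity.
        partition : P (not ∘ two) L ≈ P (allowedC r (suc b)) L * (P zer L * (P odd₁ L * P odd₂ L))
        partition = trans (∏-cong L (λ m _ → factor (suc m) (φ m)))
          (trans (∏-* L _ _) (*-congˡ (trans (∏-* L _ _) (*-congˡ (∏-* L _ _)))))
          where
          four : ∀ t z u v {x} → t ∧ z ≡ false → t ∧ u ≡ false → t ∧ v ≡ false → z ∧ u ≡ false → z ∧ v ≡ false → u ∧ v ≡ false →
            select (not t) x ≈ select (not t ∧ not z ∧ not u ∧ not v) x * (select z x * (select u x * select v x))
          four true  false false false _ _ _ _ _ _ = solve 0 (con (+ 1) := con (+ 1) :* (con (+ 1) :* (con (+ 1) :* con (+ 1)))) refl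
          four false true  false false _ _ _ _ _ _ = solve 1 (λ x → x := con (+ 1) :* (x :* (con (+ 1) :* con (+ 1)))) refl _
          four false false true  false _ _ _ _ _ _ = solve 1 (λ x → x := con (+ 1) :* (con (+ 1) :* (x :* con (+ 1)))) refl _
          four false false false true  _ _ _ _ _ _ = solve 1 (λ x → x := con (+ 1) :* (con (+ 1) :* (con (+ 1) :* x))) refl _
          four false false false false _ _ _ _ _ _ = solve 1 (λ x → x := x :* (con (+ 1) :* (con (+ 1) :* con (+ 1)))) refl _
          four true  true  _     _     () _ _ _ _ _
          four true  false true  _     _ () _ _ _ _
          four true  false false true  _ _ () _ _ _
          four false true  true  _     _ _ _ () _ _
          four false true  false true  _ _ _ _ () _
          four false false true  true  _ _ _ _ _ ()
          odd₁-form : suc (2 ℕ.* r ℕ.+ 2 ℕ.* b) ≡ 2 ℕ.* (r ℕ.+ b) ℕ.+ 1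
          odd₁-form = ident r b
            where
            ident : ∀ r b → 1 ℕ.+ (2 ℕ.* r ℕ.+ 2 ℕ.* b) ≡ 2 ℕ.* (r ℕ.+ b) ℕ.+ 1
            ident = solve-∀
          c₂<c₁ : suc (2 ℕ.* k) < suc (2 ℕ.* r ℕ.+ 2 ℕ.* b)
          c₂<c₁ = s≤s (ℕₚ.≤-trans (ℕₚ.*-monoʳ-< 2 (s≤s (ℕₚ.m≤m+n k b))) (ℕₚ.m≤m+n _ _))
          factor : ∀ m x → select (not (two m)) x ≈ select (allowedC r (suc b) m) x * (select (zer m) x * (select (odd₁ m) x * select (odd₂ m) x))
          factor m x = four (two m) (zer m) (odd₁ m) (odd₂ m)
            (≡ᵇ-exclusive (m % 4) (m % a) (λ m%4≡2 eq → zero-residue r m eq m%4≡2))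
            (≡ᵇ-exclusive (m % 4) (m % a) (λ m%4≡2 eq → odd-residue r m (r ℕ.+ b) (≡.trans eq (≡.trans (c₁≡ r b) odd₁-form)) m%4≡2))
            (≡ᵇ-exclusive (m % 4) (m % a) (λ m%4≡2 eq → odd-residue r m k (≡.trans eq (≡.trans c₂≡ (ℕₚ.+-comm 1 (2 ℕ.* k)))) m%4≡2))
            (≡ᵇ-exclusive (m % a) (m % a) (λ e₀ e₁ → 0≢suc (≡.trans (≡.sym e₀) (≡.trans e₁ (c₁≡ r b)))))
            (≡ᵇ-exclusive (m % a) (m % a) (λ e₀ e₂ → 0≢suc (≡.trans (≡.sym e₀) (≡.trans e₂ c₂≡))))
            (≡ᵇ-exclusive (m % a) (m % a) (λ e₁ e₂ → ℕₚ.<⇒≢ c₂<c₁ (≡.trans (≡.sym c₂≡) (≡.trans (≡.sym e₂) (≡.trans e₁ (c₁≡ r b))))))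
            where
            0≢suc : ∀ {n} → 0 ≢ suc n
            0≢suc ()

        progression : ∀ c (f : ℕ → Bool) → c < a → (∀ t j → j < a → f (suc (j ℕ.+ t ℕ.* a)) ≡ (j ≡ᵇ c)) →
          ∀ (e : ℕ → ℕ) → (∀ s → suc (c ℕ.+ s ℕ.* a) ≡ e s) → P f L ≈ ∏ M (λ s → 1# - q ^ e s)
        progression c f c<a f≡ e e≡ = trans (∏-progression a c (f ∘ suc) φ c<a f≡ M)
          (∏-cong M (λ s _ → +-congˡ (-‿cong (^-congʳ q (e≡ s)))))

        c₁<a′ : 2 ℕ.* r ℕ.+ 2 ℕ.* b < ℕ.pred a
        c₁<a′ = ℕₚ.≤-trans (ℕₚ.m≤m+n (suc (2 ℕ.* r ℕ.+ 2 ℕ.* b)) (2 ℕ.* k)) (ℕₚ.≤-reflexive (ident k b))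
          where
          ident : ∀ k b → 1 ℕ.+ (2 ℕ.* (1 ℕ.+ (k ℕ.+ b)) ℕ.+ 2 ℕ.* b) ℕ.+ 2 ℕ.* k ≡ (k ℕ.+ b) ℕ.+ (1 ℕ.+ (k ℕ.+ b) ℕ.+ (1 ℕ.+ (k ℕ.+ b) ℕ.+ (1 ℕ.+ (k ℕ.+ b) ℕ.+ 0)))
          ident = solve-∀

        c₂<a′ : 2 ℕ.* k < ℕ.pred a
        c₂<a′ = ℕₚ.<-trans (ℕₚ.≤-trans (ℕₚ.*-monoʳ-< 2 (s≤s (ℕₚ.m≤m+n k b))) (ℕₚ.m≤m+n _ _)) c₁<a′

        zer-product : P zer L ≈ ∏ M (λ s → 1# - q ^ (a ℕ.* suc s))
        zer-product = progression (ℕ.pred a) zer ℕₚ.≤-refl (λ t j j<a → residue-zero (ℕ.pred a) t j j<a)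
          (λ s → a ℕ.* suc s) (λ s → ℕₚ.*-comm (suc s) a)

        odd₁-product : P odd₁ L ≈ ∏ M (λ s → 1# - q ^ (2 ℕ.* r ℕ.+ (2 ℕ.* b ℕ.+ 1) ℕ.+ a ℕ.* s))
        odd₁-product = progression (2 ℕ.* r ℕ.+ 2 ℕ.* b) odd₁ (ℕₚ.m<n⇒m<1+n c₁<a′)
          (λ t j j<a → ≡.trans (≡.cong (suc (j ℕ.+ t ℕ.* a) % a ≡ᵇ_) (c₁≡ r b)) (residue-suc (ℕ.pred a) t j _ j<a c₁<a′))
          _ (λ s → ident r b s a)
          where
          ident : ∀ r b s a → 1 ℕ.+ (2 ℕ.* r ℕ.+ 2 ℕ.* b ℕ.+ s ℕ.* a) ≡ 2 ℕ.* r ℕ.+ (2 ℕ.* b ℕ.+ 1) ℕ.+ a ℕ.* s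
          ident = solve-∀

        odd₂-product : P odd₂ L ≈ ∏ M (λ s → 1# - q ^ (2 ℕ.* k ℕ.+ 1 ℕ.+ a ℕ.* s))
        odd₂-product = progression (2 ℕ.* k) odd₂ (ℕₚ.m<n⇒m<1+n c₂<a′)
          (λ t j j<a → ≡.trans (≡.cong (suc (j ℕ.+ t ℕ.* a) % a ≡ᵇ_) c₂≡) (residue-suc (ℕ.pred a) t j _ j<a c₂<a′))
          _ (λ s → ident k s a)
          where
          ident : ∀ k s a → 1 ℕ.+ (2 ℕ.* k ℕ.+ s ℕ.* a) ≡ 2 ℕ.* k ℕ.+ 1 ℕ.+ a ℕ.* s
          ident = solve-∀

      -- With B the product over the three excluded classes, B = A = x K = x · allowed · B, and B is
      -- a unit, so x inverts the allowed product. The inverses `g` of the factors stay abstract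
      -- because the full series 1/(1 - q^m) and the truncated `geometric` are different
      -- representatives.
      allowed-product : 0 < M → ∀ {x} → A 0 k b ≈ x * K M 0 →
        ∀ (g : ℕ → Carrier) → (∀ m → φ m * g m ≈ 1#) →
        ∏ M (λ m → select (allowedC (suc (k ℕ.+ b)) (suc b) (suc m)) (g m)) ≈ x
      allowed-product 0<M {x} A≈ g inv = begin
        ∏ M (λ m → select (allowed (suc m)) (g m))
          ≈⟨ ∏-stable M≤L (λ m M≤m → one (allowed (suc m)) m M≤m) ⟨
        ∏ L (λ m → select (allowed (suc m)) (g m))
          ≈⟨ P-cancel allowed L (trans (P-inverse g inv allowed L) (sym allowed*x)) ⟩
        x ∎
        where
        allowed = allowedC r (suc b)
        B = P zer L * (P odd₁ L * P odd₂ L)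
        one : ∀ b m → M ≤ m → select b (g m) ≈ 1#
        one false m M≤m = refl
        one true  m M≤m = trans (sym (*-identityˡ _)) (trans (*-congʳ (sym (φ-vanish m M≤m))) (inv m))
        B-inverse : ∃ λ B⁻¹ → B * B⁻¹ ≈ 1#
        B-inverse = _ , trans (solve 6 (λ a b c d e f → (a :* (b :* c)) :* (d :* (e :* f)) := (a :* d) :* ((b :* e) :* (c :* f))) refl _ _ _ _ _ _)
          (trans (*-cong (P-inverse _ φ-inverse zer L) (*-cong (P-inverse _ φ-inverse odd₁ L) (P-inverse _ φ-inverse odd₂ L)))
                 (solve 0 (con (+ 1) :* (con (+ 1) :* con (+ 1)) := con (+ 1)) refl))
        allowed*x : P allowed L * x ≈ 1#
        allowed*x = cancel-unit (proj₂ B-inverse) (begin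
          B * (P allowed L * x)     ≈⟨ solve 3 (λ b p x → b :* (p :* x) := x :* (p :* b)) refl _ _ _ ⟩
          x * (P allowed L * B)     ≈⟨ *-congˡ (trans K≈P partition) ⟨
          x * K M 0                 ≈⟨ A≈ ⟨
          A 0 k b                   ≈⟨ A₀-product q^M≈0 0<M k b ⟩
          _                         ≈⟨ *-cong zer-product (*-cong odd₁-product odd₂-product) ⟨
          B                         ≈⟨ *-identityʳ _ ⟨
          B * 1#                    ∎)

-- The Cauchy product of integer power series.

module Convolution where

  open ≡ using (refl; sym; trans; cong; cong₂; module ≡-Reasoning)
  open ≡.≡-Reasoning

  sumTo-cong : ∀ n {f g} → (∀ j → j ≤ n → f j ≡ g j) → sumTo n f ≡ sumTo n g
  sumTo-cong zero    f≡g = f≡g 0 z≤n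
  sumTo-cong (suc n) f≡g = cong₂ ℤ._+_ (sumTo-cong n (λ j j≤n → f≡g j (ℕₚ.m≤n⇒m≤1+n j≤n))) (f≡g (suc n) ℕₚ.≤-refl)

  sumTo-head : ∀ n f → sumTo (suc n) f ≡ f 0 ℤ.+ sumTo n (f ∘ suc)
  sumTo-head zero    f = refl
  sumTo-head (suc n) f = trans (cong (ℤ._+ f (suc (suc n))) (sumTo-head n f)) (ℤₚ.+-assoc (f 0) _ _)

  sumTo-+ : ∀ n f g → sumTo n (λ j → f j ℤ.+ g j) ≡ sumTo n f ℤ.+ sumTo n g
  sumTo-+ zero    f g = refl
  sumTo-+ (suc n) f g = trans (cong (ℤ._+ (f (suc n) ℤ.+ g (suc n))) (sumTo-+ n f g)) (interchange (sumTo n f) (sumTo n g) (f (suc n)) (g (suc n)))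
    where
    interchange : ∀ a b c d → a ℤ.+ b ℤ.+ (c ℤ.+ d) ≡ a ℤ.+ c ℤ.+ (b ℤ.+ d)
    interchange = ℤ-solve-∀

  sumTo-* : ∀ n c f → sumTo n (λ j → c ℤ.* f j) ≡ c ℤ.* sumTo n f
  sumTo-* zero    c f = refl
  sumTo-* (suc n) c f = trans (cong (ℤ._+ c ℤ.* f (suc n)) (sumTo-* n c f)) (sym (ℤₚ.*-distribˡ-+ c _ _))

  sumTo-zero : ∀ n {f} → (∀ j → f j ≡ + 0) → sumTo n f ≡ + 0
  sumTo-zero zero    f≡0 = f≡0 0
  sumTo-zero (suc n) f≡0 = cong₂ ℤ._+_ (sumTo-zero n f≡0) (f≡0 (suc n))

  *ₚ-head : ∀ f g n → (f *ₚ g) (suc n) ≡ f 0 ℤ.* g (suc n) ℤ.+ ((f ∘ suc) *ₚ g) n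
  *ₚ-head f g n = sumTo-head n _

  *ₚ-last : ∀ f g n → (f *ₚ g) (suc n) ≡ (f *ₚ (g ∘ suc)) n ℤ.+ f (suc n) ℤ.* g 0
  *ₚ-last f g n = cong₂ ℤ._+_
    (sumTo-cong n (λ j j≤n → cong (λ i → f j ℤ.* g i) (ℕₚ.+-∸-assoc 1 j≤n)))
    (cong (λ i → f (suc n) ℤ.* g i) (ℕₚ.n∸n≡0 n))

  -- Peeling the first summand on one side and the last on the other reduces the claim to degree n
  -- for a shifted factor, so the reversal j ↦ n - j of the sum is never carried out explicitly.
  *ₚ-comm : ∀ n f g → (f *ₚ g) n ≡ (g *ₚ f) n
  *ₚ-comm zero    f g = ℤₚ.*-comm (f 0) (g 0)
  *ₚ-comm (suc n) f g = begin
    (f *ₚ g) (suc n)                              ≡⟨ *ₚ-head f g n ⟩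
    f 0 ℤ.* g (suc n) ℤ.+ ((f ∘ suc) *ₚ g) n      ≡⟨ cong₂ ℤ._+_ (ℤₚ.*-comm (f 0) _) (*ₚ-comm n (f ∘ suc) g) ⟩
    g (suc n) ℤ.* f 0 ℤ.+ (g *ₚ (f ∘ suc)) n      ≡⟨ ℤₚ.+-comm (g (suc n) ℤ.* f 0) _ ⟩
    (g *ₚ (f ∘ suc)) n ℤ.+ g (suc n) ℤ.* f 0      ≡⟨ *ₚ-last g f n ⟨
    (g *ₚ f) (suc n)                              ∎

  *ₚ-distribʳ : ∀ n h f g → ((λ i → f i ℤ.+ g i) *ₚ h) n ≡ (f *ₚ h) n ℤ.+ (g *ₚ h) n
  *ₚ-distribʳ n h f g = trans (sumTo-cong n (λ j _ → ℤₚ.*-distribʳ-+ (h (n ∸ j)) (f j) (g j))) (sumTo-+ n _ _)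

  *ₚ-scale : ∀ n c f g → ((λ i → c ℤ.* f i) *ₚ g) n ≡ c ℤ.* (f *ₚ g) n
  *ₚ-scale n c f g = trans (sumTo-cong n (λ j _ → ℤₚ.*-assoc c (f j) (g (n ∸ j)))) (sumTo-* n c _)

  *ₚ-congˡ : ∀ n {f g} h → (∀ j → j ≤ n → f j ≡ g j) → (f *ₚ h) n ≡ (g *ₚ h) n
  *ₚ-congˡ n h f≡g = sumTo-cong n (λ j j≤n → cong (ℤ._* h (n ∸ j)) (f≡g j j≤n))

  *ₚ-assoc : ∀ n f g h → ((f *ₚ g) *ₚ h) n ≡ (f *ₚ (g *ₚ h)) n
  *ₚ-assoc zero    f g h = ℤₚ.*-assoc (f 0) (g 0) (h 0)
  *ₚ-assoc (suc n) f g h = begin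
    ((f *ₚ g) *ₚ h) (suc n)
      ≡⟨ *ₚ-head (f *ₚ g) h n ⟩
    f 0 ℤ.* g 0 ℤ.* h (suc n) ℤ.+ (((f *ₚ g) ∘ suc) *ₚ h) n
      ≡⟨ cong (λ x → f 0 ℤ.* g 0 ℤ.* h (suc n) ℤ.+ x) (trans (*ₚ-congˡ n h (λ j _ → *ₚ-head f g j)) (*ₚ-distribʳ n h (λ j → f 0 ℤ.* g (suc j)) ((f ∘ suc) *ₚ g))) ⟩
    f 0 ℤ.* g 0 ℤ.* h (suc n) ℤ.+ (((λ j → f 0 ℤ.* g (suc j)) *ₚ h) n ℤ.+ (((f ∘ suc) *ₚ g) *ₚ h) n)
      ≡⟨ cong (λ x → f 0 ℤ.* g 0 ℤ.* h (suc n) ℤ.+ x) (cong₂ ℤ._+_ (*ₚ-scale n (f 0) (g ∘ suc) h) (*ₚ-assoc n (f ∘ suc) g h)) ⟩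
    f 0 ℤ.* g 0 ℤ.* h (suc n) ℤ.+ (f 0 ℤ.* ((g ∘ suc) *ₚ h) n ℤ.+ ((f ∘ suc) *ₚ (g *ₚ h)) n)
      ≡⟨ factor (f 0) (g 0) (h (suc n)) _ _ ⟩
    f 0 ℤ.* (g 0 ℤ.* h (suc n) ℤ.+ ((g ∘ suc) *ₚ h) n) ℤ.+ ((f ∘ suc) *ₚ (g *ₚ h)) n
      ≡⟨ cong (λ x → f 0 ℤ.* x ℤ.+ ((f ∘ suc) *ₚ (g *ₚ h)) n) (*ₚ-head g h n) ⟨
    f 0 ℤ.* (g *ₚ h) (suc n) ℤ.+ ((f ∘ suc) *ₚ (g *ₚ h)) n
      ≡⟨ *ₚ-head f (g *ₚ h) n ⟨
    (f *ₚ (g *ₚ h)) (suc n) ∎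
    where
    factor : ∀ a b c x y → a ℤ.* b ℤ.* c ℤ.+ (a ℤ.* x ℤ.+ y) ≡ a ℤ.* (b ℤ.* c ℤ.+ x) ℤ.+ y
    factor = ℤ-solve-∀

  0*ₚ : ∀ n f → ((λ _ → + 0) *ₚ f) n ≡ + 0
  0*ₚ n f = sumTo-zero n (λ j → ℤₚ.*-zeroˡ (f (n ∸ j)))

  1*ₚ : ∀ n f → (oneₚ *ₚ f) n ≡ f n
  1*ₚ zero    f = ℤₚ.*-identityˡ (f 0)
  1*ₚ (suc n) f = trans (*ₚ-head oneₚ f n) (trans (cong₂ ℤ._+_ (ℤₚ.*-identityˡ (f (suc n))) (0*ₚ n f)) (ℤₚ.+-identityʳ _))

  X : PS
  X zero    = + 0
  X (suc n) = oneₚ n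

  X*ₚ-zero : ∀ f → (X *ₚ f) 0 ≡ + 0
  X*ₚ-zero f = ℤₚ.*-zeroˡ (f 0)

  X*ₚ-suc : ∀ f n → (X *ₚ f) (suc n) ≡ f n
  X*ₚ-suc f n = trans (*ₚ-head X f n) (trans (cong₂ ℤ._+_ (ℤₚ.*-zeroˡ (f (suc n))) (1*ₚ n f)) (ℤₚ.+-identityˡ _))

-- Power series modulo q^{N+1}.

module Truncated (N : ℕ) where

  open ≡ using (refl; sym; trans; cong; cong₂)
  open Convolution

  infix 4 _≈_
  -- The quotient by q^{N+1} is formed by coarsening equality while keeping full series as elements:
  -- the ring laws are those of the Cauchy product, and truncation matters only for congruence.
  record _≈_ (f g : PS) : Set where
    constructor mk≈
    field coeff : ∀ n → n ≤ N → f n ≡ g n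
  open _≈_ public

  commutativeRing : CommutativeRing 0ℓ 0ℓ
  commutativeRing = record
    { Carrier = PS
    ; _≈_ = _≈_
    ; _+_ = λ f g n → f n ℤ.+ g n
    ; _*_ = _*ₚ_
    ; -_ = λ f n → ℤ.- f n
    ; 0# = λ _ → + 0
    ; 1# = oneₚ
    ; isCommutativeRing = record
      { isRing = record
        { +-isAbelianGroup = record
          { isGroup = record
            { isMonoid = record
              { isSemigroup = record
                { isMagma = record
                  { isEquivalence = record
                    { refl = mk≈ (λ _ _ → refl)
                    ; sym = λ p → mk≈ (λ n n≤N → sym (coeff p n n≤N))
                    ; trans = λ p q → mk≈ (λ n n≤N → trans (coeff p n n≤N) (coeff q n n≤N)) }
                  ; ∙-cong = λ p q → mk≈ (λ n n≤N → cong₂ ℤ._+_ (coeff p n n≤N) (coeff q n n≤N)) }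
                ; assoc = λ f g h → mk≈ (λ n _ → ℤₚ.+-assoc (f n) (g n) (h n)) }
              ; identity = (λ f → mk≈ (λ n _ → ℤₚ.+-identityˡ (f n))) , (λ f → mk≈ (λ n _ → ℤₚ.+-identityʳ (f n))) }
            ; inverse = (λ f → mk≈ (λ n _ → ℤₚ.+-inverseˡ (f n))) , (λ f → mk≈ (λ n _ → ℤₚ.+-inverseʳ (f n)))
            ; ⁻¹-cong = λ p → mk≈ (λ n n≤N → cong ℤ.-_ (coeff p n n≤N)) }
          ; comm = λ f g → mk≈ (λ n _ → ℤₚ.+-comm (f n) (g n)) }
        ; *-cong = λ p q → mk≈ (λ n n≤N → sumTo-cong n (λ j j≤n →
            cong₂ ℤ._*_ (coeff p j (ℕₚ.≤-trans j≤n n≤N)) (coeff q (n ∸ j) (ℕₚ.≤-trans (ℕₚ.m∸n≤m n j) n≤N))))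
        ; *-assoc = λ f g h → mk≈ (λ n _ → *ₚ-assoc n f g h)
        ; *-identity = (λ f → mk≈ (λ n _ → 1*ₚ n f)) , (λ f → mk≈ (λ n _ → trans (*ₚ-comm n f oneₚ) (1*ₚ n f)))
        ; distrib = (λ h f g → mk≈ (λ n _ → trans (*ₚ-comm n h (λ i → f i ℤ.+ g i)) (trans (*ₚ-distribʳ n h f g) (cong₂ ℤ._+_ (*ₚ-comm n f h) (*ₚ-comm n g h)))))
                  , (λ h f g → mk≈ (λ n _ → *ₚ-distribʳ n h f g)) }
      ; *-comm = λ f g → mk≈ (λ n _ → *ₚ-comm n f g) } }

  open CommutativeRing commutativeRing using (_+_; _*_; _-_; 0#; 1#; commutativeSemiring)
  open import Algebra.Properties.CommutativeSemiring.Exp commutativeSemiring using (_^_)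

  X^-shift : ∀ e f n → (X ^ e * f) (e ℕ.+ n) ≡ f n
  X^-shift zero    f n = 1*ₚ n f
  X^-shift (suc e) f n = trans (*ₚ-assoc (suc e ℕ.+ n) X (X ^ e) f) (trans (X*ₚ-suc (X ^ e * f) (e ℕ.+ n)) (X^-shift e f n))

  X^-below : ∀ e f {n} → n < e → (X ^ e * f) n ≡ + 0
  X^-below (suc e) f {zero}  _         = trans (*ₚ-assoc 0 X (X ^ e) f) (X*ₚ-zero (X ^ e * f))
  X^-below (suc e) f {suc n} (s≤s n<e) = trans (*ₚ-assoc (suc n) X (X ^ e) f) (trans (X*ₚ-suc (X ^ e * f) n) (X^-below e f n<e))

  X^-nilpotent : X ^ suc N ≈ 0#
  X^-nilpotent = mk≈ (λ n n≤N → trans (sym (trans (*ₚ-comm n (X ^ suc N) oneₚ) (1*ₚ n (X ^ suc N)))) (X^-below (suc N) oneₚ (s≤s n≤N)))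

  -- The coefficients of `geom s` have period s. Subtracting the copy shifted by s leaves those
  -- below s, and there only the constant term is nonzero.
  geom-inverse : ∀ m → (1# - X ^ suc m) * geom (suc m) ≈ 1#
  geom-inverse m = mk≈ (λ n _ → trans (*ₚ-distribʳ n (geom s) oneₚ (λ i → ℤ.- (X ^ s) i)) (trans
      (cong₂ ℤ._+_ (1*ₚ n (geom s)) (trans (*ₚ-congˡ n (geom s) (λ j _ → sym (ℤₚ.-1*i≡-i ((X ^ s) j)))) (trans (*ₚ-scale n (ℤ.- (+ 1)) (X ^ s) (geom s)) (ℤₚ.-1*i≡-i _))))
      (at n)))
    where
    s = suc m
    at : ∀ n → geom s n ℤ.- (X ^ s * geom s) n ≡ oneₚ n
    at n with ℕₚ.<-≤-connex n s
    at zero | inj₁ n<s = cong₂ ℤ._-_ (cong (λ b → if b then + 1 else + 0) (dec-true (s ∣? 0) (s ∣0))) (X^-below s (geom s) n<s)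
    at (suc n) | inj₁ n<s = cong₂ ℤ._-_
      (cong (λ b → if b then + 1 else + 0) (dec-false (s ∣? suc n) (λ s∣n → ℕₚ.<⇒≱ n<s (∣⇒≤ s∣n)))) (X^-below s (geom s) n<s)
    at n | inj₂ s≤n with n ∸ s | ℕₚ.m+[n∸m]≡n s≤n
    ... | n′ | refl = trans (cong₂ ℤ._-_ (cong (λ b → if b then + 1 else + 0)
      (does-⇔ (mk⇔ (λ d → ∣m+n∣m⇒∣n d ∣-refl) (∣m∣n⇒∣m+n ∣-refl)) (s ∣? (s ℕ.+ n′)) (s ∣? n′))) (X^-shift s (geom s) n′)) (ℤₚ.+-inverseʳ (geom s n′))

-- Cardinalities of predicates.

module Sizes where

  open ≡ using (refl; trans)
  open import Data.Nat using (_+_)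
  open ℕₚ
  open Equivalence

  size-⇔ : ∀ {A : Set} {P Q : A → Set} {n} → (∀ x → P x ⇔ Q x) → HasSize P n → HasSize Q n
  size-⇔ P⇔Q (xs , unique , ∈⇔P , len) = xs , unique , (λ x → ⇔-trans (∈⇔P x) (P⇔Q x)) , len

  size-≡ : ∀ {A : Set} {P : A → Set} {m n} → m ≡ n → HasSize P m → HasSize P n
  size-≡ m≡n (xs , unique , ∈⇔P , len) = xs , unique , ∈⇔P , trans len m≡n

  size-empty : ∀ {A : Set} {P : A → Set} → (∀ x → ¬ P x) → HasSize P 0
  size-empty ¬P = [] , AllPairs.[] , (λ x → mk⇔ (λ ()) (⊥-elim ∘ ¬P x)) , refl

  size-single : ∀ {A : Set} (a : A) → HasSize (_≡ a) 1
  size-single a = a ∷ [] , All.[] AllPairs.∷ AllPairs.[] , (λ x → mk⇔ (λ { (here eq) → eq ; (there ()) }) here) , refl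

  size-⊎ : ∀ {A : Set} {P Q : A → Set} {m n} → (∀ x → P x → Q x → ⊥) →
           HasSize P m → HasSize Q n → HasSize (λ x → P x ⊎ Q x) (m + n)
  size-⊎ disjoint (xs , uxs , ∈xs , refl) (ys , uys , ∈ys , refl) =
    xs ++ ys ,
    Uniqueₚ.++⁺ uxs uys (λ { (x∈xs , x∈ys) → disjoint _ (to (∈xs _) x∈xs) (to (∈ys _) x∈ys) }) ,
    (λ x → mk⇔ ([ inj₁ ∘ to (∈xs x) , inj₂ ∘ to (∈ys x) ] ∘ ∈-++⁻ xs)
               [ ∈-++⁺ˡ ∘ from (∈xs x) , ∈-++⁺ʳ xs ∘ from (∈ys x) ]) ,
    length-++ xs

  size-map : ∀ {A B : Set} {P : A → Set} {n} (f : A → B) → (∀ {x y} → f x ≡ f y → x ≡ y) →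
             HasSize P n → HasSize (λ y → ∃ λ x → y ≡ f x × P x) n
  size-map f injective (xs , uxs , ∈xs , refl) =
    map f xs , Uniqueₚ.map⁺ injective uxs ,
    (λ y → mk⇔ (λ y∈ → let x , x∈ , eq = ∈-map⁻ f y∈ in x , eq , to (∈xs x) x∈)
               (λ { (x , refl , Px) → ∈-map⁺ f (from (∈xs x) Px) })) ,
    length-map f xs

-- Coefficient sequences of 1 and of q^a times a series.

module Shifts where

  open ≡ using (refl; cong)
  open import Data.Nat using (_+_)
  open ℕₚ
  δ : ℕ → ℕ
  δ zero    = 1
  δ (suc _) = 0

  -- Multiplication of a generating function by q^a, on coefficients.
  shift : ℕ → (ℕ → ℕ) → ℕ → ℕ
  shift zero    f n       = f n
  shift (suc a) f zero    = 0
  shift (suc a) f (suc n) = shift a f n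

  shift-below : ∀ a f {n} → n < a → shift a f n ≡ 0
  shift-below (suc a) f {zero}  _         = refl
  shift-below (suc a) f {suc n} (s≤s n<a) = shift-below a f n<a

  shift-+ : ∀ a f n → shift a f (a + n) ≡ f n
  shift-+ zero    f n = refl
  shift-+ (suc a) f n = shift-+ a f n

  shift-cong : ∀ a {f g} n → (∀ j → j ≤ n → f j ≡ g j) → shift a f n ≡ shift a g n
  shift-cong zero    n       f≡g = f≡g n ≤-refl
  shift-cong (suc a) zero    f≡g = refl
  shift-cong (suc a) (suc n) f≡g = shift-cong a n (λ j j≤n → f≡g j (m≤n⇒m≤1+n j≤n))

  size-shift : ∀ {A : Set} {w : A → ℕ} {P : A → Set} {f : ℕ → ℕ} →
    (∀ n → HasSize (λ x → w x ≡ n × P x) (f n)) →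
    ∀ a n → HasSize (λ x → a + w x ≡ n × P x) (shift a f n)
  size-shift sizes zero    n       = sizes n
  size-shift sizes (suc a) zero    = Sizes.size-empty (λ { x (() , _) })
  size-shift sizes (suc a) (suc n) = Sizes.size-⇔
    (λ x → mk⇔ (λ { (eq , Px) → cong suc eq , Px }) (λ { (eq , Px) → suc-injective eq , Px })) (size-shift sizes a n)

-- Counting exponent vectors by weight.

module Counting (r : ℕ) where

  open ≡ using (refl; sym; trans; cong; cong₂; subst; module ≡-Reasoning)
  open import Data.Nat using (_+_; _*_)
  open ℕₚ
  open Sizes
  open Shifts

  -- The entries are the exponents of x_{2a+1}, x_{2a+2}, x_{2a+3}, ….
  Good : ∀ {m} → ℕ → Vec ℕ m → Set
  Good i []           = ⊤
  Good i (c ∷ [])     = c ≤ 1 × c < i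
  Good i (c ∷ d ∷ xs) = c ≤ 1 × c + d < i × Good (r ∸ d) xs

  -- The recursion runs over the bound i on the first pair instead of over its exponents: going from
  -- i + 1 to i + 2 admits only the pairs (0, i+1) and (1, i), after which the next pair has bound r
  -- - (i+1) or r - i. Here o is the index of the first variable, m the number of variables and n
  -- the weight.
  cnt : ℕ → ℕ → ℕ → ℕ → ℕ
  cnt zero          o i             n = δ n
  cnt (suc zero)    o zero          n = 0
  cnt (suc zero)    o (suc zero)    n = δ n
  cnt (suc zero)    o (suc (suc i)) n = δ n + shift o δ n
  cnt (suc (suc m)) o zero          n = 0
  cnt (suc (suc m)) o (suc zero)    n = cnt m (2 + o) r n
  cnt (suc (suc m)) o (suc (suc i)) n = cnt (suc (suc m)) o (suc i) n
    + (shift (suc o * suc i) (cnt m (2 + o) (r ∸ suc i)) n + shift (o + suc o * i) (cnt m (2 + o) (r ∸ i)) n)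

  Counted : (m o i n : ℕ) → Vec ℕ m → Set
  Counted m o i n xs = wt o xs ≡ n × Good i xs

  δ-size : ∀ n → HasSize {Vec ℕ 0} (λ xs → 0 ≡ n × ⊤) (δ n)
  δ-size zero    = size-⇔ (λ { [] → mk⇔ (λ _ → refl , tt) (λ _ → refl) }) (size-single [])
  δ-size (suc n) = size-empty (λ { x (() , _) })

  size-prepend₁ : ∀ c o n → HasSize {Vec ℕ 1} (λ xs → ∃ λ ys → xs ≡ c ∷ ys × (o * c + wt (suc o) ys ≡ n × ⊤)) (shift (o * c) δ n)
  size-prepend₁ c o n = size-map (c ∷_) (λ { refl → refl })
    (size-⇔ (λ { [] → mk⇔ (λ p → p) (λ p → p) }) (size-shift δ-size (o * c) n))

  cnt-size : ∀ m o i n → HasSize (Counted m o i n) (cnt m o i n)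

  size-prepend₂ : ∀ m o c d n → HasSize {Vec ℕ (suc (suc m))} (λ xs → Σ (Vec ℕ m) λ ys → xs ≡ c ∷ d ∷ ys × (o * c + suc o * d + wt (2 + o) ys ≡ n × Good (r ∸ d) ys))
                                        (shift (o * c + suc o * d) (cnt m (2 + o) (r ∸ d)) n)
  size-prepend₂ m o c d n = size-map (λ ys → c ∷ d ∷ ys) (λ { refl → refl }) (size-shift (cnt-size m (2 + o) (r ∸ d)) (o * c + suc o * d) n)

  cnt-size zero o i n = size-⇔ (λ { [] → mk⇔ (λ p → p) (λ p → p) }) (δ-size n)
  cnt-size (suc zero) o zero n = size-empty (λ { (c ∷ []) (_ , _ , ()) })
  cnt-size (suc zero) o (suc zero) n = size-⇔
    (λ { (c ∷ []) → mk⇔ (λ { ([] , refl , eq , _) → eq , z≤n , s≤s z≤n })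
                        (λ { (eq , _ , s≤s z≤n) → [] , refl , eq , tt }) })
    (size-≡ (cong (λ a → shift a δ n) (*-zeroʳ o)) (size-prepend₁ 0 o n))
  cnt-size (suc zero) o (suc (suc i)) n = size-⇔
    (λ { (c ∷ []) → mk⇔ (λ { (inj₁ ([] , refl , eq , _)) → eq , z≤n , s≤s z≤n
                           ; (inj₂ ([] , refl , eq , _)) → eq , s≤s z≤n , s≤s (s≤s z≤n) })
                        (λ { (eq , z≤n , _) → inj₁ ([] , refl , eq , tt)
                           ; (eq , s≤s z≤n , _) → inj₂ ([] , refl , eq , tt) }) })
    (size-⊎ (λ { _ (_ , refl , _) (_ , () , _) })
      (size-≡ (cong (λ a → shift a δ n) (*-zeroʳ o)) (size-prepend₁ 0 o n))
      (size-≡ (cong (λ a → shift a δ n) (*-identityʳ o)) (size-prepend₁ 1 o n)))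
  cnt-size (suc (suc m)) o zero n = size-empty (λ { (c ∷ d ∷ ys) (_ , _ , () , _) })
  cnt-size (suc (suc m)) o (suc zero) n = size-⇔
    (λ { (c ∷ d ∷ ys) → mk⇔ (λ { (ys , refl , eq , good) → trans (sym (+-assoc (o * 0) _ _)) eq , z≤n , s≤s z≤n , good })
                            (λ { (eq , z≤n , s≤s z≤n , good) → ys , refl , trans (+-assoc (o * 0) _ _) eq , good }) })
    (size-≡ (cong (λ a → shift a (cnt m (2 + o) r) n) (cong₂ _+_ (*-zeroʳ o) (*-zeroʳ (suc o)))) (size-prepend₂ m o 0 0 n))
  cnt-size (suc (suc m)) o (suc (suc i)) n = size-⇔ split
    (size-⊎ disjoint (cnt-size (suc (suc m)) o (suc i) n)
      (size-⊎ (λ { _ (_ , refl , _) (_ , () , _) })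
        (size-≡ (cong (λ a → shift a (cnt m (2 + o) (r ∸ suc i)) n) (cong (_+ suc o * suc i) (*-zeroʳ o))) (size-prepend₂ m o 0 (suc i) n))
        (size-≡ (cong (λ a → shift a (cnt m (2 + o) (r ∸ i)) n) (cong (_+ suc o * i) (*-identityʳ o))) (size-prepend₂ m o 1 i n))))
    where
    Part : ℕ → ℕ → Vec ℕ (suc (suc m)) → Set
    Part c d xs = ∃ λ ys → xs ≡ c ∷ d ∷ ys × (o * c + suc o * d + wt (2 + o) ys ≡ n × Good (r ∸ d) ys)
    disjoint : ∀ xs → Counted (suc (suc m)) o (suc i) n xs → Part 0 (suc i) xs ⊎ Part 1 i xs → ⊥
    disjoint _ (_ , _ , lt , _) (inj₁ (ys , refl , _)) = <-irrefl refl lt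
    disjoint _ (_ , _ , lt , _) (inj₂ (ys , refl , _)) = <-irrefl refl lt
    split : ∀ xs → (Counted (suc (suc m)) o (suc i) n xs ⊎ (Part 0 (suc i) xs ⊎ Part 1 i xs)) ⇔ Counted (suc (suc m)) o (suc (suc i)) n xs
    split (c ∷ d ∷ ys) = mk⇔ merge unmerge
      where
      merge : _ → _
      merge (inj₁ (eq , c≤1 , lt , good)) = eq , c≤1 , m≤n⇒m≤1+n lt , good
      merge (inj₂ (inj₁ (_ , refl , eq , good))) = trans (sym (+-assoc (o * 0) _ _)) eq , z≤n , ≤-refl , good
      merge (inj₂ (inj₂ (_ , refl , eq , good))) = trans (sym (+-assoc (o * 1) _ _)) eq , s≤s z≤n , ≤-refl , good
      unmerge : Counted (suc (suc m)) o (suc (suc i)) n (c ∷ d ∷ ys) → _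
      unmerge (eq , c≤1 , s≤s le , good) with m≤n⇒m<n∨m≡n le
      ... | inj₁ lt = inj₁ (eq , c≤1 , lt , good)
      unmerge (eq , z≤n , s≤s le , good) | inj₂ refl = inj₂ (inj₁ (ys , refl , trans (+-assoc (o * 0) _ _) eq , good))
      unmerge (eq , s≤s z≤n , s≤s le , good) | inj₂ refl = inj₂ (inj₂ (ys , refl , trans (+-assoc (o * 1) _ _) eq , good))

  module _ (1≤r : 1 ≤ r) where

    cnt-small : ∀ m o i n → 1 ≤ i → n < o → cnt m o i n ≡ δ n
    cnt-small zero o i n _ n<o = refl
    cnt-small (suc zero) o (suc zero) n _ n<o = refl
    cnt-small (suc zero) o (suc (suc i)) n _ n<o = trans (cong (λ x → δ n + x) (shift-below o δ n<o)) (+-identityʳ _)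
    cnt-small (suc (suc m)) o (suc zero) n _ n<o = cnt-small m (2 + o) r n 1≤r (m≤n⇒m≤1+n (m≤n⇒m≤1+n n<o))
    cnt-small (suc (suc m)) o (suc (suc i)) n _ n<o = trans
      (cong₂ _+_ (cnt-small (suc (suc m)) o (suc i) n (s≤s z≤n) n<o)
        (cong₂ _+_ (shift-below (suc o * suc i) _ (≤-trans n<o (≤-trans (n≤1+n o) (m≤m*n (suc o) (suc i)))))
                   (shift-below (o + suc o * i) _ (≤-trans n<o (m≤m+n o _)))))
      (+-identityʳ _)

    cnt-one : ∀ m o i n → n ≤ o → 1 ≤ i → cnt 1 o i n ≡ cnt (suc (suc m)) o i n
    cnt-one m o (suc zero) n n≤o _ = sym (cnt-small m (2 + o) r n 1≤r (s≤s (m≤n⇒m≤1+n n≤o)))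
    cnt-one m o (suc (suc zero)) n n≤o _ = begin
      δ n + shift o δ n
        ≡⟨ cong₂ _+_ (cnt-one m o 1 n n≤o (s≤s z≤n)) (shift-cong o n (λ j j≤n → sym (cnt-small m (2 + o) r j 1≤r (s≤s (m≤n⇒m≤1+n (≤-trans j≤n n≤o)))))) ⟩
      cnt m (2 + o) r n + shift o (cnt m (2 + o) r) n
        ≡⟨ cong (λ x → cnt m (2 + o) r n + x) (cong₂ _+_ (shift-below (suc o * 1) (cnt m (2 + o) (r ∸ 1)) (≤-trans (s≤s n≤o) (m≤m*n (suc o) 1)))
             (cong (λ a → shift a (cnt m (2 + o) r) n) (trans (cong (λ x → o + x) (*-zeroʳ (suc o))) (+-identityʳ o)))) ⟨
      cnt (suc (suc m)) o 2 n ∎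
      where open ≡-Reasoning
    cnt-one m o (suc (suc (suc i))) n n≤o _ = trans (cnt-one m o (suc (suc i)) n n≤o (s≤s z≤n)) (sym (trans
      (cong (λ x → cnt (suc (suc m)) o (suc (suc i)) n + x) (cong₂ _+_
        (shift-below (suc o * suc (suc i)) _ (≤-trans (s≤s n≤o) (m≤m*n (suc o) (suc (suc i)))))
        (shift-below (o + suc o * suc i) _ (≤-trans (≤-trans (s≤s n≤o) (m≤m*n (suc o) (suc i))) (m≤n+m _ o)))))
      (+-identityʳ _)))

    -- The length of the vector is immaterial once all variables of index at most n are present,
    -- since larger ones cannot occur in weight n. This reconciles the lengths produced by peeling
    -- off pairs with the length n of the monomials of weight n.
    cnt-stable : ∀ m m′ o i n → 1 ≤ i → i ≤ r → n < o + m → n < o + m′ → cnt m o i n ≡ cnt m′ o i n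
    cnt-stable zero m′ o i n 1≤i i≤r lt lt′ = sym (cnt-small m′ o i n 1≤i (subst (n <_) (+-identityʳ o) lt))
    cnt-stable (suc m) zero o i n 1≤i i≤r lt lt′ = cnt-small (suc m) o i n 1≤i (subst (n <_) (+-identityʳ o) lt′)
    cnt-stable (suc zero) (suc zero) o i n 1≤i i≤r lt lt′ = refl
    cnt-stable (suc zero) (suc (suc m′)) o i n 1≤i i≤r lt lt′ = cnt-one m′ o i n (≤-pred (subst (n <_) (+-comm o 1) lt)) 1≤i
    cnt-stable (suc (suc m)) (suc zero) o i n 1≤i i≤r lt lt′ = sym (cnt-one m o i n (≤-pred (subst (n <_) (+-comm o 1) lt′)) 1≤i)
    cnt-stable (suc (suc m)) (suc (suc m′)) o i n 1≤i i≤r lt lt′ = go i 1≤i i≤r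
      where
      move : ∀ m → n < o + suc (suc m) → ∀ j → j ≤ n → j < suc (suc o) + m
      move m lt j j≤n = ≤-trans (s≤s j≤n) (≤-trans lt (≤-reflexive (trans (+-suc o (suc m)) (cong suc (+-suc o m)))))
      inner : ∀ i → 1 ≤ i → i ≤ r → ∀ j → j ≤ n → cnt m (2 + o) i j ≡ cnt m′ (2 + o) i j
      inner i 1≤i i≤r j j≤n = cnt-stable m m′ (2 + o) i j 1≤i i≤r (move m lt j j≤n) (move m′ lt′ j j≤n)
      go : ∀ i → 1 ≤ i → i ≤ r → cnt (suc (suc m)) o i n ≡ cnt (suc (suc m′)) o i n
      go (suc zero) _ _ = inner r 1≤r ≤-refl n ≤-refl
      go (suc (suc i)) _ i≤r = cong₂ _+_ (go (suc i) (s≤s z≤n) (<⇒≤ i≤r)) (cong₂ _+_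
        (shift-cong (suc o * suc i) n (inner (r ∸ suc i) (m<n⇒0<n∸m i≤r) (m∸n≤m r (suc i))))
        (shift-cong (o + suc o * i) n (inner (r ∸ i) (m<n⇒0<n∸m (<⇒≤ i≤r)) (m∸n≤m r i))))

  ZGood : ∀ {m} → ℕ → ℕ → Vec ℕ m → Set
  ZGood zero    i xs       = Good i xs
  ZGood (suc p) i []       = ⊤
  ZGood (suc p) i (x ∷ xs) = x ≡ 0 × ZGood p i xs

  zgood-size : ∀ p m o i n → HasSize {Vec ℕ m} (λ xs → wt o xs ≡ n × ZGood p i xs) (cnt (m ∸ p) (o + p) i n)
  zgood-size zero m o i n = size-≡ (cong (λ o′ → cnt m o′ i n) (sym (+-identityʳ o))) (cnt-size m o i n)
  zgood-size (suc p) zero o i n = size-⇔ (λ { [] → mk⇔ (λ p → p) (λ p → p) }) (δ-size n)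
  zgood-size (suc p) (suc m) o i n = size-≡ (cong (λ o′ → cnt (m ∸ p) o′ i n) (sym (+-suc o p)))
    (size-⇔ (λ { (x ∷ xs) → mk⇔ (λ { (_ , refl , eq , good) → trans (cong (_+ wt (suc o) xs) (*-zeroʳ o)) eq , refl , good })
                                (λ { (eq , refl , good) → xs , refl , trans (cong (_+ wt (suc o) xs) (sym (*-zeroʳ o))) eq , good }) })
      (size-map (0 ∷_) (λ { refl → refl }) (zgood-size p m (suc o) i n)))

-- Standard monomials as solutions of inequalities.

module Ideals (r : ℕ) (2≤r : 2 ≤ r) where

  open ≡ using (refl; sym; trans; cong; cong₂; subst; subst₂)
  open import Data.Nat using (_+_; _*_)
  open ℕₚ
  open Counting r
  open Equivalence

  module _ (F : ℕ → ℕ) where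

    private
      O V : ℕ → ℕ
      O a = F (2 * a + 1)
      V a = F (2 * a + 2)

    -- F v is the exponent of x_v.
    Admissible : ℕ → ℕ → Set
    Admissible J i = (∀ a → J ≤ a → O a ≤ 1) × O J + V J < i × (∀ a → J ≤ a → V a + (O (suc a) + V (suc a)) < r)

    -- All v are included, also those beyond the end of the vector, where `expo` is 0; so F is
    -- determined from x_{2J+1} on.
    Reads : ∀ {m} → ℕ → Vec ℕ m → Set
    Reads J xs = ∀ v → expo xs (suc v) ≡ F (suc (2 * J + v))

    private
      2J+0 : ∀ J → suc (2 * J + 0) ≡ 2 * J + 1
      2J+0 J = trans (cong suc (+-identityʳ _)) (+-comm 1 (2 * J))

      2J+1 : ∀ J → suc (2 * J + 1) ≡ 2 * J + 2
      2J+1 J = sym (+-suc (2 * J) 1)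

      reads-O : ∀ {m} J (xs : Vec ℕ m) → Reads J xs → O J ≡ expo xs 1
      reads-O J xs reads = trans (cong F (sym (2J+0 J))) (sym (reads 0))

      reads-V : ∀ {m} J (xs : Vec ℕ m) → Reads J xs → V J ≡ expo xs 2
      reads-V J xs reads = trans (cong F (sym (2J+1 J))) (sym (reads 1))

      reads-suc : ∀ {m} J c d (xs : Vec ℕ m) → Reads J (c ∷ d ∷ xs) → Reads (suc J) xs
      reads-suc J c d xs reads v = trans (reads (2 + v)) (cong F (ident J v))
        where
        ident : ∀ J v → 1 + (2 * J + (2 + v)) ≡ 1 + (2 * (1 + J) + v)
        ident = solve-∀

      reads-pad : ∀ J c → Reads J (c ∷ []) → Reads J (c ∷ 0 ∷ [])
      reads-pad J c reads zero          = reads zero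
      reads-pad J c reads (suc zero)    = reads 1
      reads-pad J c reads (suc (suc v)) = reads (suc (suc v))

      reads-[] : ∀ J → Reads J [] → ∀ a → J ≤ a → O a ≡ 0 × V a ≡ 0
      reads-[] J reads a J≤a with a ∸ J | m+[n∸m]≡n J≤a
      ... | d | refl = trans (cong F (e₁ J d)) (sym (reads (2 * d))) , trans (cong F (e₂ J d)) (sym (reads (2 * d + 1)))
        where
        e₁ : ∀ J d → 2 * (J + d) + 1 ≡ 1 + (2 * J + 2 * d)
        e₁ = solve-∀
        e₂ : ∀ J d → 2 * (J + d) + 2 ≡ 1 + (2 * J + (2 * d + 1))
        e₂ = solve-∀

    -- The triple inequality at J, read as an upper bound for the next pair, is the first-pair
    -- condition of level J+1. This matches the recursion of `Good`.
    admissible-unfold : ∀ J i → Admissible J i ⇔ (O J ≤ 1 × O J + V J < i × Admissible (suc J) (r ∸ V J))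
    admissible-unfold J i = mk⇔
      (λ { (odd , first , triples) → odd J ≤-refl , first ,
           (λ a J<a → odd a (<⇒≤ J<a)) , m+n≤o⇒m≤o∸n _ (subst (_≤ r) (cong suc (+-comm (V J) _)) (triples J ≤-refl)) , (λ a J<a → triples a (<⇒≤ J<a)) })
      (λ { (O≤1 , first , odd , next , triples) →
           (λ a J≤a → [ odd a , (λ { refl → O≤1 }) ] (m≤n⇒m<n∨m≡n J≤a)) , first ,
           (λ a J≤a → [ triples a , (λ { refl → subst (_< r) (+-comm (O (suc J) + V (suc J)) (V J)) (m<n∸o⇒m+o<n next) }) ] (m≤n⇒m<n∨m≡n J≤a)) })
      where
      m<n∸o⇒m+o<n : ∀ {m o} → m < r ∸ o → m + o < r
      m<n∸o⇒m+o<n {m} {o} lt = subst (m + o <_) (m∸n+n≡m (<⇒≤ (m<n∸m⇒ lt))) (+-monoˡ-< o lt)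
        where
        m<n∸m⇒ : m < r ∸ o → o < r
        m<n∸m⇒ lt with <-≤-connex o r
        ... | inj₁ o<r = o<r
        ... | inj₂ r≤o = ⊥-elim (n≮0 (subst (m <_) (m≤n⇒m∸n≡0 r≤o) lt))

    private
      good-[] : ∀ J i → 1 ≤ i → Reads J [] → Good i [] ⇔ Admissible J i
      good-[] J i 1≤i reads = mk⇔ (λ _ →
        (λ a J≤a → ≤-trans (≤-reflexive (proj₁ (zeros a J≤a))) z≤n) ,
        subst (_< i) (sym (cong₂ _+_ (proj₁ (zeros J ≤-refl)) (proj₂ (zeros J ≤-refl)))) 1≤i ,
        (λ a J≤a → let O≡0 , V≡0 = zeros (suc a) (m≤n⇒m≤1+n J≤a) in
          subst (_< r) (sym (cong₂ _+_ (proj₂ (zeros a J≤a)) (cong₂ _+_ O≡0 V≡0))) (<⇒≤ 2≤r)))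
        (λ _ → tt)
        where zeros = reads-[] J reads

      good-∷∷ : ∀ {m} c d (xs : Vec ℕ m) J i → O J ≡ c → V J ≡ d →
        (c + d < i → Good (r ∸ d) xs ⇔ Admissible (suc J) (r ∸ d)) → Good i (c ∷ d ∷ xs) ⇔ Admissible J i
      good-∷∷ c d xs J i refl refl tails = mk⇔
        (λ { (c≤1 , lt , good) → from (admissible-unfold J i) (c≤1 , lt , to (tails lt) good) })
        (λ adm → let c≤1 , lt , next = to (admissible-unfold J i) adm in c≤1 , lt , from (tails lt) next)

      r∸d>0 : ∀ c d {i} → i ≤ r → c + d < i → 1 ≤ r ∸ d
      r∸d>0 c d i≤r lt = m<n⇒0<n∸m (<-≤-trans (≤-<-trans (m≤n+m d c) lt) i≤r)

    good⇔admissible : ∀ {m} (xs : Vec ℕ m) J i → 1 ≤ i → i ≤ r → Reads J xs → Good i xs ⇔ Admissible J i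
    good⇔admissible [] J i 1≤i i≤r reads = good-[] J i 1≤i reads
    good⇔admissible (c ∷ []) J i 1≤i i≤r reads = mk⇔
      (λ { (c≤1 , c<i) → to padded (c≤1 , subst (_< i) (sym (+-identityʳ c)) c<i , tt) })
      (λ adm → let c≤1 , lt , _ = from padded adm in c≤1 , subst (_< i) (+-identityʳ c) lt)
      where
      -- A last odd-indexed variable without partner is completed by the exponent 0.
      reads′ = reads-pad J c reads
      padded = good-∷∷ c 0 [] J i (reads-O J (c ∷ 0 ∷ []) reads′) (reads-V J (c ∷ 0 ∷ []) reads′)
        (λ lt → good-[] (suc J) r (r∸d>0 c 0 i≤r lt) (reads-suc J c 0 [] reads′))
    good⇔admissible (c ∷ d ∷ xs) J i 1≤i i≤r reads = good-∷∷ c d xs J i (reads-O J (c ∷ d ∷ xs) reads) (reads-V J (c ∷ d ∷ xs) reads)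
      (λ lt → good⇔admissible xs (suc J) (r ∸ d) (r∸d>0 c d i≤r lt) (m∸n≤m r d) (reads-suc J c d xs reads))

  expo-0 : ∀ {m} (xs : Vec ℕ m) → expo xs 0 ≡ 0
  expo-0 []       = refl
  expo-0 (x ∷ xs) = refl

  zgood⇔ : ∀ {m} p i (xs : Vec ℕ m) → ∃ λ m′ → Σ (Vec ℕ m′) λ ys →
    (∀ v → expo ys (suc v) ≡ expo xs (suc (p + v))) ×
    (ZGood p i xs ⇔ (InS (suc p) xs × Good i ys))
  zgood⇔ zero i xs = _ , xs , (λ v → refl) , mk⇔ (λ good → (λ { zero _ → expo-0 xs ; (suc v) (s≤s ()) }) , good) proj₂
  zgood⇔ (suc p) i [] = 0 , [] , (λ v → refl) , mk⇔ (λ _ → (λ v _ → refl) , tt) (λ _ → tt)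
  zgood⇔ (suc p) i (x ∷ xs) with zgood⇔ p i xs
  ... | m′ , ys , reads , equiv = m′ , ys , reads , mk⇔
    (λ { (refl , zgood) → let ins , good = to equiv zgood in
         (λ { zero _ → refl ; (suc zero) _ → refl ; (suc (suc v)) (s≤s lt) → ins (suc v) lt }) , good })
    (λ { (ins , good) → ins 1 (s≤s (s≤s z≤n)) ,
         from equiv ((λ { zero _ → expo-0 xs ; (suc v) lt → ins (suc (suc v)) (s≤s lt) }) , good) })

  module _ {n} (e : Vec ℕ n) where

    private
      O V : ℕ → ℕ
      O a = expo e (2 * a + 1)
      V a = expo e (2 * a + 2)

      at : ∀ {x y} → x ≡ y → expo e x ≡ expo e y
      at = cong (expo e)

      even : ∀ a → 2 * suc a ≡ 2 * a + 2
      even a = trans (*-suc 2 a) (+-comm 2 (2 * a))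

      p₁ : ∀ J → 2 * J + 1 + 1 ≡ 2 * J + 2
      p₁ J = +-assoc (2 * J) 1 1

      p₂ : ∀ J → 2 * J + 1 + 1 + 1 ≡ 2 * (1 + J) + 1
      p₂ = solve-∀

      p₃ : ∀ J → 2 * J + 1 + 1 + 2 ≡ 2 * (1 + J) + 2
      p₃ = solve-∀

      odd-≤ : ∀ {a b} → 2 * a + 1 ≤ 2 * b + 1 → a ≤ b
      odd-≤ {a} {b} le = *-cancelˡ-≤ 2 (+-cancelʳ-≤ 1 (2 * a) (2 * b) le)

      odd-≤⁻ : ∀ {J b} → suc J ≤ b → 2 * J + 1 + 1 + 1 ≤ 2 * b + 1
      odd-≤⁻ {J} {b} le = subst (_≤ 2 * b + 1) (sym (p₂ J)) (+-monoˡ-≤ 1 (*-monoʳ-≤ 2 le))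

      -- The even generators of L_{2J+3} start at x_{2J+4}. The triples beginning at x_{2J+2} are
      -- governed by the extra generators of L^ℓ instead, hence the division into J < a and J = a
      -- below.
      even-≤ : ∀ {J c} → 2 * J + 1 + 1 + 1 ≤ 2 * c → suc (suc J) ≤ c
      even-≤ {J} {c} le = *-cancelˡ-< 2 (suc J) c (subst (_≤ 2 * c) (trans (p₂ J) (+-comm (2 * suc J) 1)) le)

      even-≤⁻ : ∀ {J c} → suc (suc J) ≤ c → 2 * J + 1 + 1 + 1 ≤ 2 * c
      even-≤⁻ {J} {c} le = subst (_≤ 2 * c) (trans (+-comm 1 (2 * suc J)) (sym (p₂ J))) (*-monoʳ-< 2 le)

      ∸-sum : ∀ {x y u v} → x ∸ y ≤ u → y ≤ v → x ≤ u + v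
      ∸-sum {x} {y} {u} {v} le y≤v = ≤-trans (≤-trans (m≤n+m∸n x y) (+-monoʳ-≤ y le)) (subst (_≤ u + v) (+-comm u y) (+-monoʳ-≤ u y≤v))

    admissible⇒standard : ∀ J i → i ≤ r → Admissible (expo e) J i → ¬ InLodd r (2 * J + 1) i e
    admissible⇒standard J i i≤r (odd , first , triples) = refute
      where
      pair : ∀ a → suc J ≤ a → O a + V a < r
      pair (suc a) (s≤s J≤a) = ≤-<-trans (m≤n+m _ (V a)) (triples a J≤a)
      refuteL : InL r (2 * J + 1 + 1 + 1) e → ⊥
      refuteL (inj₁ (a , le , two)) = <⇒≱ two (odd a (<⇒≤ (odd-≤ (subst (_≤ 2 * a + 1) (p₂ J) le))))
      refuteL (inj₂ (inj₁ (b , le , one , many))) = <⇒≱ (pair b (odd-≤ (subst (_≤ 2 * b + 1) (p₂ J) le)))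
        (≤-trans (m≤n+m∸n r 1) (+-mono-≤ one many))
      refuteL (inj₂ (inj₂ (inj₁ (c , le , n₁ , _ , x , y)))) with even-≤ {J} {c} le
      ... | s≤s {n = a} J<a = <⇒≱ (triples a (<⇒≤ J<a)) (≤-trans (∸-sum (subst (r ∸ n₁ ≤_) (at (even a)) x) y) (+-monoʳ-≤ (V a) (m≤n+m _ (O (suc a)))))
      refuteL (inj₂ (inj₂ (inj₂ (c , le , n₂ , _ , x , one , y)))) with even-≤ {J} {c} le
      ... | s≤s {n = a} J<a = <⇒≱ (triples a (<⇒≤ J<a)) (∸-sum {y = 1 + n₂}
              (subst (_≤ V a) (trans (∸-+-assoc r n₂ 1) (cong (r ∸_) (+-comm n₂ 1))) (subst (r ∸ n₂ ∸ 1 ≤_) (at (even a)) x)) (+-mono-≤ one y))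
      -- The mixed generators of L^i have total degree r like those of L, so `∸-sum` treats both
      -- kinds alike.
      r∸[r∸i+t] : ∀ t → r ∸ (r ∸ i + t) ≡ i ∸ t
      r∸[r∸i+t] t = trans (sym (∸-+-assoc r (r ∸ i) t)) (cong (_∸ t) (m∸[m∸n]≡n i≤r))
      refute : InLodd r (2 * J + 1) i e → ⊥
      refute (inj₁ two) = <⇒≱ two (odd J ≤-refl)
      refute (inj₂ (inj₁ (one , many))) = <⇒≱ first (≤-trans (m≤n+m∸n i 1) (+-mono-≤ one (subst (i ∸ 1 ≤_) (at (p₁ J)) many)))
      refute (inj₂ (inj₂ (inj₁ many))) = <⇒≱ first (≤-trans (subst (i ≤_) (at (p₁ J)) many) (m≤n+m _ (O J)))
      refute (inj₂ (inj₂ (inj₂ (inj₁ (t , _ , t<i , x , y))))) = <⇒≱ (triples J ≤-refl) (≤-trans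
        (∸-sum {r} {r ∸ i + t} (subst₂ _≤_ (sym (r∸[r∸i+t] t)) (at (p₁ J)) x) (subst (r ∸ i + t ≤_) (at (p₃ J)) y))
        (+-monoʳ-≤ (V J) (m≤n+m _ (O (suc J)))))
      refute (inj₂ (inj₂ (inj₂ (inj₂ (inj₁ (t , _ , t<i , x , one , y)))))) = <⇒≱ (triples J ≤-refl)
        (∸-sum {r} {r ∸ i + t} (subst₂ _≤_ (sym (r∸[r∸i+t] t)) (at (p₁ J)) x)
          (≤-trans (m≤n+m∸n (r ∸ i + t) 1) (+-mono-≤ (subst (1 ≤_) (at (p₂ J)) one) (subst (r ∸ i + t ∸ 1 ≤_) (at (p₃ J)) y))))
      refute (inj₂ (inj₂ (inj₂ (inj₂ (inj₂ inL))))) = refuteL inL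

    -- A violated inequality yields a generator dividing the monomial. For a triple beginning with V
    -- a > 0 it is the one whose first exponent fits V a: n₁ = r - V a without the odd variable, n₂
    -- = r - V a - 1 with it, and t = i - V J when a = J; there V J < i makes t positive.
    standard⇒admissible : ∀ J i → i ≤ r → ¬ InLodd r (2 * J + 1) i e → Admissible (expo e) J i
    standard⇒admissible J i i≤r std = odd , first , (λ a J≤a → ≰⇒> (triple a J≤a))
      where
      notL : ¬ InL r (2 * J + 1 + 1 + 1) e
      notL = std ∘ inj₂ ∘ inj₂ ∘ inj₂ ∘ inj₂ ∘ inj₂
      odd : ∀ a → J ≤ a → O a ≤ 1
      odd a J≤a = ≮⇒≥ (λ two → [ (λ J<a → notL (inj₁ (a , odd-≤⁻ J<a , two))) , (λ { refl → std (inj₁ two) }) ] (m≤n⇒m<n∨m≡n J≤a))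
      first : O J + V J < i
      first with O J in eq | odd J ≤-refl
      ... | .0 | z≤n     = ≰⇒> (λ le → std (inj₂ (inj₂ (inj₁ (subst (i ≤_) (at (sym (p₁ J))) le)))))
      ... | .1 | s≤s z≤n = ≰⇒> (λ le → std (inj₂ (inj₁ (≤-reflexive (sym eq) , m≤n+o⇒m∸n≤o i 1 (subst (λ x → i ≤ 1 + x) (at (sym (p₁ J))) le)))))
      -- After a vanishing even exponent the pair condition is a generator of L itself.
      lone : ∀ a → J ≤ a → O (suc a) + V (suc a) < r
      lone a J≤a with O (suc a) in eq | odd (suc a) (m≤n⇒m≤1+n J≤a)
      ... | .0 | z≤n     = ≰⇒> (λ le → notL (inj₂ (inj₂ (inj₁ (suc (suc a) , even-≤⁻ (s≤s (s≤s J≤a)) , 0 , z≤n ,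
                                  subst (r ≤_) (at (sym (even (suc a)))) le , z≤n)))))
      ... | .1 | s≤s z≤n = ≰⇒> (λ le → notL (inj₂ (inj₁ (suc a , odd-≤⁻ (s≤s J≤a) , ≤-reflexive (sym eq) , m≤n+o⇒m∸n≤o r 1 le))))
      V<i : ∀ {d} → V J ≡ d → d < i
      V<i eq = ≤-<-trans (≤-trans (≤-reflexive (sym eq)) (m≤n+m (V J) (O J))) first
      shift : ∀ {d} → d < i → r ∸ i + (i ∸ d) ≡ r ∸ d
      shift {d} d<i = trans (sym (+-∸-assoc (r ∸ i) (<⇒≤ d<i))) (cong (_∸ d) (m∸n+n≡m i≤r))
      triple : ∀ a → J ≤ a → ¬ (r ≤ V a + (O (suc a) + V (suc a)))
      triple a J≤a le with V a in eqV
      -- Here r - V a would be r, outside the permitted range n₁ ≤ r - 1.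
      triple a J≤a le | zero = <⇒≱ (lone a J≤a) le
      triple a J≤a le | suc d with O (suc a) in eqO | odd (suc a) (m≤n⇒m≤1+n J≤a) | m≤n⇒m<n∨m≡n J≤a
      ... | .0 | z≤n | inj₁ J<a = notL (inj₂ (inj₂ (inj₁ (suc a , even-≤⁻ (s≤s J<a) , r ∸ suc d , ∸-monoʳ-≤ r (s≤s z≤n) ,
              ≤-trans (m∸[m∸n]≤n r (suc d)) (≤-reflexive (sym (trans (at (even a)) eqV))) , m≤n+o⇒m∸n≤o r (suc d) le))))
        where
        m∸[m∸n]≤n : ∀ m n → m ∸ (m ∸ n) ≤ n
        m∸[m∸n]≤n m n = m≤n+o⇒m∸n≤o m (m ∸ n) (subst (m ≤_) (+-comm n (m ∸ n)) (m≤n+m∸n m n))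
      ... | .1 | s≤s z≤n | inj₁ J<a = notL (inj₂ (inj₂ (inj₂ (suc a , even-≤⁻ (s≤s J<a) , r ∸ suc (suc d) , ∸-monoʳ-≤ r (s≤s (s≤s z≤n)) ,
              ≤-trans small (≤-reflexive (sym (trans (at (even a)) eqV))) , ≤-reflexive (sym eqO) ,
              m≤n+o⇒m∸n≤o r (suc (suc d)) (subst (r ≤_) (+-suc (suc d) _) le)))))
        where
        small : r ∸ (r ∸ suc (suc d)) ∸ 1 ≤ suc d
        small = m≤n+o⇒m∸n≤o (r ∸ (r ∸ suc (suc d))) 1 (m≤n+o⇒m∸n≤o r (r ∸ suc (suc d)) (subst (r ≤_) (+-comm (suc (suc d)) _) (m≤n+m∸n r (suc (suc d)))))
      ... | .0 | z≤n | inj₂ refl = std (inj₂ (inj₂ (inj₂ (inj₁ (i ∸ suc d , m<n⇒0<n∸m d<i , ∸-monoʳ-≤ i (s≤s z≤n) ,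
              ≤-reflexive (trans (m∸[m∸n]≡n (<⇒≤ d<i)) (sym (trans (at (p₁ a)) eqV))) ,
              subst₂ _≤_ (sym (shift d<i)) (at (sym (p₃ a))) (m≤n+o⇒m∸n≤o r (suc d) le))))))
        where d<i = V<i eqV
      ... | .1 | s≤s z≤n | inj₂ refl = std (inj₂ (inj₂ (inj₂ (inj₂ (inj₁ (i ∸ suc d , m<n⇒0<n∸m d<i , ∸-monoʳ-≤ i (s≤s z≤n) ,
              ≤-reflexive (trans (m∸[m∸n]≡n (<⇒≤ d<i)) (sym (trans (at (p₁ a)) eqV))) ,
              ≤-reflexive (sym (trans (at (p₂ a)) eqO)) ,
              subst₂ _≤_ (cong (_∸ 1) (sym (shift d<i))) (at (sym (p₃ a))) (m≤n+o⇒m∸n≤o (r ∸ suc d) 1 (m≤n+o⇒m∸n≤o r (suc d) le))))))))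
        where d<i = V<i eqV

  std-size : ∀ J i n → 1 ≤ i → i ≤ r → HPoddCoeff r (2 * J + 1) i n (cnt (n ∸ 2 * J) (1 + 2 * J) i n)
  std-size J i n 1≤i i≤r = Sizes.size-⇔ equiv (zgood-size (2 * J) n 1 i n)
    where
    equiv : ∀ e → (weight e ≡ n × ZGood (2 * J) i e) ⇔ StdOdd r (2 * J + 1) i n e
    equiv e with zgood⇔ (2 * J) i e
    ... | _ , ys , reads , zg = mk⇔
      (λ { (wt≡n , zgood) → let ins , good = to zg zgood in
           wt≡n , subst (λ k → InS k e) (+-comm 1 (2 * J)) ins , admissible⇒standard e J i i≤r (to ga good) })
      (λ { (wt≡n , ins , std) → wt≡n , from zg (subst (λ k → InS k e) (+-comm (2 * J) 1) ins , from ga (standard⇒admissible e J i i≤r std)) })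
      where ga = good⇔admissible (expo e) ys J i 1≤i i≤r reads

-- The recursion for the Hilbert series.

module Coefficients where

  open ≡ using (sym; trans; cong; cong₂; module ≡-Reasoning)
  open import Data.Nat using (_+_; _*_)
  open ℕₚ
  open Shifts
  open Exponents
  open ≡-Reasoning

  -- The coefficient of qⁿ in HP^{2J+1}_i.
  hp : ℕ → ℕ → ℕ → ℕ → ℕ
  hp r J i n = Counting.cnt r n (1 + 2 * J) i n

  E : ℕ → ℕ → ℕ → ℕ → ℕ
  E J k b = hp (suc (k + b)) J (suc k)

  hp-stable : ∀ r J i m n → 1 ≤ i → i ≤ r → n < 1 + 2 * J + m → Counting.cnt r m (1 + 2 * J) i n ≡ hp r J i n
  hp-stable r J i m n 1≤i i≤r lt = Counting.cnt-stable r (≤-trans 1≤i i≤r) m n (1 + 2 * J) i n 1≤i i≤r lt (s≤s (m≤n+m n (2 * J)))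

  private
    2+o : ∀ J → 2 + (1 + 2 * J) ≡ 1 + 2 * (1 + J)
    2+o = solve-∀

    longer : ∀ J n → n < 1 + 2 * J + (2 + n)
    longer J n = s≤s (≤-trans (m≤n+m n 2) (m≤n+m (2 + n) (2 * J)))

    hp-next : ∀ r J i m n → 1 ≤ i → i ≤ r → n ≤ m → Counting.cnt r m (2 + (1 + 2 * J)) i n ≡ hp r (suc J) i n
    hp-next r J i m n 1≤i i≤r n≤m = trans (cong (λ o → Counting.cnt r m o i n) (2+o J))
      (hp-stable r (suc J) i m n 1≤i i≤r (s≤s (≤-trans n≤m (m≤n+m m (2 * suc J)))))

  E-first : ∀ J b n → E J 0 b n ≡ E (suc J) b 0 n
  E-first J b n = begin
    hp (suc b) J 1 n                                    ≡⟨ hp-stable (suc b) J 1 (2 + n) n (s≤s z≤n) (s≤s z≤n) (longer J n) ⟨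
    Counting.cnt (suc b) n (2 + (1 + 2 * J)) (suc b) n  ≡⟨ hp-next (suc b) J (suc b) n n (s≤s z≤n) ≤-refl ≤-refl ⟩
    hp (suc b) (suc J) (suc b) n                        ≡⟨ cong (λ x → hp (suc x) (suc J) (suc b) n) (+-identityʳ b) ⟨
    hp (suc (b + 0)) (suc J) (suc b) n                  ∎

  -- With r = k + b + 2, the exponents k + 1 and k of x_{2J+2} leave the bounds b + 1 and b + 2 for
  -- the next pair; thus k and b exchange roles at level J+1.
  E-next : ∀ J k b n → E J (suc k) b n
    ≡ E J k (suc b) n + (shift (hi J k) (E (suc J) b (suc k)) n + shift (lo J k) (E (suc J) (suc b) k) n)
  E-next J k b n = begin
    hp r J (2 + k) n
      ≡⟨ hp-stable r J (2 + k) (2 + n) n (s≤s z≤n) (s≤s (s≤s (m≤m+n k b))) (longer J n) ⟨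
    Counting.cnt r (2 + n) o (1 + k) n + (shift (suc o * suc k) (Counting.cnt r n (2 + o) (r ∸ suc k)) n + shift (o + suc o * k) (Counting.cnt r n (2 + o) (r ∸ k)) n)
      ≡⟨ cong₂ _+_ (hp-stable r J (1 + k) (2 + n) n (s≤s z≤n) (s≤s (m≤n⇒m≤1+n (m≤m+n k b))) (longer J n))
           (cong₂ _+_ (trans (cong₂ (λ a i → shift a (Counting.cnt r n (2 + o) i) n) (hi≡ J k) r∸suc-k)
                         (shift-cong (hi J k) n (λ j j≤n → hp-next r J (suc b) n j (s≤s z≤n) (s≤s (m≤n⇒m≤1+n (m≤n+m b k))) j≤n)))
                      (trans (cong₂ (λ a i → shift a (Counting.cnt r n (2 + o) i) n) (lo≡ J k) r∸k)
                         (shift-cong (lo J k) n (λ j j≤n → hp-next r J (2 + b) n j (s≤s z≤n) (s≤s (s≤s (m≤n+m b k))) j≤n)))) ⟩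
    hp r J (1 + k) n + (shift (hi J k) (hp r (suc J) (suc b)) n + shift (lo J k) (hp r (suc J) (2 + b)) n)
      ≡⟨ cong₂ _+_ (cong (λ x → hp (suc x) J (suc k) n) (+-suc k b))
           (cong₂ _+_ (cong (λ x → shift (hi J k) (hp (suc x) (suc J) (suc b)) n) (+-comm b (suc k)))
                      (cong (λ x → shift (lo J k) (hp (suc (suc x)) (suc J) (2 + b)) n) (+-comm b k))) ⟨
    E J k (suc b) n + (shift (hi J k) (E (suc J) b (suc k)) n + shift (lo J k) (E (suc J) (suc b) k) n) ∎
    where
    r = suc (suc k + b)
    o = 1 + 2 * J
    hi≡ : ∀ J k → (1 + (1 + 2 * J)) * (1 + k) ≡ (2 * J + 2) * (1 + k)
    hi≡ = solve-∀
    lo≡ : ∀ J k → 1 + 2 * J + (1 + (1 + 2 * J)) * k ≡ (2 * J + 2) * k + (2 * J + 1)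
    lo≡ = solve-∀
    r∸suc-k : r ∸ suc k ≡ suc b
    r∸suc-k = trans (cong (_∸ k) (sym (+-suc k b))) (m+n∸m≡n k (suc b))
    r∸k : r ∸ k ≡ 2 + b
    r∸k = trans (cong (_∸ k) (trans (cong suc (sym (+-suc k b))) (sym (+-suc k (suc b))))) (m+n∸m≡n k (2 + b))

  E-limit : ∀ {J} k b {n} → n < J → E J k b n ≡ δ n
  E-limit {J} k b {n} n<J = Counting.cnt-small (suc (k + b)) (s≤s z≤n) n (1 + 2 * J) (suc k) n (s≤s z≤n)
    (≤-trans n<J (m≤n⇒m≤1+n (m≤m+n J _)))

-- The case J = 0, one coefficient at a time.

module ProductFormula (N : ℕ) where

  open ≡ using (refl; sym; trans; cong)
  open Shifts
  open Exponents
  open Coefficients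
  open Convolution using (X)
  open Truncated N
  open CommutativeRing commutativeRing using (1#; *-congˡ; *-congʳ; *-identityˡ; *-identityʳ; +-congˡ; +-cong)
    renaming (refl to ≈-refl; sym to ≈-sym; trans to ≈-trans; _*_ to infixl 7 _⊛_)
  open import Algebra.Properties.CommutativeSemiring.Exp (CommutativeRing.commutativeSemiring commutativeRing) using (_^_)
  open BigOperators commutativeRing
  open Nilpotents commutativeRing
  open QSeries commutativeRing X (suc N) using (K; A; A-unique)
  open Products commutativeRing X (suc N) using (select; allowed-product)

  series : (ℕ → ℕ) → PS
  series f n = + f n

  X^*series : ∀ a f → X ^ a ⊛ series f ≈ series (shift a f)
  X^*series a f = mk≈ (λ n _ → go n)
    where
    go : ∀ n → (X ^ a ⊛ series f) n ≡ + shift a f n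
    go n with ℕₚ.<-≤-connex n a
    ... | inj₁ n<a = trans (X^-below a (series f) n<a) (cong +_ (sym (shift-below a f n<a)))
    ... | inj₂ a≤n with n ℕ.∸ a | ℕₚ.m+[n∸m]≡n a≤n
    ... | n′ | refl = trans (X^-shift a (series f) n′) (cong +_ (sym (shift-+ a f n′)))

  A₀≈ : ∀ k b → A 0 k b ≈ series (E 0 k b) ⊛ K (suc N) 0
  A₀≈ k b = A-unique X^-nilpotent (λ J k b → series (E J k b))
    (λ J b → mk≈ (λ n _ → cong +_ (E-first J b n)))
    (λ J k b → ≈-trans (mk≈ (λ n _ → cong +_ (E-next J k b n)))
      (+-congˡ {series (E J k (suc b))} (≈-sym (+-cong (X^*series (hi J k) (E (suc J) b (suc k))) (X^*series (lo J k) (E (suc J) (suc b) k))))))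
    (λ k b M≤J → mk≈ (λ n n≤N → trans (cong +_ (E-limit k b (ℕₚ.≤-trans (s≤s n≤N) M≤J))) (+δ≡one n)))
    (s≤s z≤n) (suc N) 0 k b (ℕₚ.m≤m+n (suc N) 0)
    where
    +δ≡one : ∀ n → + δ n ≡ oneₚ n
    +δ≡one zero    = refl
    +δ≡one (suc n) = refl

  prodGeom-∏ : ∀ (f : ℕ → ℕ) (allowed : ℕ → Bool) n →
    prodGeom (filterᵇ allowed (map suc (applyUpTo f n))) ≈ ∏ n (λ m → select (allowed (suc (f m))) (geom (suc (f m))))
  prodGeom-∏ f allowed zero = ≈-refl
  prodGeom-∏ f allowed (suc n) = ≈-trans step (≈-sym (∏-head n _))
    where
    step : prodGeom (filterᵇ allowed (suc (f 0) Data.List.∷ map suc (applyUpTo (f ∘ suc) n)))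
         ≈ select (allowed (suc (f 0))) (geom (suc (f 0))) ⊛ ∏ n (λ m → select (allowed (suc (f (suc m)))) (geom (suc (f (suc m)))))
    step with allowed (suc (f 0))
    ... | true  = *-congˡ {geom (suc (f 0))} (prodGeom-∏ (f ∘ suc) allowed n)
    ... | false = ≈-trans (prodGeom-∏ (f ∘ suc) allowed n) (≈-sym (*-identityˡ _))

  -- Nilpotency q^{N+1} = 0 gives products of N + 1 factors, whereas `infProd` takes N of them for
  -- the coefficient of q^N; the extra factor is trivial modulo q^{N+1}.
  geom-top : ∀ b → select b (geom (suc N)) ≈ 1#
  geom-top true  = ≈-trans (≈-sym (*-identityˡ (geom (suc N)))) (≈-trans (*-congʳ {geom (suc N)} (≈-sym (1-0≈1 X^-nilpotent))) (geom-inverse N))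
  geom-top false = ≈-refl

  göllnitz-gordon-andrews : ∀ k b → infProd (allowedC (suc (k ℕ.+ b)) (suc b)) N ≡ + E 0 k b N
  göllnitz-gordon-andrews k b = coeff eq N ℕₚ.≤-refl
    where
    allowed = allowedC (suc (k ℕ.+ b)) (suc b)
    p = ∏ N (λ m → select (allowed (suc m)) (geom (suc m)))
    eq : prodGeom (filterᵇ allowed (map suc (applyUpTo (λ x → x) N))) ≈ series (E 0 k b)
    eq = ≈-trans (prodGeom-∏ (λ x → x) allowed N) (≈-trans
      (≈-trans (≈-sym (*-identityʳ p)) (*-congˡ {p} (≈-sym (geom-top (allowed (suc N))))))
      (allowed-product X^-nilpotent k b (s≤s z≤n) (A₀≈ k b) (geom ∘ suc) geom-inverse))

-- The sequence C and its Laurent coefficients.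

module Recursion where

  open ≡ using (refl; sym; trans; cong; cong₂; subst; module ≡-Reasoning)
  open import Data.Nat using (_+_; _*_; _/_; _≤ᵇ_)
  open ℕₚ
  open Shifts
  open Exponents
  open Coefficients

  series : (ℕ → ℕ) → Ser
  series f = fromPS (λ n → + f n)

  -- Valid for negative m too, because `shift a f` is zero below a. This exactness is why dividing
  -- by powers of q leaves no negative exponents in C.
  series-shift : ∀ a f m → series (shift a f) (m ℤ.+ + a) ≡ series f m
  series-shift a f (+ n) = trans (cong (λ x → + shift a f x) (+-comm n a)) (cong +_ (shift-+ a f n))
  series-shift a f -[1+ n ] with <-≤-connex n a
  ... | inj₁ n<a = trans (cong (series (shift a f)) (ℤₚ.⊖-≥ n<a)) (cong +_ (shift-below a f (≤-trans (∸-monoʳ-< {a} (s≤s z≤n) n<a) ≤-refl)))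
  ... | inj₂ a≤n = cong (series (shift a f)) (trans (ℤₚ.⊖-< (s≤s a≤n)) (cong (λ x → ℤ.- (+ x)) (+-∸-assoc 1 a≤n)))

  series-cong : ∀ {f g} → (∀ n → f n ≡ g n) → ∀ m → series f m ≡ series g m
  series-cong f≡g (+ n)    = cong +_ (f≡g n)
  series-cong f≡g -[1+ n ] = refl

  series-+ : ∀ f g m → series (λ n → f n + g n) m ≡ series f m ℤ.+ series g m
  series-+ f g (+ n)    = refl
  series-+ f g -[1+ n ] = refl

  block-base : ∀ k b m → block (suc (k + b)) 0 (suc b) m ≡ series (E 0 k b) m
  block-base k b (+ n)    = ProductFormula.göllnitz-gordon-andrews n k b
  block-base k b -[1+ n ] = refl

  Block≡series : ℕ → Set
  Block≡series J = ∀ k b m → block (suc (k + b)) J (suc b) m ≡ series (E J k b) m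

  -- The recursion of C is `E-next` solved for its `hi` term. The divisor q^{2(J+1)(b+1)} has
  -- exponent `hi J b`, which is also 1 + `lo J b`; the `lo` term is thus left divided by q, and
  -- that is what the subtracted quotient removes.
  block-step : ∀ J → Block≡series J → Block≡series (suc J)
  block-step J block≡ k zero m = begin
    block (suc (k + 0)) J (suc (k + 0)) m   ≡⟨ cong (λ x → block (suc x) J (suc x) m) (+-identityʳ k) ⟩
    block (suc k) J (suc k) m               ≡⟨ block≡ 0 k m ⟩
    series (E J 0 k) m                      ≡⟨ series-cong (E-first J k) m ⟩
    series (E (suc J) k 0) m                ∎
    where open ≡-Reasoning
  block-step J block≡ k (suc b) m = begin
    block r J (r ∸ suc (suc b) + 1) (m ℤ.+ + a) ℤ.- block r J (r ∸ suc (suc b) + 2) (m ℤ.+ + a) ℤ.- block r (suc J) (suc b) (m ℤ.+ + 1)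
      ≡⟨ cong₂ ℤ._-_ (cong₂ ℤ._-_ first second) third ⟩
    series (E J (suc b) k) (m ℤ.+ + a) ℤ.- series (E J b (suc k)) (m ℤ.+ + a) ℤ.- series (E (suc J) (suc k) b) (m ℤ.+ + 1)
      ≡⟨ cong (λ x → x ℤ.- series (E J b (suc k)) (m ℤ.+ + a) ℤ.- series (E (suc J) (suc k) b) (m ℤ.+ + 1)) expand ⟩
    series (E J b (suc k)) (m ℤ.+ + a) ℤ.+ (series (E (suc J) k (suc b)) m ℤ.+ series (E (suc J) (suc k) b) (m ℤ.+ + 1))
      ℤ.- series (E J b (suc k)) (m ℤ.+ + a) ℤ.- series (E (suc J) (suc k) b) (m ℤ.+ + 1)
      ≡⟨ cancel (series (E J b (suc k)) (m ℤ.+ + a)) _ _ ⟩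
    series (E (suc J) k (suc b)) m ∎
    where
    open ≡-Reasoning
    r = suc (k + suc b)
    a = 2 * suc J * suc b
    r∸ : r ∸ suc (suc b) ≡ k
    r∸ = m+n∸n≡m k (suc b)
    at : ∀ k′ b′ {r′} j → r′ ≡ suc (k′ + b′) → j ≡ suc b′ → ∀ m → block r′ J j m ≡ series (E J k′ b′) m
    at k′ b′ _ refl refl m = block≡ k′ b′ m
    first = at (suc b) k (r ∸ suc (suc b) + 1) (cong suc (+-comm k (suc b))) (trans (cong (_+ 1) r∸) (+-comm k 1)) (m ℤ.+ + a)
    second = at b (suc k) (r ∸ suc (suc b) + 2) (cong suc (trans (+-comm k (suc b)) (sym (+-suc b k)))) (trans (cong (_+ 2) r∸) (+-comm k 2)) (m ℤ.+ + a)
    third : block r (suc J) (suc b) (m ℤ.+ + 1) ≡ series (E (suc J) (suc k) b) (m ℤ.+ + 1)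
    third = trans (cong (λ x → block (suc x) (suc J) (suc b) (m ℤ.+ + 1)) (+-suc k b)) (block-step J block≡ (suc k) b (m ℤ.+ + 1))
    a≡hi : ∀ J b → 2 * (1 + J) * (1 + b) ≡ (2 * J + 2) * (1 + b)
    a≡hi = solve-∀
    a≡1+lo : ∀ J b → 2 * (1 + J) * (1 + b) ≡ 1 + ((2 * J + 2) * b + (2 * J + 1))
    a≡1+lo = solve-∀
    expand : series (E J (suc b) k) (m ℤ.+ + a)
      ≡ series (E J b (suc k)) (m ℤ.+ + a) ℤ.+ (series (E (suc J) k (suc b)) m ℤ.+ series (E (suc J) (suc k) b) (m ℤ.+ + 1))
    expand = trans (series-cong (E-next J b k) (m ℤ.+ + a)) (trans (series-+ _ _ (m ℤ.+ + a)) (cong (λ x → series (E J b (suc k)) (m ℤ.+ + a) ℤ.+ x)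
      (trans (series-+ _ _ (m ℤ.+ + a)) (cong₂ ℤ._+_
        (trans (cong (λ x → series (shift (hi J b) (E (suc J) k (suc b))) (m ℤ.+ + x)) (a≡hi J b)) (series-shift (hi J b) _ m))
        (trans (cong (series (shift (lo J b) (E (suc J) (suc k) b))) (trans (cong (λ x → m ℤ.+ + x) (a≡1+lo J b)) (sym (ℤₚ.+-assoc m (+ 1) (+ lo J b)))))
               (series-shift (lo J b) _ (m ℤ.+ + 1)))))))
    cancel : ∀ x y z → x ℤ.+ (y ℤ.+ z) ℤ.- x ℤ.- z ≡ y
    cancel = ℤ-solve-∀

  block≡series : ∀ J → Block≡series J
  block≡series zero    = block-base
  block≡series (suc J) = block-step J (block≡series J)

  C-small : ∀ s {N} → N ≤ 2 + s → ∀ m → C (2 + s) N m ≡ Cbase (2 + s) N m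
  C-small s {N} N≤r m with N ≤ᵇ 2 + s | ≤⇒≤ᵇ N≤r
  ... | true | _ = refl

  C-large : ∀ s j t → j ≤ s → ∀ m → C (2 + s) (2 + (j + suc t * suc s)) m ≡ block (2 + s) (suc t) (2 + j) m
  C-large s j t j≤s m with 2 + (j + suc t * suc s) ≤ᵇ 2 + s in eq
  ... | true  = ⊥-elim (<⇒≱ (s≤s (s≤s (≤-trans (m≤m+n (suc s) (t * suc s)) (m≤n+m _ j)))) (≤ᵇ⇒≤ _ (2 + s) (subst T (sym eq) _)))
  ... | false = cong₂ (λ g i → block (2 + s) g i m) quotient (trans (cong (_+ 2) remainder) (+-comm j 2))
    where
    remainder : (j + suc t * suc s) % suc s ≡ j
    remainder = trans (DM.[m+kn]%n≡m%n j (suc t) (suc s)) (DM.m<n⇒m%n≡m (s≤s j≤s))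
    quotient : (j + suc t * suc s) / suc s ≡ suc t
    quotient = trans (DM.+-distrib-/-∣ʳ j (n∣m*n (suc t))) (cong₂ _+_ (DM.m<n⇒m/n≡0 (s≤s j≤s)) (DM.m*n/n≡m (suc t) (suc s)))

  -- Consecutive blocks overlap: position 1 of a block is position r of the one before. `C` reads an
  -- overlapping index in the earlier block, so b = 0 with J > 0 is treated separately, J = 1
  -- falling back to the base series.
  C≡block : ∀ s J b → b ≤ suc s → ∀ m → C (2 + s) (suc s * J + suc b) m ≡ block (2 + s) J (suc b) m
  C≡block s zero b b≤ m = trans (cong (λ N → C (2 + s) N m) (cong (_+ suc b) (*-zeroʳ (suc s)))) (C-small s (s≤s b≤) m)
  C≡block s (suc zero) zero b≤ m = trans (cong (λ N → C (2 + s) N m) (ident s)) (C-small s ≤-refl m)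
    where
    ident : ∀ s → (1 + s) * 1 + 1 ≡ 2 + s
    ident = solve-∀
  C≡block s (suc (suc J)) zero b≤ m = trans (cong (λ N → C (2 + s) N m) (ident s J)) (C-large s s J ≤-refl m)
    where
    ident : ∀ s J → (1 + s) * (2 + J) + 1 ≡ 2 + (s + (1 + J) * (1 + s))
    ident = solve-∀
  C≡block s (suc J) (suc b) (s≤s b≤s) m = trans (cong (λ N → C (2 + s) N m) (ident s J b)) (C-large s b J b≤s m)
    where
    ident : ∀ s J b → (1 + s) * (1 + J) + (2 + b) ≡ 2 + (b + (1 + J) * (1 + s))
    ident = solve-∀

  C≡series : ∀ J k b → 2 ≤ suc (k + b) → ∀ m → C (suc (k + b)) ((k + b) * J + suc b) m ≡ series (E J k b) m
  C≡series J k b 2≤r m = trans (go (k + b) 2≤r (m≤n+m b k)) (block≡series J k b m)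
    where
    go : ∀ x → 2 ≤ suc x → b ≤ x → C (suc x) (x * J + suc b) m ≡ block (suc x) J (suc b) m
    go (suc s) _ b≤ = C≡block s J b b≤ m
    go zero (s≤s ()) _

-- Assembly, with k = i - 1 and b = r - i.

open import Data.Nat using (_+_; _*_)
open ≡ using (refl; sym; trans; cong)
open ℕₚ

theorem2p5 : (r i J : ℕ) → 2 ≤ r → 1 ≤ i → i ≤ r →
    (∀ (m : ℤ) → m ℤ.< + 0 → C r ((r ∸ 1) * J + (r ∸ i + 1)) m ≡ + 0)
    × (∀ (n : ℕ) → Σ ℕ λ N →
         (C r ((r ∸ 1) * J + (r ∸ i + 1)) (+ n) ≡ + N)
         × HPoddCoeff r (2 * J + 1) i n N)
theorem2p5 (suc x) (suc k) J 2≤r 1≤i (s≤s k≤x) =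
    (λ { (+ n) (ℤ.+<+ ()) ; -[1+ n ] _ → C≡ x k+b≡x 2≤r -[1+ n ] }) ,
    (λ n → E J k b n , C≡ x k+b≡x 2≤r (+ n) ,
      -- Monomials of weight n have n exponents, the first 2J of them zero, so the count comes with
      -- length n - 2J, while `E` uses length n.
      Sizes.size-≡ (trans (hp-stable (suc x) J (suc k) (n ∸ 2 * J) n (s≤s z≤n) (s≤s k≤x) (s≤s (m≤n+m∸n n (2 * J))))
                          (cong (λ y → hp (suc y) J (suc k) n) (sym k+b≡x)))
        (Ideals.std-size (suc x) 2≤r J (suc k) n (s≤s z≤n) (s≤s k≤x)))
  where
  open Coefficients
  b = x ∸ k
  k+b≡x : k + b ≡ x
  k+b≡x = m+[n∸m]≡n k≤x
  C≡ : ∀ x → k + b ≡ x → 2 ≤ suc x → ∀ m → C (suc x) (x * J + (b + 1)) m ≡ Recursion.series (E J k b) m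
  C≡ x refl 2≤r m = trans (cong (λ c → C (suc x) (x * J + c) m) (+-comm b 1)) (Recursion.C≡series J k b 2≤r m)
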